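{- Let $a_1,\dots,a_s$ be positive integers with $\max\{a_1,\dots,a_s\} = 7$ and let $m = \sum_{i=1}^{s}(a_i - 1) + 1$. If $m \ge 13$, then $$F_v(a_1, \dots, a_s; 8) \ge 3m - 10.$$
   Context: All graphs are finite, simple and undirected; $\omega(G)$ denotes the clique number. $G \overset{v}{\rightarrow} (a_1, \dots, a_s)$ means that for every coloring of the vertices of $G$ in $s$ colors there exists $i$ such that $G$ contains an $a_i$-clique all of whose vertices have color $i$. The vertex Folkman number is $F_v(a_1, \dots, a_s; q) = \min\{|V(G)| : G \overset{v}{\rightarrow} (a_1,\dots,a_s) \text{ and } \omega(G) < q\}$. -}

module Defs where

open import Data.Nat using (ℕ; suc; _+_; _∸_)
open import Data.Bool using (Bool; true; false)
open import Data.Fin using (Fin)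
open import Data.Product using (Σ; ∃; _×_)
open import Relation.Binary.PropositionalEquality using (_≡_; _≢_)
open import Data.Vec.Functional using (foldr)
open import Relation.Nullary using (¬_)

record Graph (n : ℕ) : Set where
  field
    adj   : Fin n → Fin n → Bool
    sym   : ∀ u v → adj u v ≡ adj v u
    irrefl : ∀ v → adj v v ≡ false
open Graph public

IsClique : ∀ {n k} → Graph n → (Fin k → Fin n) → Set
IsClique G f = ∀ i j → i ≢ j → adj G (f i) (f j) ≡ true

HasClique : ∀ {n} → Graph n → ℕ → Set
HasClique {n} G k = Σ (Fin k → Fin n) λ f → IsClique G f

CliqueNumberLt : ∀ {n} → Graph n → ℕ → Set
CliqueNumberLt G q = ¬ HasClique G q

VArrows : ∀ {n} → Graph n → (s : ℕ) → (Fin s → ℕ) → Set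
VArrows {n} G s a =
  (c : Fin n → Fin s) →
  ∃ λ (i : Fin s) → Σ (Fin (a i) → Fin n) λ f → IsClique G f × (∀ j → c (f j) ≡ i)

mOf : (s : ℕ) → (Fin s → ℕ) → ℕ
mOf s a = foldr (λ x acc → (x ∸ 1) + acc) 0 a + 1

{-# OPTIONS --safe #-}
module Submission where

open import Defs hiding (sym)
open import Defs using () renaming (sym to adj-sym)
open import Data.Nat using (ℕ; zero; suc; _+_; _*_; _∸_; _≤_; _<_; z≤n; s≤s; _≤ᵇ_; _≤?_)
open import Data.Nat.Properties hiding (_≟_)
open import Data.Bool as Bool using (Bool; true; false; _∧_; _∨_; _xor_; not; if_then_else_)
open import Data.Bool.Properties using (∨-zeroʳ; xor-comm; xor-same; ∧-zeroʳ)
open import Data.Fin using (Fin; zero; suc)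
open import Data.Fin.Properties using (_≟_; any?; all?)
open import Data.Vec using (Vec; []; _∷_; map; lookup; zipWith; replicate)
import Data.Vec.Functional as Vector
open import Data.List using (List; []; _∷_)
import Data.List as List
open import Data.List.Relation.Unary.Any as Any using (Any; here; there)
open import Data.List.Relation.Unary.Any.Properties using (++⁺ˡ; ++⁺ʳ; map⁺)
open import Data.Product using (Σ; ∃; _×_; _,_; proj₁; proj₂)
open import Data.Sum using (_⊎_; inj₁; inj₂; [_,_]′)
open import Data.Empty using (⊥; ⊥-elim)
open import Data.Unit using (tt)
open import Function using (_∘_)
open import Relation.Nullary using (¬_; Dec; yes; no; does)
open import Relation.Nullary.Decidable using (⌊_⌋; dec-true; _×-dec_; _→-dec_; ¬?; map′)
open import Relation.Binary.PropositionalEquality hiding ([_])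

-- Let H be the complement of G, so that H has no independent set of 8 vertices, and let r = m − 7. If r cliques
-- of H can be deleted so that no independent set of 7 vertices is left ("H is broken by r cliques"), then giving
-- aᵢ − 1 of these cliques to every colour i except one with aᵢ = 7, and the rest of the vertices to that colour,
-- contradicts the arrow relation. So it suffices that 3r + 10 vertices can be broken by r ≥ 6 cliques.
-- Deleting a triangle of H shows that a minimal counterexample is triangle-free, hence has degrees at most 7, and
-- # N(E) ≥ # E + r for every independent set E, hence degrees at least r + 1, which settles r ≥ 7. For r = 6 a count of
-- the edges leaving N(v) suffices, and the induction has to be started with 14, 16, 19, 22, 25 vertices for
-- r = 1, …, 5. There one deletes a star with centre v, keeping one neighbour u of v: the sets that survive contain
-- u. By Hajnal's inequality the maximum independent sets among the vertices far from u and v have a large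
-- intersection C, so that deleting one edge between C and N(v) destroys all of them.

-- Linear arithmetic over ℕ

-- The line is anchored at r = 1, where the surplus inequality alone gives 14, one vertex more than
-- 3r + 10; this vertex pays for r = 2, where only an edge is deleted. From r = 3 on triangles are
-- excluded, but up to r = 5 the degree bound r + 1 stays below the maximal degree 7 and contradicts
-- nothing. What helps there is that a clique spent on a leaf of a star may be an edge, whose other
-- end is deleted at no cost. In a set with fewer than 2q vertices all independent q-sets share a
-- vertex, and this is the end to choose. If no leaf is adjacent to the common part, that part and u
-- form an independent set with a smallest possible neighbourhood, so the real obstacle is equality
-- in the surplus inequality. For r = 4 equality is excluded altogether. For r = 5 the star argument
-- is still one vertex short: degree 6 is excluded by looking at vertices at distance at least 3,
-- and degree 7 everywhere by parity.

data Lin (k : ℕ) : Set where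
  var : Fin k → Lin k
  κ   : ℕ → Lin k
  _⊕_ : Lin k → Lin k → Lin k

infixl 6 _⊕_
infix 4 _≲_by_ _⊑_by_

val : ∀ {k} → Lin k → Vec ℕ k → ℕ
val (var i) ρ = lookup ρ i
val (κ c)   ρ = c
val (a ⊕ b) ρ = val a ρ + val b ρ

unit : ∀ {k} → Fin k → Vec ℕ k
unit {suc k} zero    = 1 ∷ replicate k 0
unit (suc i) = 0 ∷ unit i

-- The constant term comes first and meets the leading 1 of `1 ∷ ρ`.
coeffs : ∀ {k} → Lin k → Vec ℕ (suc k)
coeffs (var i)     = 0 ∷ unit i
coeffs {k} (κ c)   = c ∷ replicate k 0
coeffs (a ⊕ b)     = zipWith _+_ (coeffs a) (coeffs b)

dot : ∀ {k} → Vec ℕ k → Vec ℕ k → ℕ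
dot []       []       = 0
dot (a ∷ as) (x ∷ xs) = a * x + dot as xs

dot-0 : ∀ {k} (ρ : Vec ℕ k) → dot (replicate k 0) ρ ≡ 0
dot-0 []      = refl
dot-0 (x ∷ ρ) = dot-0 ρ

dot-unit : ∀ {k} (i : Fin k) (ρ : Vec ℕ k) → dot (unit i) ρ ≡ lookup ρ i
dot-unit zero    (x ∷ ρ) = trans (cong₂ _+_ (+-identityʳ x) (dot-0 ρ)) (+-identityʳ x)
dot-unit (suc i) (x ∷ ρ) = dot-unit i ρ

interchange : ∀ a b c d → (a + b) + (c + d) ≡ (a + c) + (b + d)
interchange a b c d = trans (+-assoc a b (c + d)) (trans (cong (a +_) (trans (sym (+-assoc b c d))
  (trans (cong (_+ d) (+-comm b c)) (+-assoc c b d)))) (sym (+-assoc a c (b + d))))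

dot-+ : ∀ {k} (a b ρ : Vec ℕ k) → dot (zipWith _+_ a b) ρ ≡ dot a ρ + dot b ρ
dot-+ []      []      []      = refl
dot-+ (a ∷ as) (b ∷ bs) (x ∷ ρ) =
  trans (cong₂ _+_ (*-distribʳ-+ x a b) (dot-+ as bs ρ)) (interchange (a * x) (b * x) _ _)

val-coeffs : ∀ {k} (a : Lin k) ρ → val a ρ ≡ dot (coeffs a) (1 ∷ ρ)
val-coeffs (var i) ρ = sym (dot-unit i ρ)
val-coeffs (κ c)   ρ = sym (trans (cong₂ _+_ (*-identityʳ c) (dot-0 ρ)) (+-identityʳ c))
val-coeffs (a ⊕ b) ρ = trans (cong₂ _+_ (val-coeffs a ρ) (val-coeffs b ρ)) (sym (dot-+ (coeffs a) (coeffs b) (1 ∷ ρ)))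

_≤ᵛ_ : ∀ {k} → Vec ℕ k → Vec ℕ k → Bool
[]       ≤ᵛ []       = true
(a ∷ as) ≤ᵛ (b ∷ bs) = (a ≤ᵇ b) ∧ (as ≤ᵛ bs)

T-∧ˡ : ∀ {a b} → Bool.T (a ∧ b) → Bool.T a
T-∧ˡ {true} _ = tt

T-∧ʳ : ∀ {a b} → Bool.T (a ∧ b) → Bool.T b
T-∧ʳ {true} t = t

dot-mono : ∀ {k} (a b ρ : Vec ℕ k) → Bool.T (a ≤ᵛ b) → dot a ρ ≤ dot b ρ
dot-mono []       []       []      _ = z≤n
dot-mono (a ∷ as) (b ∷ bs) (x ∷ ρ) t =
  +-mono-≤ (*-monoˡ-≤ x (≤ᵇ⇒≤ a b (T-∧ˡ t))) (dot-mono as bs ρ (T-∧ʳ {a ≤ᵇ b} t))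

data Hyp {k} (ρ : Vec ℕ k) : Set where
  _≲_by_ : (a b : Lin k) → val a ρ ≤ val b ρ → Hyp ρ

-- Hypotheses are added with coefficient 1, so one that is needed with a larger coefficient is
-- listed several times.
lhs rhs : ∀ {k} {ρ : Vec ℕ k} → List (Hyp ρ) → Lin k
lhs []                = κ 0
lhs ((a ≲ b by h) ∷ hs) = a ⊕ lhs hs
rhs []                = κ 0
rhs ((a ≲ b by h) ∷ hs) = b ⊕ rhs hs

hyps : ∀ {k} {ρ : Vec ℕ k} (hs : List (Hyp ρ)) → val (lhs hs) ρ ≤ val (rhs hs) ρ
hyps []                  = z≤n
hyps ((a ≲ b by h) ∷ hs) = +-mono-≤ h (hyps hs)

-- The goal a ≤ b follows from the sum l ≤ r of the hypotheses as soon as a + r ≤ b + l coefficientwise.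
lin : ∀ {k} (ρ : Vec ℕ k) (hs : List (Hyp ρ)) (a b : Lin k)
      {_ : Bool.T (coeffs (a ⊕ rhs hs) ≤ᵛ coeffs (b ⊕ lhs hs))} → val a ρ ≤ val b ρ
lin ρ hs a b {t} = +-cancelʳ-≤ (val (rhs hs) ρ) _ _ (≤-trans
  (subst₂ _≤_ (sym (val-coeffs (a ⊕ rhs hs) ρ)) (sym (val-coeffs (b ⊕ lhs hs) ρ))
    (dot-mono (coeffs (a ⊕ rhs hs)) (coeffs (b ⊕ lhs hs)) (1 ∷ ρ) t))
  (+-monoʳ-≤ (val b ρ) (hyps hs)))

absurd : ∀ {k} (ρ : Vec ℕ k) (hs : List (Hyp ρ))
         {_ : Bool.T (coeffs (κ {k} 1 ⊕ rhs hs) ≤ᵛ coeffs (κ 0 ⊕ lhs hs))} → ⊥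
absurd {k} ρ hs {t} = 1+n≰n (lin {k} ρ hs (κ 1) (κ 0) {t})

-- Finite sets of vertices and their sizes

VS : ℕ → Set
VS n = Fin n → Bool

infix 4 _∈_ _∉_ _⊆_

-- A record rather than a synonym of `A x ≡ true`, so that unification can recover `x` and `A` from
-- the type of a proof.
record _∈_ {n} (x : Fin n) (A : VS n) : Set where
  constructor mem
  field holds : A x ≡ true
open _∈_

_∉_ : ∀ {n} → Fin n → VS n → Set
x ∉ A = ¬ x ∈ A

_⊆_ : ∀ {n} → VS n → VS n → Set
A ⊆ B = ∀ {x} → x ∈ A → x ∈ B

ι : Bool → ℕ
ι true  = 1
ι false = 0

∑ : ∀ {n} → (Fin n → ℕ) → ℕ
∑ {zero}  f = 0
∑ {suc n} f = f zero + ∑ (f ∘ suc)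

∑-mono : ∀ {n} {f g : Fin n → ℕ} → (∀ x → f x ≤ g x) → ∑ f ≤ ∑ g
∑-mono {zero}  h = z≤n
∑-mono {suc n} h = +-mono-≤ (h zero) (∑-mono (h ∘ suc))

∑-cong : ∀ {n} {f g : Fin n → ℕ} → (∀ x → f x ≡ g x) → ∑ f ≡ ∑ g
∑-cong h = ≤-antisym (∑-mono (λ x → ≤-reflexive (h x))) (∑-mono (λ x → ≤-reflexive (sym (h x))))

∑-+ : ∀ {n} (f g : Fin n → ℕ) → ∑ (λ x → f x + g x) ≡ ∑ f + ∑ g
∑-+ {zero}  f g = refl
∑-+ {suc n} f g = trans (cong (f zero + g zero +_) (∑-+ (f ∘ suc) (g ∘ suc)))
  (interchange (f zero) (g zero) _ _)

infixl 7 _∩_ _∖_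
infixl 6 _∪_

-- Opaque, so that set expressions keep their shape in goals and implicit sets can be inferred.
opaque
  # : ∀ {n} → VS n → ℕ
  # A = ∑ (ι ∘ A)

  _∪_ _∩_ _∖_ : ∀ {n} → VS n → VS n → VS n
  (A ∪ B) x = A x ∨ B x
  (A ∩ B) x = A x ∧ B x
  (A ∖ B) x = A x ∧ not (B x)

  ∅ full : ∀ {n} → VS n
  ∅ _ = false
  full _ = true

  ｛_｝ : ∀ {n} → Fin n → VS n
  ｛ v ｝ x = ⌊ v ≟ x ⌋

  ∈∪ˡ : ∀ {n} {A B : VS n} {x} → x ∈ A → x ∈ A ∪ B
  ∈∪ˡ (mem p) = mem (cong (_∨ _) p)

  ∈∪ʳ : ∀ {n} {A B : VS n} {x} → x ∈ B → x ∈ A ∪ B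
  ∈∪ʳ {A = A} {x = x} (mem p) = mem (trans (cong (A x ∨_) p) (∨-zeroʳ (A x)))

  ∈∪⁻ : ∀ {n} {A B : VS n} {x} → x ∈ A ∪ B → x ∈ A ⊎ x ∈ B
  ∈∪⁻ {A = A} {x = x} (mem p) with A x in q
  ... | true  = inj₁ (mem q)
  ... | false = inj₂ (mem p)

  ∈∩ : ∀ {n} {A B : VS n} {x} → x ∈ A → x ∈ B → x ∈ A ∩ B
  ∈∩ (mem p) (mem q) = mem (cong₂ _∧_ p q)

  ∈∩ˡ : ∀ {n} {A B : VS n} {x} → x ∈ A ∩ B → x ∈ A
  ∈∩ˡ {A = A} {x = x} (mem p) with A x in q
  ... | true = mem q

  ∈∩ʳ : ∀ {n} {A B : VS n} {x} → x ∈ A ∩ B → x ∈ B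
  ∈∩ʳ {A = A} {x = x} (mem p) with A x
  ... | true = mem p

  ∈∖ : ∀ {n} {A B : VS n} {x} → x ∈ A → x ∉ B → x ∈ A ∖ B
  ∈∖ {B = B} {x} (mem p) q with B x in r
  ... | true  = ⊥-elim (q (mem r))
  ... | false = mem (trans (cong₂ _∧_ p (cong not r)) refl)

  ∈∖ˡ : ∀ {n} {A B : VS n} {x} → x ∈ A ∖ B → x ∈ A
  ∈∖ˡ = ∈∩ˡ

  ∈∖ʳ : ∀ {n} {A B : VS n} {x} → x ∈ A ∖ B → x ∉ B
  ∈∖ʳ {A = A} {B} {x} (mem p) (mem q) with A x | B x
  ∈∖ʳ (mem ()) (mem refl) | true | true

  ∉∅ : ∀ {n} {x : Fin n} → x ∉ ∅
  ∉∅ (mem ())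

  ∈full : ∀ {n} {x : Fin n} → x ∈ full
  ∈full = mem refl

  ∈｛｝ : ∀ {n} {v : Fin n} → v ∈ ｛ v ｝
  ∈｛｝ {v = v} with v ≟ v in q
  ... | yes _ = mem (cong ⌊_⌋ q)
  ... | no  p = ⊥-elim (p refl)

  ｛｝⁻ : ∀ {n} {v x : Fin n} → x ∈ ｛ v ｝ → v ≡ x
  ｛｝⁻ {v = v} {x} (mem p) with v ≟ x
  ... | yes q = q

-- Boolean combinations of given sets, and sums of their sizes

data Form (k : ℕ) : Set where
  var       : Fin k → Form k
  _∧ᶠ_ _∨ᶠ_ _∖ᶠ_ : Form k → Form k → Form k
  ff        : Form k

infixl 7 _∧ᶠ_ _∖ᶠ_
infixl 6 _∨ᶠ_

data Size (k : ℕ) : Set where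
  ⟨_⟩ : Form k → Size k
  _⊕_ : Size k → Size k → Size k

-- Shared by `Lin` and `Form`, whose constructors for variables have the same name.
pattern x₀ = var zero
pattern x₁ = var (suc zero)
pattern x₂ = var (suc (suc zero))
pattern x₃ = var (suc (suc (suc zero)))
pattern x₄ = var (suc (suc (suc (suc zero))))
pattern x₅ = var (suc (suc (suc (suc (suc zero)))))
pattern x₆ = var (suc (suc (suc (suc (suc (suc zero))))))
pattern x₇ = var (suc (suc (suc (suc (suc (suc (suc zero)))))))
pattern x₈ = var (suc (suc (suc (suc (suc (suc (suc (suc zero))))))))
pattern x₉ = var (suc (suc (suc (suc (suc (suc (suc (suc (suc zero)))))))))

pattern x₁₀ = var (suc (suc (suc (suc (suc (suc (suc (suc (suc (suc zero))))))))))
pattern x₁₁ = var (suc (suc (suc (suc (suc (suc (suc (suc (suc (suc (suc zero)))))))))))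

⟦_⟧ : ∀ {k} → Form k → Vec Bool k → Bool
⟦ var i ⟧  ρ = lookup ρ i
⟦ F ∧ᶠ G ⟧ ρ = ⟦ F ⟧ ρ ∧ ⟦ G ⟧ ρ
⟦ F ∨ᶠ G ⟧ ρ = ⟦ F ⟧ ρ ∨ ⟦ G ⟧ ρ
⟦ F ∖ᶠ G ⟧ ρ = ⟦ F ⟧ ρ ∧ not (⟦ G ⟧ ρ)
⟦ ff ⟧     ρ = false

at : ∀ {n k} → Vec (VS n) k → Fin n → Vec Bool k
at As x = map (λ A → A x) As

set : ∀ {n k} → Vec (VS n) k → Form k → VS n
set As (var i)  = lookup As i
set As (F ∧ᶠ G) = set As F ∩ set As G
set As (F ∨ᶠ G) = set As F ∪ set As G
set As (F ∖ᶠ G) = set As F ∖ set As G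
set As ff       = ∅

opaque
  unfolding _∪_

  set-at : ∀ {n k} (As : Vec (VS n) k) F x → set As F x ≡ ⟦ F ⟧ (at As x)
  set-at As (var i)  x = lookup-map As i
    where
    lookup-map : ∀ {k} (Bs : Vec _ k) i → lookup Bs i x ≡ lookup (at Bs x) i
    lookup-map (B ∷ Bs) zero    = refl
    lookup-map (B ∷ Bs) (suc i) = lookup-map Bs i
  set-at As (F ∧ᶠ G) x = cong₂ _∧_ (set-at As F x) (set-at As G x)
  set-at As (F ∨ᶠ G) x = cong₂ _∨_ (set-at As F x) (set-at As G x)
  set-at As (F ∖ᶠ G) x = cong₂ (λ a b → a ∧ not b) (set-at As F x) (set-at As G x)
  set-at As ff       x = refl

size : ∀ {n k} → Vec (VS n) k → Size k → ℕ
size As ⟨ F ⟩   = # (set As F)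
size As (s ⊕ t) = size As s + size As t

weight : ∀ {k} → Vec Bool k → Size k → ℕ
weight ρ ⟨ F ⟩   = ι (⟦ F ⟧ ρ)
weight ρ (s ⊕ t) = weight ρ s + weight ρ t

opaque
  unfolding #

  size-weight : ∀ {n k} (As : Vec (VS n) k) s → size As s ≡ ∑ (λ x → weight (at As x) s)
  size-weight As ⟨ F ⟩   = ∑-cong (λ x → cong ι (set-at As F x))
  size-weight As (s ⊕ t) = trans (cong₂ _+_ (size-weight As s) (size-weight As t)) (sym (∑-+ (λ x → weight (at As x) s) _))

data Fact {n k} (As : Vec (VS n) k) : Set where
  _⊑_by_ : (F G : Form k) → set As F ⊆ set As G → Fact As

everywhere : ∀ {k} → (Vec Bool k → Bool) → Bool
everywhere {zero}  p = p []
everywhere {suc k} p = everywhere (p ∘ (true ∷_)) ∧ everywhere (p ∘ (false ∷_))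

everywhere-sound : ∀ {k} (p : Vec Bool k → Bool) → Bool.T (everywhere p) → ∀ ρ → Bool.T (p ρ)
everywhere-sound p t []          = t
everywhere-sound p t (true ∷ ρ)  = everywhere-sound (p ∘ (true ∷_)) (T-∧ˡ t) ρ
everywhere-sound p t (false ∷ ρ) =
  everywhere-sound (p ∘ (false ∷_)) (T-∧ʳ {everywhere (p ∘ (true ∷_))} t) ρ

-- A row of the truth table that violates a fact is realised by no vertex, so it counts as passed.
follows : ∀ {n k} {As : Vec (VS n) k} → List (Fact As) → Size k → Size k → Vec Bool k → Bool
follows []                  s t ρ = weight ρ s ≤ᵇ weight ρ t
follows ((F ⊑ G by h) ∷ fs) s t ρ = (⟦ F ⟧ ρ ∧ not (⟦ G ⟧ ρ)) ∨ follows fs s t ρ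

follows-sound : ∀ {n k} {As : Vec (VS n) k} (fs : List (Fact As)) s t x →
                Bool.T (follows fs s t (at As x)) → weight (at As x) s ≤ weight (at As x) t
follows-sound []                  s t x p = ≤ᵇ⇒≤ _ _ p
follows-sound {As = As} ((F ⊑ G by h) ∷ fs) s t x p = go _ _ (λ q → trans (sym (set-at As G x)) (holds (h (mem (trans (set-at As F x) q))))) p
  where
  go : ∀ a b → (a ≡ true → b ≡ true) → Bool.T ((a ∧ not b) ∨ follows fs s t (at As x)) →
       weight (at As x) s ≤ weight (at As x) t
  go true  true  _ q = follows-sound fs s t x q
  go true  false i q with i refl
  ... | ()
  go false b     _ q = follows-sound fs s t x q

-- Pointwise, hence decided by a truth table.
count : ∀ {n k} (As : Vec (VS n) k) (fs : List (Fact As)) (s t : Size k)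
        {_ : Bool.T (everywhere (follows fs s t))} → size As s ≤ size As t
count As fs s t {p} = subst₂ _≤_ (sym (size-weight As s)) (sym (size-weight As t))
  (∑-mono (λ x → follows-sound fs s t x (everywhere-sound (follows fs s t) p (at As x))))

∪⊆ : ∀ {n} {A B C : VS n} → A ⊆ C → B ⊆ C → A ∪ B ⊆ C
∪⊆ f g p = [ f , g ]′ (∈∪⁻ p)

∖≢ : ∀ {n} {A : VS n} {x y} → y ∈ A ∖ ｛ x ｝ → x ≢ y
∖≢ {x = x} p r = ∈∖ʳ p (subst (_∈ ｛ x ｝) r ∈｛｝)

infix 4 _∈?_
_∈?_ : ∀ {n} (x : Fin n) (A : VS n) → Dec (x ∈ A)
x ∈? A with A x in q
... | true  = yes (mem q)
... | false = no λ { (mem p) → false≢true (trans (sym q) p) }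
  where
  false≢true : false ≢ true
  false≢true ()

∉-resp : ∀ {n} {A : VS n} {x y} → x ∈ A → y ∉ A → x ≢ y
∉-resp p q refl = q p

some? : ∀ {n} (A : VS n) → (∃ λ x → x ∈ A) ⊎ (∀ {x} → x ∉ A)
some? A with any? (_∈? A)
... | yes p = inj₁ p
... | no  p = inj₂ λ q → p (_ , q)

#-mono : ∀ {n} {A B : VS n} → A ⊆ B → # A ≤ # B
#-mono {A = A} {B} h = count (A ∷ B ∷ []) ((x₀ ⊑ x₁ by h) ∷ []) ⟨ x₀ ⟩ ⟨ x₁ ⟩

opaque
  unfolding #

  #∅ : ∀ {n} {A : VS n} → (∀ {x} → x ∉ A) → # A ≡ 0
  #∅ {zero}      h = refl
  #∅ {suc n} {A} h with A zero in q
  ... | true  = ⊥-elim (h (mem q))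
  ... | false = #∅ {n} {A ∘ suc} (λ { (mem p) → h (mem p) })

  #｛｝ : ∀ {n} (v : Fin n) → # ｛ v ｝ ≡ 1
  #｛｝ {suc n} zero    = cong suc (#∅ {n} λ { (mem ()) })
  #｛｝ (suc v) = trans (∑-cong λ x → cong ι (eq x)) (#｛｝ v)
    where
    eq : ∀ x → ⌊ suc v ≟ suc x ⌋ ≡ ⌊ v ≟ x ⌋
    eq x with v ≟ x
    ... | yes refl = refl
    ... | no  _    = refl

｛｝⊆ : ∀ {n} {A : VS n} {v} → v ∈ A → ｛ v ｝ ⊆ A
｛｝⊆ {A = A} p q = subst (_∈ A) (｛｝⁻ q) p

#-pos : ∀ {n} {A : VS n} {x} → x ∈ A → 1 ≤ # A
#-pos {x = x} p = ≤-trans (≤-reflexive (sym (#｛｝ x))) (#-mono (｛｝⊆ p))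

opaque
  #-inhabited : ∀ {n} {A : VS n} → 1 ≤ # A → ∃ λ x → x ∈ A
  #-inhabited {A = A} h with some? A
  ... | inj₁ p = p
  ... | inj₂ q = ⊥-elim (1+n≰n (≤-trans h (≤-reflexive (#∅ q))))

#-∖｛｝ : ∀ {n} {A : VS n} {v} → # A ≤ suc (# (A ∖ ｛ v ｝))
#-∖｛｝ {A = A} {v} = lin (# A ∷ # (A ∖ ｛ v ｝) ∷ # ｛ v ｝ ∷ [])
  ((x₀ ≲ x₁ ⊕ x₂ by count (A ∷ ｛ v ｝ ∷ []) [] ⟨ x₀ ⟩ (⟨ x₀ ∖ᶠ x₁ ⟩ ⊕ ⟨ x₁ ⟩))
  ∷ (x₂ ≲ κ 1 by ≤-reflexive (#｛｝ v)) ∷ []) x₀ (κ 1 ⊕ x₁)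

#-∖∈ : ∀ {n} {A : VS n} {v} → v ∈ A → suc (# (A ∖ ｛ v ｝)) ≤ # A
#-∖∈ {A = A} {v} p = lin (# A ∷ # (A ∖ ｛ v ｝) ∷ # ｛ v ｝ ∷ [])
  ((x₁ ⊕ x₂ ≲ x₀ by count (A ∷ ｛ v ｝ ∷ []) ((x₁ ⊑ x₀ by ｛｝⊆ p) ∷ []) (⟨ x₀ ∖ᶠ x₁ ⟩ ⊕ ⟨ x₁ ⟩) ⟨ x₀ ⟩)
  ∷ (κ 1 ≲ x₂ by ≤-reflexive (sym (#｛｝ v))) ∷ []) (κ 1 ⊕ x₁) x₀

#-∖⊆ : ∀ {n} {A K : VS n} → K ⊆ A → # (A ∖ K) + # K ≡ # A
#-∖⊆ {A = A} {K} h = ≤-antisym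
  (count (A ∷ K ∷ []) ((x₁ ⊑ x₀ by h) ∷ []) (⟨ x₀ ∖ᶠ x₁ ⟩ ⊕ ⟨ x₁ ⟩) ⟨ x₀ ⟩)
  (count (A ∷ K ∷ []) [] ⟨ x₀ ⟩ (⟨ x₀ ∖ᶠ x₁ ⟩ ⊕ ⟨ x₁ ⟩))

#-∪｛｝ : ∀ {n} {A : VS n} {v} → v ∉ A → # A + 1 ≤ # (A ∪ ｛ v ｝)
#-∪｛｝ {A = A} {v} h = lin (# A ∷ # ｛ v ｝ ∷ # (A ∪ ｛ v ｝) ∷ [])
  ((x₀ ⊕ x₁ ≲ x₂ by count (A ∷ ｛ v ｝ ∷ []) ((x₀ ∧ᶠ x₁ ⊑ ff by λ p → ⊥-elim (h (subst (_∈ A) (sym (｛｝⁻ (∈∩ʳ p))) (∈∩ˡ p)))) ∷ []) (⟨ x₀ ⟩ ⊕ ⟨ x₁ ⟩) ⟨ x₀ ∨ᶠ x₁ ⟩)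
  ∷ (κ 1 ≲ x₁ by ≤-reflexive (sym (#｛｝ v))) ∷ []) (x₀ ⊕ κ 1) x₂

opaque
  two : ∀ {n} {A : VS n} → 2 ≤ # A → ∃ λ x → ∃ λ y → x ∈ A × y ∈ A × x ≢ y
  two {A = A} h with #-inhabited {A = A} (≤-trans (s≤s z≤n) h)
  ... | x , p with #-inhabited {A = A ∖ ｛ x ｝} (≤-pred (≤-trans h #-∖｛｝))
  ...   | y , q = x , y , p , ∈∖ˡ q , ∖≢ q

opaque
  shrink : ∀ {n} k {A : VS n} → k ≤ # A → Σ (VS n) λ K → K ⊆ A × # K ≡ k
  shrink zero    h = ∅ , (λ p → ⊥-elim (∉∅ p)) , #∅ ∉∅
  shrink (suc k) {A} h with #-inhabited {A = A} (≤-trans (s≤s z≤n) h)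
  ... | x , p with shrink k {A ∖ ｛ x ｝} (≤-pred (≤-trans h #-∖｛｝))
  ...   | K , K⊆ , refl = K ∪ ｛ x ｝ , (λ q → go (∈∪⁻ q)) , ≤-antisym
        (lin (# K ∷ # ｛ x ｝ ∷ # (K ∪ ｛ x ｝) ∷ [])
          ((x₂ ≲ x₀ ⊕ x₁ by count (K ∷ ｛ x ｝ ∷ []) [] ⟨ x₀ ∨ᶠ x₁ ⟩ (⟨ x₀ ⟩ ⊕ ⟨ x₁ ⟩))
          ∷ (x₁ ≲ κ 1 by ≤-reflexive (#｛｝ x)) ∷ []) x₂ (κ 1 ⊕ x₀))
        (lin (# K ∷ # ｛ x ｝ ∷ # (K ∪ ｛ x ｝) ∷ [])
          ((x₀ ⊕ x₁ ≲ x₂ by count (K ∷ ｛ x ｝ ∷ []) ((x₀ ∧ᶠ x₁ ⊑ ff by λ r → ⊥-elim (∈∖ʳ (K⊆ (∈∩ˡ r)) (∈∩ʳ r))) ∷ [])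
            (⟨ x₀ ⟩ ⊕ ⟨ x₁ ⟩) ⟨ x₀ ∨ᶠ x₁ ⟩)
          ∷ (κ 1 ≲ x₁ by ≤-reflexive (sym (#｛｝ x))) ∷ []) (κ 1 ⊕ x₀) x₂)
    where
    go : ∀ {y} → y ∈ K ⊎ y ∈ ｛ x ｝ → y ∈ A
    go (inj₁ r) = ∈∖ˡ (K⊆ r)
    go (inj₂ r) = ｛｝⊆ p r

-- Double counting

∑-swap : ∀ {m n} (f : Fin m → Fin n → ℕ) → ∑ (λ x → ∑ (f x)) ≡ ∑ (λ y → ∑ (λ x → f x y))
∑-swap {zero} {n} f = sym (zeros n)
  where
  zeros : ∀ n → ∑ {n} (λ _ → 0) ≡ 0
  zeros zero    = refl
  zeros (suc n) = zeros n
∑-swap {suc m} f = trans (cong (∑ (f zero) +_) (∑-swap (f ∘ suc))) (sym (∑-+ (f zero) _))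

∑-* : ∀ {n} c (f : Fin n → ℕ) → ∑ (λ x → c * f x) ≡ c * ∑ f
∑-* {zero}  c f = sym (*-zeroʳ c)
∑-* {suc n} c f = trans (cong (c * f zero +_) (∑-* c (f ∘ suc))) (sym (*-distribˡ-+ c (f zero) _))

-- By symmetry the first row and the first column have the same sum off the diagonal; removing both
-- leaves a smaller array of the same kind.
∑∑-even : ∀ {n} (f : Fin n → Fin n → ℕ) → (∀ x y → f x y ≡ f y x) → (∀ x → f x x ≡ 0) →
          ∃ λ h → ∑ (λ x → ∑ (f x)) ≡ h + h
∑∑-even {zero}  f s d = 0 , refl
∑∑-even {suc n} f s d with ∑∑-even (λ x y → f (suc x) (suc y)) (λ x y → s (suc x) (suc y)) (d ∘ suc)
... | h , eq = r + h , trans (cong₂ _+_ (cong (_+ r) (d zero))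
      (trans (∑-+ (λ x → f (suc x) zero) _) (cong₂ _+_ (∑-cong λ x → s (suc x) zero) eq)))
      (trans (sym (+-assoc r r (h + h))) (interchange r r h h))
  where
  r = ∑ (f zero ∘ suc)


-- Enumeration of all vertex sets

subsets : ∀ n → List (VS n)
subsets zero    = (λ ()) ∷ []
subsets (suc n) = List.map (extend true) (subsets n) List.++ List.map (extend false) (subsets n)
  where
  extend : Bool → VS n → VS (suc n)
  extend b A zero    = b
  extend b A (suc x) = A x

-- Functions are not extensional, so a set is found only up to pointwise equality.
subsets-complete : ∀ {n} (J : VS n) → Any (λ K → ∀ x → K x ≡ J x) (subsets n)
subsets-complete {zero}  J = here λ ()
subsets-complete {suc n} J with J zero in q
... | true  = ++⁺ˡ (map⁺ (Any.map (λ h → λ { zero → sym q ; (suc x) → h x }) (subsets-complete (J ∘ suc))))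
... | false = ++⁺ʳ _ (map⁺ (Any.map (λ h → λ { zero → sym q ; (suc x) → h x }) (subsets-complete (J ∘ suc))))

⊆-dec : ∀ {n} (A B : VS n) → Dec (A ⊆ B)
⊆-dec A B = map′ (λ h {x} → h x) (λ h x → h) (all? λ x → (x ∈? A) →-dec (x ∈? B))

≗⇒⊆ : ∀ {n} {A B : VS n} → (∀ x → A x ≡ B x) → A ⊆ B
≗⇒⊆ h (mem p) = mem (trans (sym (h _)) p)

-- Independent sets, cliques, neighbourhoods, breaking, and Hajnal's inequality

module Graphs {n : ℕ} (e : Fin n → VS n) (e-sym : ∀ x y → e x y ≡ e y x) (e-irr : ∀ x → e x x ≡ false) where

  e⇄ : ∀ {x y} → y ∈ e x → x ∈ e y
  e⇄ {x} {y} (mem p) = mem (trans (e-sym y x) p)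

  e≢ : ∀ {x y} → y ∈ e x → x ≢ y
  e≢ {x} (mem p) refl with trans (sym p) (e-irr x)
  ... | ()

  Ind Clique : VS n → Set
  Ind J = ∀ {x y} → x ∈ J → y ∈ J → y ∉ e x
  Clique Q = ∀ {x y} → x ∈ Q → y ∈ Q → x ≢ y → y ∈ e x

  Ind-dec : ∀ J → Dec (Ind J)
  Ind-dec J = map′ (λ h {x} {y} → h x y) (λ h x y → h)
    (all? λ x → all? λ y → (x ∈? J) →-dec ((y ∈? J) →-dec ¬? (y ∈? e x)))

  Ind-⊆ : ∀ {I J} → I ⊆ J → Ind J → Ind I
  Ind-⊆ s i p q = i (s p) (s q)

  Ind-∪ : ∀ {I J} → Ind I → Ind J → (∀ {x y} → x ∈ I → y ∈ J → y ∉ e x) → Ind (I ∪ J)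
  Ind-∪ i j c p q r with ∈∪⁻ p | ∈∪⁻ q
  ... | inj₁ a | inj₁ b = i a b r
  ... | inj₁ a | inj₂ b = c a b r
  ... | inj₂ a | inj₁ b = c b a (e⇄ r)
  ... | inj₂ a | inj₂ b = j a b r

  Ind-｛｝ : ∀ {v} → Ind ｛ v ｝
  Ind-｛｝ p q r = e≢ r (trans (sym (｛｝⁻ p)) (｛｝⁻ q))

  Ind-∪｛｝ : ∀ {I v} → Ind I → (∀ {x} → x ∈ I → x ∉ e v) → Ind (I ∪ ｛ v ｝)
  Ind-∪｛｝ i c = Ind-∪ i Ind-｛｝ λ p q r → c p (e⇄ (subst (_∈ e _) (sym (｛｝⁻ q)) r))

  Clique-∅ : Clique ∅
  Clique-∅ p = ⊥-elim (∉∅ p)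

  Clique-｛｝ : ∀ {v} → Clique ｛ v ｝
  Clique-｛｝ p q r = ⊥-elim (r (trans (sym (｛｝⁻ p)) (｛｝⁻ q)))

  Clique-∪ : ∀ {P v} → Clique P → (∀ {x} → x ∈ P → x ∈ e v) → Clique (P ∪ ｛ v ｝)
  Clique-∪ c h p q r with ∈∪⁻ p | ∈∪⁻ q
  ... | inj₁ a | inj₁ b = c a b r
  ... | inj₁ a | inj₂ b rewrite sym (｛｝⁻ b) = e⇄ (h a)
  ... | inj₂ a | inj₁ b rewrite sym (｛｝⁻ a) = h b
  ... | inj₂ a | inj₂ b = ⊥-elim (r (trans (sym (｛｝⁻ a)) (｛｝⁻ b)))

  edge : Fin n → Fin n → VS n
  edge x y = ｛ x ｝ ∪ ｛ y ｝

  Clique-edge : ∀ {x y} → y ∈ e x → Clique (edge x y)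
  Clique-edge p = Clique-∪ Clique-｛｝ λ q → e⇄ (subst (λ x → _ ∈ e x) (｛｝⁻ q) p)

  opaque
    N : VS n → VS n → VS n
    N S E y = S y ∧ does (any? (λ x → x ∈? (E ∩ e y)))

    N-intro : ∀ {S E x y} → y ∈ S → x ∈ E → y ∈ e x → y ∈ N S E
    N-intro {S} {E} {x} {y} (mem p) q r = mem (cong₂ _∧_ p (dec-true (any? _) (x , ∈∩ q (e⇄ r))))

    N-elim : ∀ {S E y} → y ∈ N S E → y ∈ S × ∃ λ x → x ∈ E × y ∈ e x
    N-elim {S} {E} {y} (mem p) with S y in s | any? (λ x → x ∈? (E ∩ e y))
    ... | true | yes (x , q) = mem s , x , ∈∩ˡ q , e⇄ (∈∩ʳ q)

  N⊆ : ∀ {S E} → N S E ⊆ S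
  N⊆ p = proj₁ (N-elim p)

  N-∉ : ∀ {S E y} → Ind E → y ∈ N S E → y ∉ E
  N-∉ i p q with N-elim p
  ... | _ , x , r , s = i r q s

  N-mono : ∀ {S E E'} → E ⊆ E' → N S E ⊆ N S E'
  N-mono h p with N-elim p
  ... | s , x , q , r = N-intro s (h q) r

  N-｛｝ : ∀ {S v} → N S ｛ v ｝ ⊆ S ∩ e v
  N-｛｝ p with N-elim p
  ... | s , x , q , r = ∈∩ s (subst (λ x → _ ∈ e x) (sym (｛｝⁻ q)) r)

  N-｛｝⁺ : ∀ {S v} → S ∩ e v ⊆ N S ｛ v ｝
  N-｛｝⁺ p = N-intro (∈∩ˡ p) ∈｛｝ (∈∩ʳ p)

  NoInd : ℕ → VS n → Set
  NoInd k S = ∀ {J} → J ⊆ S → Ind J → k ≤ # J → ⊥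

  Bound : ℕ → VS n → Set
  Bound k S = ∀ {J} → J ⊆ S → Ind J → # J ≤ k

  Bound-⊆ : ∀ {k A B} → A ⊆ B → Bound k B → Bound k A
  Bound-⊆ s b j = b (s ∘ j)

  Br : ℕ → ℕ → VS n → Set
  Br k zero    S = NoInd k S
  Br k (suc r) S = Σ (VS n) λ Q → Clique Q × Br k r (S ∖ Q)

  ∖-mono : ∀ {A B Q : VS n} → A ⊆ B → A ∖ Q ⊆ B ∖ Q
  ∖-mono h p = ∈∖ (h (∈∖ˡ p)) (∈∖ʳ p)

  Br-⊆ : ∀ {k r S S'} → S' ⊆ S → Br k r S → Br k r S'
  Br-⊆ {r = zero}  h b j = b (h ∘ j)
  Br-⊆ {r = suc r} h (Q , c , b) = Q , c , Br-⊆ {r = r} (∖-mono h) b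

  Br-suc : ∀ {k r S} → Br k r S → Br k (suc r) S
  Br-suc {r = r} b = ∅ , Clique-∅ , Br-⊆ {r = r} ∈∖ˡ b

  data Cov : ℕ → VS n → Set where
    []  : ∀ {L} → (∀ {x} → x ∉ L) → Cov zero L
    _∷_ : ∀ {j L Q} → Clique Q → Cov j (L ∖ Q) → Cov (suc j) L

  -- A clique of the cover may reach outside `L`; deleting too much does no harm, since `Br` passes
  -- to subsets.
  Cov-Br : ∀ {k j r S L} → Cov j L → Br k r (S ∖ L) → Br k (j + r) S
  Cov-Br {r = r} ([] h)       b = Br-⊆ {r = r} (λ p → ∈∖ p h) b
  Cov-Br {j = suc j} {r} {S} {L} (_∷_ {Q = Q} c cs) b =
    Q , c , Cov-Br cs (Br-⊆ {r = r} {S = S ∖ L} (λ p → ∈∖ (∈∖ˡ (∈∖ˡ p)) λ q → ∈∖ʳ p (∈∖ q (∈∖ʳ (∈∖ˡ p)))) b)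

  Cov-⊆ : ∀ {j L L'} → L' ⊆ L → Cov j L → Cov j L'
  Cov-⊆ s ([] h)   = [] (h ∘ s)
  Cov-⊆ s (c ∷ cs) = c ∷ Cov-⊆ (∖-mono s) cs

  -- Hajnal: the intersection and the union of the independent sets of maximal size q have at least 2q elements together.
  record Core (q : ℕ) (X : VS n) : Set where
    field
      core hull : VS n
      core⊆ : ∀ {J} → Ind J → J ⊆ X → q ≤ # J → core ⊆ J
      ⊆hull : ∀ {J} → Ind J → J ⊆ X → q ≤ # J → J ⊆ hull
      hull⊆ : ∀ {x} → x ∈ hull → Σ (VS n) λ J → Ind J × J ⊆ X × q ≤ # J × x ∈ J
      some  : Σ (VS n) λ J → Ind J × J ⊆ X × q ≤ # J
      sizes : q + q ≤ # core + # hull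

  module _ {q : ℕ} {X : VS n} (bound : Bound q X) where

    Large : VS n → Set
    Large J = Ind J × J ⊆ X × q ≤ # J

    Large-dec : ∀ J → Dec (Large J)
    Large-dec J = Ind-dec J ×-dec (⊆-dec J X ×-dec (q ≤? # J))

    Large-resp : ∀ {J K} → (∀ x → K x ≡ J x) → Large J → Large K
    Large-resp h (i , s , l) = Ind-⊆ (≗⇒⊆ h) i , s ∘ ≗⇒⊆ h , ≤-trans l (#-mono (≗⇒⊆ (sym ∘ h)))

    -- The invariant of a recursion over a list of sets. The clause `core ⊆ J` in `hull⊆` puts every
    -- vertex of the hull into an independent set that contains the core, so no edge joins the two.
    record CoreOf (L : List (VS n)) : Set where
      field
        core hull : VS n
        core⊆ : ∀ {J} → Large J → Any (λ K → ∀ x → K x ≡ J x) L → core ⊆ J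
        ⊆hull : ∀ {J} → Large J → Any (λ K → ∀ x → K x ≡ J x) L → J ⊆ hull
        hull⊆ : ∀ {x} → x ∈ hull → Σ (VS n) λ J → Large J × core ⊆ J × x ∈ J
        some  : Σ (VS n) λ J → Large J × core ⊆ J × J ⊆ hull
        sizes : q + q ≤ # core + # hull

    coreOf : ∀ L → CoreOf L ⊎ (∀ {J} → Large J → ¬ Any (λ K → ∀ x → K x ≡ J x) L)
    coreOf [] = inj₂ λ _ ()
    coreOf (K ∷ L) with Large-dec K | coreOf L
    ... | no ¬l | inj₂ none = inj₂ λ { l (here h) → ¬l (Large-resp h l) ; l (there a) → none l a }
    ... | no ¬l | inj₁ c = inj₁ record
      { CoreOf c hiding (core⊆; ⊆hull)
      ; core⊆ = λ { l (here h) → ⊥-elim (¬l (Large-resp h l)) ; l (there a) → CoreOf.core⊆ c l a }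
      ; ⊆hull = λ { l (here h) → ⊥-elim (¬l (Large-resp h l)) ; l (there a) → CoreOf.⊆hull c l a } }
    ... | yes l | inj₂ none = inj₁ record
      { core = K ; hull = K
      ; core⊆ = λ { _ (here h) → ≗⇒⊆ h ; l' (there a) → ⊥-elim (none l' a) }
      ; ⊆hull = λ { _ (here h) → ≗⇒⊆ (sym ∘ h) ; l' (there a) → ⊥-elim (none l' a) }
      ; hull⊆ = λ p → K , l , (λ p → p) , p
      ; some  = K , l , (λ p → p) , (λ p → p)
      ; sizes = +-mono-≤ (proj₂ (proj₂ l)) (proj₂ (proj₂ l)) }
    ... | yes l | inj₁ c = inj₁ record
      { core = core ∩ K ; hull = hull ∪ K
      ; core⊆ = λ { _ (here h) → ≗⇒⊆ h ∘ ∈∩ʳ ; l' (there a) → core⊆ l' a ∘ ∈∩ˡ }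
      ; ⊆hull = λ { _ (here h) → ∈∪ʳ ∘ ≗⇒⊆ (sym ∘ h) ; l' (there a) → ∈∪ˡ ∘ ⊆hull l' a }
      ; hull⊆ = λ p → hull⊆′ (∈∪⁻ p)
      ; some  = K , l , ∈∩ʳ , ∈∪ʳ
      ; sizes = lin (# core ∷ # hull ∷ # K ∷ # I ∷ # (core ∩ K) ∷ # (hull ∪ K) ∷ q ∷ [])
          ((x₀ ⊕ x₁ ⊕ x₂ ≲ x₄ ⊕ x₅ ⊕ x₃ by count (core ∷ hull ∷ K ∷ []) ((x₀ ⊑ x₁ by core⊆hull) ∷ [])
              (⟨ x₀ ⟩ ⊕ ⟨ x₁ ⟩ ⊕ ⟨ x₂ ⟩) (⟨ x₀ ∧ᶠ x₂ ⟩ ⊕ ⟨ x₁ ∨ᶠ x₂ ⟩ ⊕ ⟨ x₀ ∨ᶠ x₁ ∧ᶠ x₂ ⟩))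
          ∷ (x₃ ≲ x₆ by bound I⊆ I-ind)
          ∷ (x₆ ≲ x₂ by proj₂ (proj₂ l))
          ∷ (x₆ ⊕ x₆ ≲ x₀ ⊕ x₁ by sizes) ∷ []) (x₆ ⊕ x₆) (x₄ ⊕ x₅) }
      where
      open CoreOf c
      -- As `core ⊆ hull`, adding `K` changes # core + # hull by # K - # I. No edge joins core and
      -- hull, so `I` is independent and # I ≤ q ≤ # K.
      I = core ∪ hull ∩ K
      hull⊆′ : ∀ {x} → x ∈ hull ⊎ x ∈ K → Σ (VS n) λ J → Large J × core ∩ K ⊆ J × x ∈ J
      hull⊆′ (inj₁ p) = let J , l' , s , p' = hull⊆ p in J , l' , (λ r → s (∈∩ˡ r)) , p'
      hull⊆′ (inj₂ p) = K , l , ∈∩ʳ , p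
      core⊆hull : core ⊆ hull
      core⊆hull p = let _ , _ , s , t = some in t (s p)
      coreX : core ⊆ X
      coreX p = let _ , l' , s , _ = some in proj₁ (proj₂ l') (s p)
      core-ind : Ind core
      core-ind p q = let _ , l' , s , _ = some in proj₁ l' (s p) (s q)
      I⊆ : I ⊆ X
      I⊆ = [ coreX , proj₁ (proj₂ l) ∘ ∈∩ʳ ]′ ∘ ∈∪⁻
      I-ind : Ind I
      I-ind = Ind-∪ core-ind (Ind-⊆ ∈∩ʳ (proj₁ l)) λ p r →
        let _ , l' , s , r' = hull⊆ (∈∩ˡ r) in proj₁ l' (s p) r'

    opaque
      core? : Core q X ⊎ NoInd q X
      core? with coreOf (subsets n)
      ... | inj₂ none = inj₂ λ {J} s i l → none (i , s , l) (subsets-complete J)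
      ... | inj₁ c = inj₁ record
        { core = core ; hull = hull
        ; core⊆ = λ {J} i s l → core⊆ (i , s , l) (subsets-complete J)
        ; ⊆hull = λ {J} i s l → ⊆hull (i , s , l) (subsets-complete J)
        ; hull⊆ = λ p → let J , (i , s , l) , _ , r = hull⊆ p in J , i , s , l , r
        ; some  = let J , l , _ = some in J , l
        ; sizes = sizes }
        where open CoreOf c

  module _ {q : ℕ} {X : VS n} (c : Core q X) where
    open Core c

    core-X : core ⊆ X
    core-X p = let J , i , s , l = some in s (core⊆ i s l p)

    core-ind : Ind core
    core-ind p q = let J , i , s , l = some in i (core⊆ i s l p) (core⊆ i s l q)

    -- since no vertex of the hull has a neighbour in the core
    core-N : q + q + # (N X core) ≤ # core + # X
    core-N = lin (# core ∷ # hull ∷ # (N X core) ∷ # X ∷ q ∷ [])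
      ((x₄ ⊕ x₄ ≲ x₀ ⊕ x₁ by sizes)
      ∷ (x₁ ⊕ x₂ ≲ x₃ by count (hull ∷ N X core ∷ X ∷ [])
          ((x₀ ⊑ x₂ by λ p → let J , i , s , l , r = hull⊆ p in s r) ∷ (x₁ ⊑ x₂ by N⊆)
          ∷ (x₀ ∧ᶠ x₁ ⊑ ff by λ p → let J , i , s , l , r = hull⊆ (∈∩ˡ p) ; _ , x , a , b = N-elim (∈∩ʳ p) in
              ⊥-elim (i (core⊆ i s l a) r b)) ∷ []) (⟨ x₀ ⟩ ⊕ ⟨ x₁ ⟩) ⟨ x₂ ⟩) ∷ [])
      (x₄ ⊕ x₄ ⊕ x₂) (x₀ ⊕ x₃)

  opaque
    unfolding #

    double-count : ∀ {p q} (A Y : VS n) → (∀ {u} → u ∈ A → p ≤ # (Y ∩ e u)) →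
                   (∀ {y} → y ∈ Y → # (A ∩ e y) ≤ q) → p * # A ≤ q * # Y
    double-count {p} {q} A Y low up = begin
      p * # A                                            ≡⟨ ∑-* p (ι ∘ A) ⟨
      ∑ (λ u → p * ι (A u))                              ≤⟨ ∑-mono lowᵢ ⟩
      ∑ (λ u → ∑ (λ y → ι (A u ∧ (Y y ∧ e u y))))        ≡⟨ ∑-swap (λ u y → ι (A u ∧ (Y y ∧ e u y))) ⟩
      ∑ (λ y → ∑ (λ u → ι (A u ∧ (Y y ∧ e u y))))        ≤⟨ ∑-mono upᵢ ⟩
      ∑ (λ y → q * ι (Y y))                              ≡⟨ ∑-* q (ι ∘ Y) ⟩
      q * # Y                                            ∎
      where
      open ≤-Reasoning
      lowᵢ : ∀ u → p * ι (A u) ≤ ∑ (λ y → ι (A u ∧ (Y y ∧ e u y)))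
      lowᵢ u with A u in r
      ... | true  = ≤-trans (≤-reflexive (*-identityʳ p)) (low (mem r))
      ... | false = ≤-trans (≤-reflexive (*-zeroʳ p)) z≤n
      zero-∧ : ∀ {m} (f : Fin m → Bool) → ∑ (λ u → ι (f u ∧ false)) ≤ 0
      zero-∧ {zero}  f = z≤n
      zero-∧ {suc m} f with f zero
      ... | true  = zero-∧ (f ∘ suc)
      ... | false = zero-∧ (f ∘ suc)
      upᵢ : ∀ y → ∑ (λ u → ι (A u ∧ (Y y ∧ e u y))) ≤ q * ι (Y y)
      upᵢ y with Y y in r
      ... | true  = ≤-trans (≤-reflexive (∑-cong λ u → cong (λ b → ι (A u ∧ b)) (e-sym u y)))
                      (≤-trans (up (mem r)) (≤-reflexive (sym (*-identityʳ q))))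
      ... | false = ≤-trans (zero-∧ A) z≤n

    degree-sum-even : ∀ {d} (S : VS n) → (∀ {u} → u ∈ S → # (S ∩ e u) ≡ d) → ∃ λ h → d * # S ≡ h + h
    degree-sum-even {d} S deg with ∑∑-even (λ u y → ι (S u ∧ (S y ∧ e u y))) flip diag
      where
      flip : ∀ u y → ι (S u ∧ (S y ∧ e u y)) ≡ ι (S y ∧ (S u ∧ e y u))
      flip u y rewrite e-sym u y with S u | S y
      ... | true  | true  = refl
      ... | true  | false = refl
      ... | false | true  = refl
      ... | false | false = refl
      diag : ∀ u → ι (S u ∧ (S u ∧ e u u)) ≡ 0
      diag u rewrite e-irr u with S u
      ... | true  = refl
      ... | false = refl
    ... | h , eq = h , trans (sym (∑-* d (ι ∘ S))) (trans (∑-cong row) eq)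
      where
      zeros : ∀ {m} → ∑ {m} (λ _ → 0) ≡ 0
      zeros {zero}  = refl
      zeros {suc m} = zeros {m}
      row : ∀ u → d * ι (S u) ≡ ∑ (λ y → ι (S u ∧ (S y ∧ e u y)))
      row u with S u in r
      ... | true  = trans (*-identityʳ d) (sym (deg (mem r)))
      ... | false = trans (*-zeroʳ d) (sym (zeros {n}))

-- The surplus of neighbourhoods over independent sets, and König's theorem

module Surplus {n : ℕ} (e : Fin n → VS n) (e-sym : ∀ x y → e x y ≡ e y x) (e-irr : ∀ x → e x x ≡ false) where
  open Graphs e e-sym e-irr

  drop : ∀ {k r S} → ¬ Br k (suc r) S → ∀ {Q} → Clique Q → ¬ Br k r (S ∖ Q)
  drop nb c b = nb (_ , c , b)

  module _ {k : ℕ} where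

    private
      -- Replacing `J ∩ N S E` by `E` leaves an independent set, and `J` already has the maximal
      -- size, so nothing can be gained.
      swap′ : ∀ {S E J} → Bound k S → E ⊆ S → Ind E → J ⊆ S → Ind J → k ≤ # J → # (E ∖ J) ≤ # (J ∩ N S E)
      swap′ {S} {E} {J} bound E⊆ E-ind J⊆ J-ind large = lin (# (E ∖ J) ∷ # (J ∩ N S E) ∷ # J ∷ # (J ∖ N S E ∪ E) ∷ k ∷ [])
        ((x₂ ⊕ x₀ ≲ x₃ ⊕ x₁ by count (J ∷ N S E ∷ E ∷ []) ((x₁ ∧ᶠ x₂ ⊑ ff by λ p → ⊥-elim (N-∉ E-ind (∈∩ˡ p) (∈∩ʳ p))) ∷ [])
            (⟨ x₀ ⟩ ⊕ ⟨ x₂ ∖ᶠ x₀ ⟩) (⟨ x₀ ∖ᶠ x₁ ∨ᶠ x₂ ⟩ ⊕ ⟨ x₀ ∧ᶠ x₁ ⟩))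
        ∷ (x₃ ≲ x₄ by bound (∪⊆ (λ p → J⊆ (∈∖ˡ p)) E⊆) (Ind-∪ (Ind-⊆ ∈∖ˡ J-ind) E-ind λ p q r → ∈∖ʳ p (N-intro (J⊆ (∈∖ˡ p)) q (e⇄ r))))
        ∷ (x₄ ≲ x₂ by large) ∷ []) x₀ x₁

    -- If fewer than # E vertices of N S E survive, then exchanging J ∩ N S E for E enlarges J.
    private
      exchange : ∀ {S E D J} → Bound k S → E ⊆ S → Ind E →
                 (∀ {T} → T ⊆ E → Ind T → (∃ λ x → x ∈ T) → # T < # E → # T + 1 ≤ # (N S T)) →
                 # (N S E) ≤ # E → # (N S E ∖ D) < # E →
                 J ⊆ S → Ind J → k ≤ # J → (∀ {x} → x ∈ J → x ∉ D) → (∃ λ x → x ∈ E ∖ J) → ⊥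
      exchange {S} {E} {D} {J} bound E⊆ E-ind ih few fewD J⊆ J-ind large J∩D (e₀ , e₀∈) with some? (E ∩ J)
      ... | inj₂ none = absurd (# (N S E ∖ D) ∷ # E ∷ # (E ∖ J) ∷ # (J ∩ N S E) ∷ [])
            ((κ 1 ⊕ x₀ ≲ x₁ by fewD)
            ∷ (x₁ ≲ x₂ by count (E ∷ J ∷ []) ((x₀ ∧ᶠ x₁ ⊑ ff by ⊥-elim ∘ none) ∷ []) ⟨ x₀ ⟩ ⟨ x₀ ∖ᶠ x₁ ⟩)
            ∷ (x₂ ≲ x₃ by swap′ bound E⊆ E-ind J⊆ J-ind large)
            ∷ (x₃ ≲ x₀ by count (N S E ∷ D ∷ J ∷ []) ((x₂ ∧ᶠ x₁ ⊑ ff by λ p → ⊥-elim (J∩D (∈∩ˡ p) (∈∩ʳ p))) ∷ [])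
                ⟨ x₂ ∧ᶠ x₀ ⟩ ⟨ x₀ ∖ᶠ x₁ ⟩) ∷ [])
      -- The set `T = E ∩ J` is smaller than `E`, so N(T) has more than # T vertices, none of them
      -- in `J`. This leaves fewer than # (E ∖ J) vertices for `J ∩ N S E`, against `swap′`.
      ... | inj₁ (x , x∈) = absurd (# T ∷ # (N S T) ∷ # E ∷ # (E ∖ J) ∷ # (J ∩ N S E) ∷ # (N S E) ∷ [])
            ((x₀ ⊕ κ 1 ≲ x₁ by ih ∈∩ˡ (Ind-⊆ ∈∩ˡ E-ind) (x , x∈) T<E)
            ∷ (x₂ ≲ x₀ ⊕ x₃ by count (E ∷ J ∷ []) [] ⟨ x₀ ⟩ (⟨ x₀ ∧ᶠ x₁ ⟩ ⊕ ⟨ x₀ ∖ᶠ x₁ ⟩))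
            ∷ (x₃ ≲ x₄ by swap′ bound E⊆ E-ind J⊆ J-ind large)
            ∷ (x₄ ⊕ x₁ ≲ x₅ by count (J ∷ N S E ∷ N S T ∷ []) ((x₂ ⊑ x₁ by N-mono ∈∩ˡ) ∷ (x₂ ∧ᶠ x₀ ⊑ ff by λ p → ⊥-elim (disj (∈∩ˡ p) (∈∩ʳ p))) ∷ [])
                (⟨ x₀ ∧ᶠ x₁ ⟩ ⊕ ⟨ x₂ ⟩) ⟨ x₁ ⟩)
            ∷ (x₅ ≲ x₂ by few) ∷ [])
        where
        T = E ∩ J
        T<E : # T < # E
        T<E = lin (# T ∷ # E ∷ # (E ∖ J) ∷ [])
          ((x₀ ⊕ x₂ ≲ x₁ by count (E ∷ J ∷ []) [] (⟨ x₀ ∧ᶠ x₁ ⟩ ⊕ ⟨ x₀ ∖ᶠ x₁ ⟩) ⟨ x₀ ⟩) ∷ (κ 1 ≲ x₂ by #-pos e₀∈) ∷ [])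
          (κ 1 ⊕ x₀) x₁
        disj : ∀ {y} → y ∈ N S T → y ∉ J
        disj p q with N-elim p
        ... | _ , t , t∈ , a = J-ind (∈∩ʳ t∈) q a

      -- Take a smallest `E` with # N(E) ≤ # E. One edge between `E` and N(E), or a vertex of `E` if
      -- there is no such edge, breaks `S`: a surviving set misses the ends of the edge, and
      -- `exchange` enlarges it.
      surplus₁ : ∀ m {S} → Bound k S → ¬ Br k 1 S → ∀ {E} → E ⊆ S → Ind E → (∃ λ x → x ∈ E) → # E ≤ m → # E + 1 ≤ # (N S E)
      surplus₁ zero    bound nb E⊆ E-ind (x , p) E≤ = ⊥-elim (1+n≰n (≤-trans (#-pos p) E≤))
      surplus₁ (suc m) {S} bound nb {E} E⊆ E-ind (x , p) E≤ with # E + 1 ≤? # (N S E)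
      ... | yes h = h
      ... | no  h = ⊥-elim (nb (breaks (some? (N S E))))
        where
        few : # (N S E) ≤ # E
        few = ≤-pred (≤-trans (≰⇒> h) (≤-reflexive (+-comm (# E) 1)))
        ih : ∀ {T} → T ⊆ E → Ind T → (∃ λ x → x ∈ T) → # T < # E → # T + 1 ≤ # (N S T)
        ih s i t l = surplus₁ m bound nb (λ q → E⊆ (s q)) i t (≤-pred (≤-trans l E≤))
        breaks : (∃ λ w → w ∈ N S E) ⊎ (∀ {w} → w ∉ N S E) → Br k 1 S
        breaks (inj₂ none) = ｛ x ｝ , Clique-｛｝ , λ s i l →
          exchange {D = ∅} bound E⊆ E-ind ih few (≤-trans (s≤s (≤-reflexive (#∅ (none ∘ ∈∖ˡ)))) (#-pos p)) (∈∖ˡ ∘ s) i l (λ _ → ∉∅)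
            (x , ∈∖ p λ q → ∈∖ʳ (s q) ∈｛｝)
        breaks (inj₁ (w , q)) with N-elim q
        ... | _ , y , y∈ , a = edge y w , Clique-edge a , λ s i l →
          exchange {D = ｛ w ｝} bound E⊆ E-ind ih few (≤-trans (#-∖∈ q) few) (∈∖ˡ ∘ s) i l (λ r t → ∈∖ʳ (s r) (∈∪ʳ t))
            (y , ∈∖ y∈ λ t → ∈∖ʳ (s t) (∈∪ˡ ∈｛｝))

    -- Deleting one vertex of N(E) spends one clique and one neighbour, which reduces r by 1.
    surplus : ∀ r {S} → Bound k S → ¬ Br k (suc r) S → ∀ {E} → E ⊆ S → Ind E → (∃ λ x → x ∈ E) → # E + suc r ≤ # (N S E)
    surplus zero bound nb {E} E⊆ E-ind x = surplus₁ (# E) bound nb E⊆ E-ind x ≤-refl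
    surplus (suc r) {S} bound nb {E} E⊆ E-ind x with some? (N S E)
    ... | inj₁ (w , p) = lin (# E ∷ # (N S E) ∷ # (N S E ∖ ｛ w ｝) ∷ # (N (S ∖ ｛ w ｝) E) ∷ r ∷ [])
          ((x₀ ⊕ (κ 1 ⊕ x₄) ≲ x₃ by surplus r (Bound-⊆ ∈∖ˡ bound) (drop {r = suc r} nb Clique-｛｝) (λ q → ∈∖ (E⊆ q) λ t → N-∉ E-ind p (subst (_∈ E) (sym (｛｝⁻ t)) q)) E-ind x)
          ∷ (x₃ ≲ x₂ by #-mono λ q → let s , y , y∈ , a = N-elim q in ∈∖ (N-intro (∈∖ˡ s) y∈ a) (∈∖ʳ s))
          ∷ (κ 1 ⊕ x₂ ≲ x₁ by #-∖∈ p) ∷ []) (x₀ ⊕ (κ 2 ⊕ x₄)) x₁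
    ... | inj₂ none = ⊥-elim (absurd (# E ∷ # (N S E) ∷ r ∷ [])
          ((x₀ ⊕ (κ 1 ⊕ x₂) ≲ x₁ by surplus r bound (nb ∘ Br-suc {r = suc r}) E⊆ E-ind x)
          ∷ (x₁ ≲ κ 0 by ≤-reflexive (#∅ none)) ∷ []))

    -- An edge inside N(E) removes two neighbours at the price of one clique, a gain of 1 over
    -- `surplus`. Hence equality in `surplus` forces an independent neighbourhood.
    surplus-edge : ∀ r {S} → Bound k S → ¬ Br k (suc (suc r)) S → ∀ {E} → E ⊆ S → Ind E → (∃ λ x → x ∈ E) →
                   ∀ {a b} → a ∈ N S E → b ∈ N S E → b ∈ e a → # E + suc (suc (suc r)) ≤ # (N S E)
    surplus-edge r {S} bound nb {E} E⊆ E-ind x {a} {b} p q ab =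
      lin (# E ∷ # (N S E) ∷ # (N S E ∖ ｛ a ｝) ∷ # (N S E ∖ ｛ a ｝ ∖ ｛ b ｝) ∷ # (N (S ∖ edge a b) E) ∷ r ∷ [])
        ((x₀ ⊕ (κ 1 ⊕ x₅) ≲ x₄ by surplus r (Bound-⊆ ∈∖ˡ bound) (drop {r = suc r} nb (Clique-edge ab))
            (λ t → ∈∖ (E⊆ t) λ u → [ (λ v → N-∉ E-ind p (subst (_∈ E) (sym (｛｝⁻ v)) t)) , (λ v → N-∉ E-ind q (subst (_∈ E) (sym (｛｝⁻ v)) t)) ]′ (∈∪⁻ u)) E-ind x)
        ∷ (x₄ ≲ x₃ by #-mono λ t → let s , y , y∈ , l = N-elim t in ∈∖ (∈∖ (N-intro (∈∖ˡ s) y∈ l) (∈∖ʳ s ∘ ∈∪ˡ)) (∈∖ʳ s ∘ ∈∪ʳ))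
        ∷ (κ 1 ⊕ x₃ ≲ x₂ by #-∖∈ (∈∖ q λ t → e≢ ab (｛｝⁻ t)))
        ∷ (κ 1 ⊕ x₂ ≲ x₁ by #-∖∈ p) ∷ []) (x₀ ⊕ (κ 3 ⊕ x₅)) x₁

    degree≥ : ∀ r {S} → Bound k S → ¬ Br k (suc r) S → ∀ {v} → v ∈ S → suc (suc r) ≤ # (S ∩ e v)
    degree≥ r {S} bound nb {v} p = lin (# ｛ v ｝ ∷ # (N S ｛ v ｝) ∷ # (S ∩ e v) ∷ r ∷ [])
      ((x₀ ⊕ (κ 1 ⊕ x₃) ≲ x₁ by surplus r bound nb (｛｝⊆ p) Ind-｛｝ (v , ∈｛｝))
      ∷ (κ 1 ≲ x₀ by ≤-reflexive (sym (#｛｝ v))) ∷ (x₁ ≲ x₂ by #-mono N-｛｝) ∷ []) (κ 2 ⊕ x₃) x₂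

  Cov-∅ : ∀ k {L} → (∀ {x} → x ∉ L) → Cov k L
  Cov-∅ zero    h = [] h
  Cov-∅ (suc k) h = Clique-∅ ∷ Cov-∅ k (h ∘ ∈∖ˡ)

  -- König's theorem. A minimal counterexample X ∪ Y would satisfy # X < # N(X) ≤ # Y and # Y < # N(Y) ≤ # X.
  opaque
    könig : ∀ k {X Y} → Ind X → Ind Y → Bound k (X ∪ Y) → ¬ ¬ Cov k (X ∪ Y)
    könig zero i j bound nc = nc ([] λ {x} p → 1+n≰n (≤-trans (≤-reflexive (sym (#｛｝ x))) (bound (｛｝⊆ p) Ind-｛｝)))
    könig (suc k) {X} {Y} i j bound nc with some? (X ∪ Y)
    ... | inj₂ none = nc (Cov-∅ (suc k) none)
    ... | inj₁ (x , p) = [ (λ q → let h = more i NX (x , q) ∈∪ˡ in less h (more j NY (#-inhabited (≤-trans (m≤n+m 1 (# X)) h)) ∈∪ʳ))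
                         , (λ q → let h = more j NY (x , q) ∈∪ʳ in less h (more i NX (#-inhabited (≤-trans (m≤n+m 1 (# Y)) h)) ∈∪ˡ)) ]′ (∈∪⁻ p)
      where
      nb : ¬ Br (suc k) 1 (X ∪ Y)
      nb (Q , c , b) = könig k (Ind-⊆ ∈∖ˡ i) (Ind-⊆ ∈∖ˡ j) bound′ λ cs → nc (c ∷ Cov-⊆ split cs)
        where
        split : (X ∪ Y) ∖ Q ⊆ X ∖ Q ∪ Y ∖ Q
        split r = [ (λ t → ∈∪ˡ (∈∖ t (∈∖ʳ r))) , (λ t → ∈∪ʳ (∈∖ t (∈∖ʳ r))) ]′ (∈∪⁻ (∈∖ˡ r))
        bound′ : Bound k (X ∖ Q ∪ Y ∖ Q)
        bound′ s t = ≤-pred (≰⇒> λ l → b (λ r → ∪⊆ (λ u → ∈∖ (∈∪ˡ (∈∖ˡ u)) (∈∖ʳ u)) (λ u → ∈∖ (∈∪ʳ (∈∖ˡ u)) (∈∖ʳ u)) (s r)) t l)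
      NX : N (X ∪ Y) X ⊆ Y
      NX r = let s , y , y∈ , a = N-elim r in [ (λ t → ⊥-elim (i y∈ t a)) , (λ t → t) ]′ (∈∪⁻ s)
      NY : N (X ∪ Y) Y ⊆ X
      NY r = let s , y , y∈ , a = N-elim r in [ (λ t → t) , (λ t → ⊥-elim (j y∈ t a)) ]′ (∈∪⁻ s)
      more : ∀ {A B} → Ind A → N (X ∪ Y) A ⊆ B → (∃ λ x → x ∈ A) → A ⊆ X ∪ Y → # A + 1 ≤ # B
      more a s t u = ≤-trans (surplus zero bound nb u a t) (#-mono s)
      less : ∀ {a b} → a + 1 ≤ b → b + 1 ≤ a → ⊥
      less {a} {b} h h′ = absurd (a ∷ b ∷ []) ((x₀ ⊕ κ 1 ≲ x₁ by h) ∷ (x₁ ⊕ κ 1 ≲ x₀ by h′) ∷ [])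

-- Graphs with independence number at most 7

module Bounded {n : ℕ} (e : Fin n → VS n) (e-sym : ∀ x y → e x y ≡ e y x) (e-irr : ∀ x → e x x ≡ false)
               (α : ∀ {J} → Graphs.Ind e e-sym e-irr J → # J ≤ 7) where
  open Graphs e e-sym e-irr
  open Surplus e e-sym e-irr

  bound₇ : ∀ {S} → Bound 7 S
  bound₇ _ = α

  TF : VS n → Set
  TF S = ∀ {x y z} → x ∈ S → y ∈ S → z ∈ S → y ∈ e x → z ∈ e y → z ∈ e x → ⊥

  TF-⊆ : ∀ {A B} → A ⊆ B → TF B → TF A
  TF-⊆ s t p q r = t (s p) (s q) (s r)

  nbr-ind : ∀ {S v} → TF S → v ∈ S → Ind (S ∩ e v)
  nbr-ind tf v∈ p q a = tf v∈ (∈∩ˡ p) (∈∩ˡ q) (∈∩ʳ p) a (∈∩ʳ q)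

  -- Deleting a star and disposing of the other neighbours of its centre

  Cov-singles : ∀ k {U} → # U ≤ k → Cov k U
  Cov-singles zero    h = [] λ p → 1+n≰n (≤-trans (#-pos p) h)
  Cov-singles (suc k) {U} h with some? U
  ... | inj₁ (x , p) = Clique-｛｝ ∷ Cov-singles k (≤-pred (≤-trans (#-∖∈ p) h))
  ... | inj₂ none    = Cov-∅ (suc k) none

  -- The centre shares the clique of one leaf, so a star costs only as many cliques as it has
  -- leaves.
  Cov-star : ∀ k {U v} → U ⊆ e v → (∃ λ u → u ∈ U) → # U ≤ k → Cov k (U ∪ ｛ v ｝)
  Cov-star zero    h (u , p) l = ⊥-elim (1+n≰n (≤-trans (#-pos p) l))
  Cov-star (suc k) {U} {v} h (u , p) l = Clique-edge (h p) ∷ Cov-⊆ rest (Cov-singles k (≤-pred (≤-trans (#-∖∈ p) l)))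
    where
    rest : (U ∪ ｛ v ｝) ∖ edge v u ⊆ U ∖ ｛ u ｝
    rest q = [ (λ r → ∈∖ r (∈∖ʳ q ∘ ∈∪ʳ)) , (λ r → ⊥-elim (∈∖ʳ q (∈∪ˡ r))) ]′ (∈∪⁻ (∈∖ˡ q))

  Cov-Br₀ : ∀ {r S L} → Cov r L → NoInd 7 (S ∖ L) → Br 7 r S
  Cov-Br₀ {r} {S} c h = subst (λ t → Br 7 t S) (+-identityʳ r) (Cov-Br {r = 0} c h)

  dominated : ∀ {J v} → Ind J → v ∉ J → (∀ {x} → x ∈ J → x ∉ e v) → 7 ≤ # J → ⊥
  dominated i v∉ h l = 1+n≰n (≤-trans (+-monoˡ-≤ 1 l) (≤-trans (#-∪｛｝ v∉) (α (Ind-∪｛｝ i h))))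

  -- The slack needed to kill the vertices of K₂ one by one.
  Slack : VS n → Fin n → VS n → ℕ → Set
  Slack S v K c = ∀ {E} → E ⊆ S → Ind E → (∃ λ x → x ∈ E) → v ∈ N S E → K ⊆ N S E → # E + c ≤ # (N S E)

  -- N(v) = U ∪ K₁ ∪ K₂. The set U ∪ {v} will be deleted, and no maximum independent set then meets K₁.
  record State (ρ s τ : ℕ) (S : VS n) (v : Fin n) (U K₁ K₂ : VS n) : Set where
    field
      tf    : TF S
      v∈    : v ∈ S
      U⊆    : U ⊆ S ∩ e v
      K₁⊆   : K₁ ⊆ S ∩ e v
      K₂⊆   : K₂ ⊆ S ∩ e v
      cover : S ∩ e v ⊆ U ∪ K₁ ∪ K₂
      U#K₁  : ∀ {x} → x ∈ U → x ∉ K₁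
      U#K₂  : ∀ {x} → x ∈ U → x ∉ K₂
      K₁#K₂ : ∀ {x} → x ∈ K₁ → x ∉ K₂
      sizeU : # U ≡ ρ
      sizeS : # S ≤ ρ + ρ + 13 + τ
      deg   : ∀ {i} → i ∈ K₂ → ρ + 1 + s ≤ # (S ∩ e i)
      τ≤    : τ ≤ s + # K₁
      dead  : ∀ {J x} → J ⊆ S ∖ U ∖ ｛ v ｝ → Ind J → 7 ≤ # J → x ∈ J → x ∉ K₁
      room  : # K₂ < ρ
      slack : (∃ λ x → x ∈ K₁) ⊎ Slack S v K₁ (ρ + τ)
      unbroken : ¬ Br 7 ρ S

  -- Each round moves one vertex `i` from `K₂` to `K₁`, after making sure that no surviving set
  -- contains `i`. This costs at most one edge, which takes a leaf out of `U`, so the smaller budget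
  -- still pays for the star.
  kill : ∀ m {ρ s τ S v U K₁ K₂} → τ ≤ 1 → # K₂ ≤ m → State ρ s τ S v U K₁ K₂ → ⊥
  kill m {ρ} {s} {τ} {S} {v} {U} {K₁} {K₂} τ≤1 fuel st with some? K₂
  -- Surviving sets now avoid N(v) altogether, so `v` could be added to them.
  ... | inj₂ none = unbroken (Cov-Br₀ {ρ} (Cov-star ρ (∈∩ʳ ∘ U⊆) (#-inhabited (≤-trans (≤-trans (s≤s z≤n) room) (≤-reflexive (sym sizeU)))) (≤-reflexive sizeU))
      λ {J} J⊆ i l → dominated i (λ p → ∈∖ʳ (J⊆ p) (∈∪ʳ ∈｛｝)) (λ {x} p a →
        [ [ (λ q → ∈∖ʳ (J⊆ p) (∈∪ˡ q)) , dead (λ r → ∈∖ (∈∖ (∈∖ˡ (J⊆ r)) (∈∖ʳ (J⊆ r) ∘ ∈∪ˡ)) (∈∖ʳ (J⊆ r) ∘ ∈∪ʳ)) i l p ]′ ∘ ∈∪⁻ , none ]′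
          (∈∪⁻ (cover (∈∩ (∈∖ˡ (J⊆ p)) a)))) l)
    where open State st
  kill zero _ fuel st | inj₁ (i , i∈) = 1+n≰n (≤-trans (#-pos i∈) fuel)
  kill (suc m) {ρ} {s} {τ} {S} {v} {U} {K₁} {K₂} τ≤1 fuel st | inj₁ (i , i∈) = step (core? bound₆)
    where
    open State st
    -- The other six vertices of a surviving set through `i` lie here.
    X = S ∖ ｛ v ｝ ∖ U ∖ K₁ ∖ e i ∖ ｛ i ｝
    iS : i ∈ S
    iS = ∈∩ˡ (K₂⊆ i∈)
    iv : i ∈ e v
    iv = ∈∩ʳ (K₂⊆ i∈)
    i∉U : i ∉ U
    i∉U p = U#K₂ p i∈
    i∉K₁ : i ∉ K₁
    i∉K₁ p = K₁#K₂ p i∈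
    X⊆S : X ⊆ S
    X⊆S p = ∈∖ˡ (∈∖ˡ (∈∖ˡ (∈∖ˡ (∈∖ˡ p))))
    with-i : ∀ {J} → J ⊆ X → Ind J → Ind (J ∪ ｛ i ｝)
    with-i s j = Ind-∪｛｝ j λ p → ∈∖ʳ (∈∖ˡ (s p))
    sizeX : # X + # U + # K₁ + # (S ∩ e i) + 1 ≤ # S
    sizeX = lin (# X ∷ # U ∷ # K₁ ∷ # (S ∩ e i) ∷ # ｛ i ｝ ∷ # S ∷ [])
      ((x₀ ⊕ x₁ ⊕ x₂ ⊕ x₃ ⊕ x₄ ≲ x₅ by count (S ∷ U ∷ K₁ ∷ e i ∷ ｛ i ｝ ∷ ｛ v ｝ ∷ [])
          ((x₁ ⊑ x₀ by ∈∩ˡ ∘ U⊆) ∷ (x₂ ⊑ x₀ by ∈∩ˡ ∘ K₁⊆) ∷ (x₄ ⊑ x₀ by ｛｝⊆ iS)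
          ∷ (x₄ ∧ᶠ x₃ ⊑ ff by λ p → ⊥-elim (e≢ (∈∩ʳ p) (｛｝⁻ (∈∩ˡ p))))
          ∷ (x₁ ∧ᶠ x₃ ⊑ ff by λ p → ⊥-elim (nbr-ind tf v∈ (K₂⊆ i∈) (U⊆ (∈∩ˡ p)) (∈∩ʳ p)))
          ∷ (x₂ ∧ᶠ x₃ ⊑ ff by λ p → ⊥-elim (nbr-ind tf v∈ (K₂⊆ i∈) (K₁⊆ (∈∩ˡ p)) (∈∩ʳ p)))
          ∷ (x₁ ∧ᶠ x₂ ⊑ ff by λ p → ⊥-elim (U#K₁ (∈∩ˡ p) (∈∩ʳ p)))
          ∷ (x₄ ∧ᶠ x₁ ⊑ ff by λ p → ⊥-elim (i∉U (｛｝⊆′ p)))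
          ∷ (x₄ ∧ᶠ x₂ ⊑ ff by λ p → ⊥-elim (i∉K₁ (｛｝⊆′ p))) ∷ [])
          (⟨ x₀ ∖ᶠ x₅ ∖ᶠ x₁ ∖ᶠ x₂ ∖ᶠ x₃ ∖ᶠ x₄ ⟩ ⊕ ⟨ x₁ ⟩ ⊕ ⟨ x₂ ⟩ ⊕ ⟨ x₀ ∧ᶠ x₃ ⟩ ⊕ ⟨ x₄ ⟩) ⟨ x₀ ⟩)
      ∷ (κ 1 ≲ x₄ by ≤-reflexive (sym (#｛｝ i))) ∷ []) (x₀ ⊕ x₁ ⊕ x₂ ⊕ x₃ ⊕ κ 1) x₅
      where
      ｛｝⊆′ : ∀ {A : VS n} {x} → x ∈ ｛ i ｝ ∩ A → i ∈ A
      ｛｝⊆′ {A} p = subst (_∈ A) (sym (｛｝⁻ (∈∩ˡ p))) (∈∩ʳ p)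
    plus-i : ∀ {J} → J ⊆ X → # J + 1 ≤ # (J ∪ ｛ i ｝)
    plus-i J⊆ = #-∪｛｝ λ p → ∈∖ʳ (J⊆ p) ∈｛｝
    bound₆ : Bound 6 X
    bound₆ {J} J⊆ j = lin (# J ∷ # (J ∪ ｛ i ｝) ∷ []) ((x₀ ⊕ κ 1 ≲ x₁ by plus-i J⊆) ∷ (x₁ ≲ κ 7 by α (with-i J⊆ j)) ∷ []) x₀ (κ 6)
    through : ∀ {J} → J ⊆ S ∖ U ∖ ｛ v ｝ → Ind J → 7 ≤ # J → i ∈ J → J ∖ ｛ i ｝ ⊆ X × 6 ≤ # (J ∖ ｛ i ｝)
    through J⊆ j l p = (λ q → let q′ = ∈∖ˡ q ; t = J⊆ q′ in
        ∈∖ (∈∖ (∈∖ (∈∖ (∈∖ (∈∖ˡ (∈∖ˡ t)) (∈∖ʳ t)) (∈∖ʳ (∈∖ˡ t))) (dead J⊆ j l q′)) (j p q′)) (∈∖ʳ q))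
      , ≤-pred (≤-trans l #-∖｛｝)
    m′ : # (K₂ ∖ ｛ i ｝) ≤ m
    m′ = ≤-pred (≤-trans (#-∖∈ i∈) fuel)
    cover′ : ∀ {x} → x ∈ U ∪ K₁ ∪ K₂ → x ∈ U ⊎ x ∈ (K₁ ∪ ｛ i ｝) ∪ (K₂ ∖ ｛ i ｝)
    cover′ {x} p with ∈∪⁻ p
    ... | inj₁ q = [ inj₁ , inj₂ ∘ ∈∪ˡ ∘ ∈∪ˡ ]′ (∈∪⁻ q)
    ... | inj₂ q with x ∈? ｛ i ｝
    ...   | yes r = inj₂ (∈∪ˡ (∈∪ʳ r))
    ...   | no  r = inj₂ (∈∪ʳ (∈∖ q r))
    K₁#K₂′ : ∀ {x} → x ∈ K₁ ∪ ｛ i ｝ → x ∉ K₂ ∖ ｛ i ｝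
    K₁#K₂′ p q = [ (λ r → K₁#K₂ r (∈∖ˡ q)) , ∈∖ʳ q ]′ (∈∪⁻ p)
    U#i : ∀ {x} → x ∈ U → x ∉ K₁ ∪ ｛ i ｝
    U#i p q = [ U#K₁ p , (λ r → i∉U (subst (_∈ U) (sym (｛｝⁻ r)) p)) ]′ (∈∪⁻ q)
    τ≤′ : τ ≤ s + # (K₁ ∪ ｛ i ｝)
    τ≤′ = ≤-trans τ≤ (+-monoʳ-≤ s (#-mono ∈∪ˡ))

    step : Core 6 X ⊎ NoInd 6 X → ⊥
    step (inj₂ none) = kill m τ≤1 m′ record
      { tf = tf ; v∈ = v∈ ; U⊆ = U⊆ ; K₁⊆ = ∪⊆ K₁⊆ (｛｝⊆ (K₂⊆ i∈)) ; K₂⊆ = K₂⊆ ∘ ∈∖ˡ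
      ; cover = λ p → [ ∈∪ˡ ∘ ∈∪ˡ , (λ q → [ ∈∪ˡ ∘ ∈∪ʳ , ∈∪ʳ ]′ (∈∪⁻ q)) ]′ (cover′ (cover p))
      ; U#K₁ = U#i ; U#K₂ = λ p q → U#K₂ p (∈∖ˡ q) ; K₁#K₂ = K₁#K₂′
      ; sizeU = sizeU ; sizeS = sizeS ; deg = deg ∘ ∈∖ˡ ; τ≤ = τ≤′
      ; dead = λ J⊆ j l p q → [ dead J⊆ j l p , (λ r → let a , b = through J⊆ j l (subst (_∈ _) (sym (｛｝⁻ r)) p) in none a (Ind-⊆ ∈∖ˡ j) b) ]′ (∈∪⁻ q)
      ; room = ≤-trans (s≤s (#-mono {A = K₂ ∖ ｛ i ｝} ∈∖ˡ)) room
      ; slack = inj₁ (i , ∈∪ʳ ∈｛｝) ; unbroken = unbroken }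
    step (inj₁ c) = [ (λ { (a , p) → let p′ , f , f∈ , fa = N-elim p in remove a p′ f f∈ fa }) , stuck ]′ (some? (N U core))
      where
      open Core c
      E = core ∪ ｛ i ｝
      E⊆S : E ⊆ S
      E⊆S = ∪⊆ (X⊆S ∘ core-X c) (｛｝⊆ iS)
      E-ind : Ind E
      E-ind = with-i (core-X c) (core-ind c)
      sizeX′ : # X + ρ + # K₁ + # (S ∩ e i) + 1 ≤ # S
      sizeX′ = subst (λ u → # X + u + # K₁ + # (S ∩ e i) + 1 ≤ # S) sizeU sizeX

      where-N : (∀ {x} → x ∉ N U core) → ∀ {y} → y ∈ N S E → y ∈ S ∩ e i ∪ N X core ∪ K₁
      where-N none {y} p with N-elim p
      ... | y∈ , x , x∈ , a with ∈∪⁻ x∈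
      ...   | inj₂ q = ∈∪ˡ (∈∪ˡ (∈∩ y∈ (subst (λ t → y ∈ e t) (sym (｛｝⁻ q)) a)))
      ...   | inj₁ q with y ∈? e i | y ∈? K₁ | y ∈? U
      ...     | yes r | _     | _     = ∈∪ˡ (∈∪ˡ (∈∩ y∈ r))
      ...     | no _  | yes r | _     = ∈∪ʳ r
      ...     | no _  | no _  | yes r = ⊥-elim (none (N-intro r q a))
      ...     | no r  | no r′ | no r″ = ∈∪ˡ (∈∪ʳ (N-intro (∈∖ (∈∖ (∈∖ (∈∖ (∈∖ y∈
          (λ t → r (subst (_∈ e i) (｛｝⁻ t) (e⇄ iv)))) r″) r′) r)
          (λ t → ∈∖ʳ (∈∖ˡ (core-X c q)) (e⇄ (subst (_∈ e x) (sym (｛｝⁻ t)) a)))) q a))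

      NSE : (∀ {x} → x ∉ N U core) → # (N S E) ≤ # (S ∩ e i) + # (N X core) + # (K₁ ∩ N S E)
      NSE none = count (N S E ∷ S ∩ e i ∷ N X core ∷ K₁ ∷ []) ((x₀ ⊑ x₁ ∨ᶠ x₂ ∨ᶠ x₃ by where-N none) ∷ [])
        ⟨ x₀ ⟩ (⟨ x₁ ⟩ ⊕ ⟨ x₂ ⟩ ⊕ ⟨ x₃ ∧ᶠ x₀ ⟩)

      surplus′ : ∀ ρ → # K₂ < ρ → ¬ Br 7 ρ S → ∀ {E} → E ⊆ S → Ind E → (∃ λ x → x ∈ E) → # E + ρ ≤ # (N S E)
      surplus′ (suc ρ) _ nb = surplus ρ bound₇ nb

      -- `v` and a vertex of `K₁` form an edge inside N(E), and `surplus-edge` yields the additional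
      -- 1 that covers τ.
      slack-edge : ∀ ρ → # K₂ < ρ → ¬ Br 7 ρ S → (∃ λ x → x ∈ K₁) → Slack S v K₁ (ρ + τ)
      slack-edge zero          () nb k s j x p q
      slack-edge (suc zero)    r  nb k s j x p q = ⊥-elim (1+n≰n (≤-trans (#-pos i∈) (≤-pred r)))
      slack-edge (suc (suc ρ)) r  nb (κ′ , κ∈) {E} s j x p q = lin (# E ∷ ρ ∷ τ ∷ # (N S E) ∷ [])
        ((x₀ ⊕ (κ 3 ⊕ x₁) ≲ x₃ by surplus-edge ρ bound₇ nb s j x p (q κ∈) (∈∩ʳ (K₁⊆ κ∈))) ∷ (x₂ ≲ κ 1 by τ≤1) ∷ []) (x₀ ⊕ (κ 2 ⊕ x₁ ⊕ x₂)) x₃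

      slack′ : Slack S v K₁ (ρ + τ)
      slack′ = choose slack
        where
        choose : (∃ λ x → x ∈ K₁) ⊎ Slack S v K₁ (ρ + τ) → Slack S v K₁ (ρ + τ)
        choose (inj₁ k) = slack-edge ρ room unbroken k
        choose (inj₂ h) = h

      K₁⊆N : (∀ {x} → x ∉ K₁ ∖ N S E) → K₁ ⊆ N S E
      K₁⊆N all {x} p with x ∈? N S E
      ... | yes q = q
      ... | no  q = ⊥-elim (all (∈∖ p q))

      -- If the core has no neighbour in `U`, then the surplus of `E`, Hajnal's inequality in `X`
      -- and the size of `S` add up to 1 + # (K₁ ∖ N S E) ≤ τ. So `K₁` lies in N(E), where the slack
      -- improves the surplus by τ and closes the gap.
      stuck : (∀ {x} → x ∉ N U core) → ⊥
      stuck none with some? (K₁ ∖ N S E)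
      ... | inj₁ (κ′ , κ∈) = absurd (# E ∷ # core ∷ # (N S E) ∷ # (N X core) ∷ # X ∷ # (S ∩ e i) ∷ # K₁ ∷ # (K₁ ∩ N S E) ∷ ρ ∷ τ ∷ # S ∷ # (K₁ ∖ N S E) ∷ [])
            ((x₁ ⊕ κ 1 ≲ x₀ by plus-i (core-X c))
            ∷ (x₀ ⊕ x₈ ≲ x₂ by surplus′ ρ room unbroken E⊆S E-ind (i , ∈∪ʳ ∈｛｝))
            ∷ (x₂ ≲ x₅ ⊕ x₃ ⊕ x₇ by NSE none)
            ∷ (κ 12 ⊕ x₃ ≲ x₁ ⊕ x₄ by core-N c)
            ∷ (x₄ ⊕ x₈ ⊕ x₆ ⊕ x₅ ⊕ κ 1 ≲ x₁₀ by sizeX′)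
            ∷ (x₁₀ ≲ x₈ ⊕ x₈ ⊕ κ 13 ⊕ x₉ by sizeS)
            ∷ (x₉ ≲ κ 1 by τ≤1)
            ∷ (x₇ ⊕ x₁₁ ≲ x₆ by count (K₁ ∷ N S E ∷ []) [] (⟨ x₀ ∧ᶠ x₁ ⟩ ⊕ ⟨ x₀ ∖ᶠ x₁ ⟩) ⟨ x₀ ⟩)
            ∷ (κ 1 ≲ x₁₁ by #-pos κ∈) ∷ [])
      ... | inj₂ all = absurd (# E ∷ # core ∷ # (N S E) ∷ # (N X core) ∷ # X ∷ # (S ∩ e i) ∷ # K₁ ∷ # (K₁ ∩ N S E) ∷ ρ ∷ τ ∷ # S ∷ [])
            ((x₁ ⊕ κ 1 ≲ x₀ by plus-i (core-X c))
            ∷ (x₀ ⊕ (x₈ ⊕ x₉) ≲ x₂ by slack′ E⊆S E-ind (i , ∈∪ʳ ∈｛｝) (N-intro v∈ (∈∪ʳ ∈｛｝) (e⇄ iv)) (K₁⊆N all))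
            ∷ (x₂ ≲ x₅ ⊕ x₃ ⊕ x₇ by NSE none)
            ∷ (x₇ ≲ x₆ by #-mono ∈∩ˡ)
            ∷ (κ 12 ⊕ x₃ ≲ x₁ ⊕ x₄ by core-N c)
            ∷ (x₄ ⊕ x₈ ⊕ x₆ ⊕ x₅ ⊕ κ 1 ≲ x₁₀ by sizeX′)
            ∷ (x₁₀ ≲ x₈ ⊕ x₈ ⊕ κ 13 ⊕ x₉ by sizeS) ∷ [])

      -- Every independent 6-set of `X` contains `f`, so deleting the edge from `f` to `a` destroys
      -- all surviving sets through `i`. `S` loses two vertices while ρ drops by 1, which preserves
      -- `sizeS`.
      remove : ∀ a → a ∈ U → ∀ f → f ∈ core → a ∈ e f → ⊥
      remove a a∈ f f∈ fa = go ρ sizeU sizeS deg room unbroken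
        where
        S′ = S ∖ edge f a
        fX = core-X c f∈
        f∉U : f ∉ U
        f∉U = ∈∖ʳ (∈∖ˡ (∈∖ˡ (∈∖ˡ fX)))
        f∉K₁ : f ∉ K₁
        f∉K₁ = ∈∖ʳ (∈∖ˡ (∈∖ˡ fX))
        av : a ∈ e v
        av = ∈∩ʳ (U⊆ a∈)
        keep : ∀ {x} → x ∈ S → f ≢ x → a ≢ x → x ∈ S′
        keep p q r = ∈∖ p λ t → [ q ∘ ｛｝⁻ , r ∘ ｛｝⁻ ]′ (∈∪⁻ t)
        a≢ : ∀ {x} {A : VS n} → (∀ {y} → y ∈ U → y ∉ A) → x ∈ A → a ≢ x
        a≢ h p refl = h a∈ p
        f≢K₂ : ∀ {x} → x ∈ K₂ → f ≢ x
        f≢K₂ p refl = nbr-ind tf v∈ (K₂⊆ p) (U⊆ a∈) fa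
        U⊆′ : U ∖ ｛ a ｝ ⊆ S′ ∩ e v
        U⊆′ p = let q = U⊆ (∈∖ˡ p) in ∈∩ (keep (∈∩ˡ q) (λ { refl → f∉U (∈∖ˡ p) }) (λ { refl → ∈∖ʳ p ∈｛｝ })) (∈∩ʳ q)
        K₁⊆′ : K₁ ∪ ｛ i ｝ ⊆ S′ ∩ e v
        K₁⊆′ p = ∈∩ (keep (∈∩ˡ q) (λ { refl → [ f∉K₁ , (λ r → ∈∖ʳ fX r) ]′ (∈∪⁻ p) }) (a≢ U#i p)) (∈∩ʳ q)
          where q = ∪⊆ K₁⊆ (｛｝⊆ (K₂⊆ i∈)) p
        K₂⊆′ : K₂ ∖ ｛ i ｝ ⊆ S′ ∩ e v
        K₂⊆′ p = let q = K₂⊆ (∈∖ˡ p) in ∈∩ (keep (∈∩ˡ q) (f≢K₂ (∈∖ˡ p)) (a≢ U#K₂ (∈∖ˡ p))) (∈∩ʳ q)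
        cover″ : S′ ∩ e v ⊆ U ∖ ｛ a ｝ ∪ (K₁ ∪ ｛ i ｝) ∪ K₂ ∖ ｛ i ｝
        cover″ p = [ (λ q → ∈∪ˡ (∈∪ˡ (∈∖ q λ r → ∈∖ʳ (∈∩ˡ p) (∈∪ʳ r)))) , (λ q → [ ∈∪ˡ ∘ ∈∪ʳ , ∈∪ʳ ]′ (∈∪⁻ q)) ]′ (cover′ (cover (∈∩ (∈∖ˡ (∈∩ˡ p)) (∈∩ʳ p))))
        deg′ : ∀ {j} → j ∈ K₂ → # (S ∩ e j) ≤ suc (# (S′ ∩ e j))
        deg′ {j} p = lin (# (S ∩ e j) ∷ # (S′ ∩ e j) ∷ # ｛ f ｝ ∷ [])
          ((x₀ ≲ x₁ ⊕ x₂ by count (S ∩ e j ∷ S′ ∩ e j ∷ ｛ f ｝ ∷ []) ((x₀ ⊑ x₁ ∨ᶠ x₂ by lost) ∷ []) ⟨ x₀ ⟩ (⟨ x₁ ⟩ ⊕ ⟨ x₂ ⟩))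
          ∷ (x₂ ≲ κ 1 by ≤-reflexive (#｛｝ f)) ∷ []) x₀ (κ 1 ⊕ x₁)
          where
          lost : S ∩ e j ⊆ S′ ∩ e j ∪ ｛ f ｝
          lost {x} q with x ∈? ｛ f ｝
          ... | yes r = ∈∪ʳ r
          ... | no  r = ∈∪ˡ (∈∩ (∈∖ (∈∩ˡ q) λ t → [ r , (λ u → nbr-ind tf v∈ (K₂⊆ p) (U⊆ a∈) (subst (_∈ e j) (sym (｛｝⁻ u)) (∈∩ʳ q))) ]′ (∈∪⁻ t)) (∈∩ʳ q))
        sizeS′ : # S′ + 2 ≤ # S
        sizeS′ = lin (# S′ ∷ # S ∷ # ｛ f ｝ ∷ # ｛ a ｝ ∷ [])
          ((x₀ ⊕ x₂ ⊕ x₃ ≲ x₁ by count (S ∷ ｛ f ｝ ∷ ｛ a ｝ ∷ [])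
              ((x₁ ⊑ x₀ by ｛｝⊆ (X⊆S fX)) ∷ (x₂ ⊑ x₀ by ｛｝⊆ (∈∩ˡ (U⊆ a∈))) ∷ (x₁ ∧ᶠ x₂ ⊑ ff by λ p → ⊥-elim (e≢ fa (trans (｛｝⁻ (∈∩ˡ p)) (sym (｛｝⁻ (∈∩ʳ p)))))) ∷ [])
              (⟨ x₀ ∖ᶠ (x₁ ∨ᶠ x₂) ⟩ ⊕ ⟨ x₁ ⟩ ⊕ ⟨ x₂ ⟩) ⟨ x₀ ⟩)
          ∷ (κ 1 ≲ x₂ by ≤-reflexive (sym (#｛｝ f))) ∷ (κ 1 ≲ x₃ by ≤-reflexive (sym (#｛｝ a))) ∷ []) (x₀ ⊕ κ 2) x₁
        dead′ : ∀ {J x} → J ⊆ S′ ∖ (U ∖ ｛ a ｝) ∖ ｛ v ｝ → Ind J → 7 ≤ # J → x ∈ J → x ∉ K₁ ∪ ｛ i ｝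
        dead′ {J} J⊆ j l p q = [ dead J⊆′ j l p , (λ r → through-i (subst (_∈ J) (sym (｛｝⁻ r)) p)) ]′ (∈∪⁻ q)
          where
          J⊆′ : J ⊆ S ∖ U ∖ ｛ v ｝
          J⊆′ p = let q = J⊆ p ; r = ∈∖ˡ (∈∖ˡ q) in
            ∈∖ (∈∖ (∈∖ˡ r) λ t → ∈∖ʳ (∈∖ˡ q) (∈∖ t λ u → ∈∖ʳ r (∈∪ʳ u))) (∈∖ʳ q)
          through-i : i ∈ J → ⊥
          through-i p = let s , b = through J⊆′ j l p in
            ∈∖ʳ (∈∖ˡ (∈∖ˡ (J⊆ (∈∖ˡ (core⊆ (Ind-⊆ ∈∖ˡ j) s b f∈))))) (∈∪ˡ ∈｛｝)
        go : ∀ ρ → # U ≡ ρ → # S ≤ ρ + ρ + 13 + τ → (∀ {i} → i ∈ K₂ → ρ + 1 + s ≤ # (S ∩ e i)) → # K₂ < ρ → ¬ Br 7 ρ S → ⊥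
        go zero    _ _ _ () _
        go (suc ρ) sizeU sizeS deg room nb = kill m τ≤1 m′ record
          { tf = TF-⊆ ∈∖ˡ tf ; v∈ = keep v∈ (λ { refl → ∈∖ʳ (∈∖ˡ (∈∖ˡ (∈∖ˡ (∈∖ˡ fX)))) ∈｛｝ }) (λ { refl → e≢ av refl })
          ; U⊆ = U⊆′ ; K₁⊆ = K₁⊆′ ; K₂⊆ = K₂⊆′ ; cover = cover″
          ; U#K₁ = U#i ∘ ∈∖ˡ ; U#K₂ = λ p q → U#K₂ (∈∖ˡ p) (∈∖ˡ q) ; K₁#K₂ = K₁#K₂′
          ; sizeU = ≤-antisym (≤-pred (≤-trans (#-∖∈ a∈) (≤-reflexive sizeU))) (≤-pred (≤-trans (≤-reflexive (sym sizeU)) #-∖｛｝))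
          ; sizeS = lin (# S′ ∷ # S ∷ ρ ∷ τ ∷ []) ((x₀ ⊕ κ 2 ≲ x₁ by sizeS′) ∷ (x₁ ≲ κ 1 ⊕ (x₂ ⊕ (κ 1 ⊕ x₂)) ⊕ κ 13 ⊕ x₃ by sizeS) ∷ []) x₀ (x₂ ⊕ x₂ ⊕ κ 13 ⊕ x₃)
          ; deg = λ {j} p → lin (# (S ∩ e j) ∷ # (S′ ∩ e j) ∷ ρ ∷ s ∷ []) ((κ 1 ⊕ x₂ ⊕ κ 1 ⊕ x₃ ≲ x₀ by deg (∈∖ˡ p)) ∷ (x₀ ≲ κ 1 ⊕ x₁ by deg′ (∈∖ˡ p)) ∷ []) (x₂ ⊕ κ 1 ⊕ x₃) x₁
          ; τ≤ = τ≤′ ; dead = dead′ ; room = ≤-trans (#-∖∈ i∈) (≤-pred room)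
          ; slack = inj₁ (i , ∈∪ʳ ∈｛｝) ; unbroken = drop {r = ρ} nb (Clique-edge fa) }

  -- Reductions by an edge or a triangle; one and two cliques

  Br₀ : ∀ r {S} → NoInd 7 S → Br 7 r S
  Br₀ zero    h = h
  Br₀ (suc r) h = Br-suc {r = r} (Br₀ r h)

  opaque
    maximum : ∀ {S} → ¬ NoInd 7 S → Σ (VS n) λ J → Ind J × J ⊆ S × 7 ≤ # J
    maximum h with core? bound₇
    ... | inj₁ c    = Core.some c
    ... | inj₂ none = ⊥-elim (h none)

  size-edge : ∀ {S a b} → a ∈ S → b ∈ S → b ∈ e a → # (S ∖ edge a b) + 2 ≤ # S
  size-edge {S} {a} {b} p q h = lin (# (S ∖ edge a b) ∷ # (edge a b) ∷ # S ∷ # ｛ a ｝ ∷ [])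
    ((x₀ ⊕ x₁ ≲ x₂ by ≤-reflexive (#-∖⊆ (∪⊆ (｛｝⊆ p) (｛｝⊆ q))))
    ∷ (x₃ ⊕ κ 1 ≲ x₁ by #-∪｛｝ (λ r → e≢ h (｛｝⁻ r)))
    ∷ (κ 1 ≲ x₃ by ≤-reflexive (sym (#｛｝ a))) ∷ []) (x₀ ⊕ κ 2) x₂

  size-triangle : ∀ {S a b c} → a ∈ S → b ∈ S → c ∈ S → b ∈ e a → c ∈ e b → c ∈ e a → # (S ∖ (edge a b ∪ ｛ c ｝)) + 3 ≤ # S
  size-triangle {S} {a} {b} {c} p q r h h′ h″ = lin (# (S ∖ (edge a b ∪ ｛ c ｝)) ∷ # (edge a b) ∷ # S ∷ # ｛ a ｝ ∷ # (edge a b ∪ ｛ c ｝) ∷ [])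
    ((x₀ ⊕ x₄ ≲ x₂ by ≤-reflexive (#-∖⊆ (∪⊆ (∪⊆ (｛｝⊆ p) (｛｝⊆ q)) (｛｝⊆ r))))
    ∷ (x₁ ⊕ κ 1 ≲ x₄ by #-∪｛｝ (λ t → [ (λ u → e≢ h″ (｛｝⁻ u)) , (λ u → e≢ h′ (｛｝⁻ u)) ]′ (∈∪⁻ t)))
    ∷ (x₃ ⊕ κ 1 ≲ x₁ by #-∪｛｝ (λ t → e≢ h (｛｝⁻ t)))
    ∷ (κ 1 ≲ x₃ by ≤-reflexive (sym (#｛｝ a))) ∷ []) (x₀ ⊕ κ 3) x₂

  Clique-triangle : ∀ {a b c} → b ∈ e a → c ∈ e b → c ∈ e a → Clique (edge a b ∪ ｛ c ｝)
  Clique-triangle h h′ h″ = Clique-∪ (Clique-edge h) λ p →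
    [ (λ q → subst (_∈ e _) (｛｝⁻ q) (e⇄ h″)) , (λ q → subst (_∈ e _) (｛｝⁻ q) (e⇄ h′)) ]′ (∈∪⁻ p)

  -- Double negation is enough, as only contradictions are drawn from it, and it allows a
  -- counterexample to be assumed without deciding `Br`.
  Breakable : ℕ → ℕ → Set
  Breakable r c = ∀ {S} → # S ≤ c → ¬ ¬ Br 7 r S

  opaque
    has-edge : ∀ r {S} → ¬ Br 7 (suc r) S → ∃ λ v → ∃ λ u → v ∈ S × u ∈ S × u ∈ e v
    has-edge r {S} nb =
      let J , i , J⊆ , l = maximum (λ h → nb (Br₀ (suc r) h)) ; v , p = #-inhabited (≤-trans (s≤s z≤n) l)
          u , q = #-inhabited (≤-trans (s≤s z≤n) (degree≥ r bound₇ nb (J⊆ p)))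
      in v , u , J⊆ p , ∈∩ˡ q , ∈∩ʳ q

  from-edge : ∀ {r c} → Breakable r c → Breakable (suc r) (c + 2)
  from-edge {r} {c} br {S} l nb =
    let v , u , p , q , h = has-edge r nb in
    br (+-cancelʳ-≤ 2 _ c (≤-trans (size-edge p q h) l)) (drop {r = r} nb (Clique-edge h))

  triangle-free : ∀ {r c S} → Breakable r c → # S ≤ c + 3 → ¬ Br 7 (suc r) S → TF S
  triangle-free {r} {c} br l nb p q s h h′ h″ =
    br (+-cancelʳ-≤ 3 _ c (≤-trans (size-triangle p q s h h′ h″) l)) (drop {r = r} nb (Clique-triangle h h′ h″))

  -- In an unbroken set a maximum independent set has 7 vertices and at least 8 neighbours, 15
  -- vertices in all.
  break₁ : Breakable 1 14
  break₁ {S} l nb =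
    let J , i , J⊆ , l′ = maximum (λ h → nb (Br₀ 1 h)) in
    absurd (# J ∷ # (N S J) ∷ # S ∷ [])
      ((x₀ ⊕ κ 1 ≲ x₁ by surplus 0 bound₇ nb J⊆ i (#-inhabited (≤-trans (s≤s z≤n) l′)))
      ∷ (κ 7 ≲ x₀ by l′) ∷ (κ 7 ≲ x₀ by l′) ∷ (x₂ ≲ κ 14 by l)
      ∷ (x₀ ⊕ x₁ ≲ x₂ by count (J ∷ N S J ∷ S ∷ []) ((x₀ ⊑ x₂ by J⊆) ∷ (x₁ ⊑ x₂ by N⊆) ∷ (x₁ ∧ᶠ x₀ ⊑ ff by λ p → ⊥-elim (N-∉ i (∈∩ˡ p) (∈∩ʳ p))) ∷ [])
          (⟨ x₀ ⟩ ⊕ ⟨ x₁ ⟩) ⟨ x₂ ⟩) ∷ [])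

  break₂ : Breakable 2 16
  break₂ = from-edge break₁

  -- The budget pays for r leaves, so s + 1 of the r + 1 + s neighbours go to `K₂`. The size 2r + 13
  -- + τ is 19 for r = 3 with τ = 0 and 22 for r = 4 with τ = 1; 25 for r = 5 would require τ = 2.
  start : ∀ {r s τ S v} → τ ≤ 1 → τ ≤ s → s + 2 ≤ r → TF S → # S ≤ r + r + 13 + τ → v ∈ S → # (S ∩ e v) ≡ r + 1 + s →
          (∀ {u} → u ∈ S → r + 1 + s ≤ # (S ∩ e u)) → Slack S v ∅ (r + τ) → ¬ Br 7 r S → ⊥
  start {r} {s} {τ} {S} {v} τ≤1 τ≤s room tf sizeS v∈ deg≡ deg slack nb with shrink (s + 1) {S ∩ e v} (≤-trans (lin (r ∷ s ∷ []) [] (x₁ ⊕ κ 1) (x₀ ⊕ κ 1 ⊕ x₁)) (≤-reflexive (sym deg≡)))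
  ... | K , K⊆ , sizeK = kill (s + 1) τ≤1 (≤-reflexive sizeK) record
    { tf = tf ; v∈ = v∈ ; U⊆ = ∈∖ˡ ; K₁⊆ = λ p → ⊥-elim (∉∅ p) ; K₂⊆ = K⊆
    ; cover = λ {x} p → cover p (x ∈? K)
    ; U#K₁ = λ _ → ∉∅ ; U#K₂ = ∈∖ʳ ; K₁#K₂ = λ p → ⊥-elim (∉∅ p)
    ; sizeU = +-cancelʳ-≡ (s + 1) _ r (trans (cong (# ((S ∩ e v) ∖ K) +_) (sym sizeK)) (trans (#-∖⊆ K⊆) (trans deg≡ (trans (+-assoc r 1 s) (cong (r +_) (+-comm 1 s))))))
    ; sizeS = sizeS ; deg = λ p → deg (∈∩ˡ (K⊆ p)) ; τ≤ = ≤-trans τ≤s (m≤m+n s _)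
    ; dead = λ _ _ _ _ → ∉∅
    ; room = lin (# K ∷ s ∷ r ∷ []) ((x₀ ≲ x₁ ⊕ κ 1 by ≤-reflexive sizeK) ∷ (x₁ ⊕ κ 2 ≲ x₂ by room) ∷ []) (κ 1 ⊕ x₀) x₂
    ; slack = inj₂ slack ; unbroken = nb }
    where
    cover : ∀ {x} → x ∈ S ∩ e v → Dec (x ∈ K) → x ∈ (S ∩ e v) ∖ K ∪ ∅ ∪ K
    cover p (yes q) = ∈∪ʳ q
    cover p (no q)  = ∈∪ˡ (∈∪ˡ (∈∖ p q))

  -- Losing both ends would mean a triangle.
  deg-edge : ∀ {S a b v} → TF S → a ∈ S → b ∈ S → b ∈ e a → v ∈ S → # (S ∩ e v) ≤ # ((S ∖ edge a b) ∩ e v) + 1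
  deg-edge {S} {a} {b} {v} tf p q h v∈ with a ∈? e v
  ... | yes r = lin (# (S ∩ e v) ∷ # ((S ∖ edge a b) ∩ e v) ∷ # ｛ a ｝ ∷ [])
        ((x₀ ≲ x₁ ⊕ x₂ by count (S ∷ e v ∷ ｛ a ｝ ∷ ｛ b ｝ ∷ []) ((x₁ ∧ᶠ x₃ ⊑ ff by λ t → ⊥-elim (tf v∈ p q r h (subst (_∈ e v) (sym (｛｝⁻ (∈∩ʳ t))) (∈∩ˡ t)))) ∷ [])
           ⟨ x₀ ∧ᶠ x₁ ⟩ (⟨ (x₀ ∖ᶠ (x₂ ∨ᶠ x₃)) ∧ᶠ x₁ ⟩ ⊕ ⟨ x₂ ⟩)) ∷ (x₂ ≲ κ 1 by ≤-reflexive (#｛｝ a)) ∷ []) x₀ (x₁ ⊕ κ 1)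
  ... | no  r = lin (# (S ∩ e v) ∷ # ((S ∖ edge a b) ∩ e v) ∷ # ｛ b ｝ ∷ [])
        ((x₀ ≲ x₁ ⊕ x₂ by count (S ∷ e v ∷ ｛ a ｝ ∷ ｛ b ｝ ∷ []) ((x₁ ∧ᶠ x₂ ⊑ ff by λ t → ⊥-elim (r (subst (_∈ e v) (sym (｛｝⁻ (∈∩ʳ t))) (∈∩ˡ t)))) ∷ [])
           ⟨ x₀ ∧ᶠ x₁ ⟩ (⟨ (x₀ ∖ᶠ (x₂ ∨ᶠ x₃)) ∧ᶠ x₁ ⟩ ⊕ ⟨ x₃ ⟩)) ∷ (x₂ ≲ κ 1 by ≤-reflexive (#｛｝ b)) ∷ []) x₀ (x₁ ⊕ κ 1)

  -- Three cliques: perfect matchings across a maximum independent set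

  data Match (A : VS n) : ℕ → VS n → Set where
    []   : ∀ {L} → (∀ {x} → x ∉ L) → Match A 0 L
    pair : ∀ {j L} a b → a ∈ L → b ∈ L → a ∈ A → b ∉ A → b ∈ e a → Match A j (L ∖ edge a b) → Match A (suc j) L

  data Pair {A : VS n} (x y : Fin n) : ∀ {j L} → Match A j L → Set where
    here  : ∀ {j L p q r s t} {M : Match A j (L ∖ edge x y)} → Pair x y (pair {L = L} x y p q r s t M)
    there : ∀ {j L a b p q r s t} {M : Match A j (L ∖ edge a b)} → Pair x y M → Pair x y (pair {L = L} a b p q r s t M)

  module _ {A : VS n} where

    Pair-L : ∀ {j L x y} {M : Match A j L} → Pair x y M → x ∈ L × y ∈ L × x ∈ A × y ∉ A × y ∈ e x
    Pair-L (here {p = p} {q} {r} {s} {t}) = p , q , r , s , t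
    Pair-L (there m) = let p , q , r = Pair-L m in ∈∖ˡ p , ∈∖ˡ q , r

    opaque
      partner : ∀ {j L y} (M : Match A j L) → y ∈ L → y ∉ A → ∃ λ x → Pair x y M
      partner ([] h) p q = ⊥-elim (h p)
      partner {y = y} (pair a b _ _ r _ _ M) p q with y ∈? ｛ b ｝
      ... | yes u with ｛｝⁻ u
      ...   | refl = a , here
      partner (pair a b _ _ r _ _ M) p q | no u =
        let x , m = partner M (∈∖ p λ t → [ (λ v → q (subst (_∈ A) (｛｝⁻ v) r)) , u ]′ (∈∪⁻ t)) q in x , there m

    module _ {J : VS n} (i : Ind J) where

      private
        split : ∀ {L a b} → b ∈ e a → # (J ∩ L) ≤ # (J ∩ (L ∖ edge a b)) + 1
        split {L} {a} {b} h with a ∈? J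
        ... | yes p = lin (# (J ∩ L) ∷ # (J ∩ (L ∖ edge a b)) ∷ # ｛ a ｝ ∷ [])
              ((x₀ ≲ x₁ ⊕ x₂ by count (J ∷ L ∷ ｛ a ｝ ∷ ｛ b ｝ ∷ []) ((x₀ ∧ᶠ x₃ ⊑ ff by λ t → ⊥-elim (i p (subst (_∈ J) (sym (｛｝⁻ (∈∩ʳ t))) (∈∩ˡ t)) h)) ∷ [])
                ⟨ x₀ ∧ᶠ x₁ ⟩ (⟨ x₀ ∧ᶠ (x₁ ∖ᶠ (x₂ ∨ᶠ x₃)) ⟩ ⊕ ⟨ x₂ ⟩)) ∷ (x₂ ≲ κ 1 by ≤-reflexive (#｛｝ a)) ∷ []) x₀ (x₁ ⊕ κ 1)
        ... | no  p = lin (# (J ∩ L) ∷ # (J ∩ (L ∖ edge a b)) ∷ # ｛ b ｝ ∷ [])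
              ((x₀ ≲ x₁ ⊕ x₂ by count (J ∷ L ∷ ｛ a ｝ ∷ ｛ b ｝ ∷ []) ((x₀ ∧ᶠ x₂ ⊑ ff by λ t → ⊥-elim (p (subst (_∈ J) (sym (｛｝⁻ (∈∩ʳ t))) (∈∩ˡ t)))) ∷ [])
                ⟨ x₀ ∧ᶠ x₁ ⟩ (⟨ x₀ ∧ᶠ (x₁ ∖ᶠ (x₂ ∨ᶠ x₃)) ⟩ ⊕ ⟨ x₃ ⟩)) ∷ (x₂ ≲ κ 1 by ≤-reflexive (#｛｝ b)) ∷ []) x₀ (x₁ ⊕ κ 1)
        skip : ∀ {L a b} → a ∉ J → b ∉ J → # (J ∩ L) ≤ # (J ∩ (L ∖ edge a b))
        skip p q = #-mono λ t → ∈∩ (∈∩ˡ t) (∈∖ (∈∩ʳ t) λ u →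
          [ (λ v → p (subst (_∈ J) (sym (｛｝⁻ v)) (∈∩ˡ t))) , (λ v → q (subst (_∈ J) (sym (｛｝⁻ v)) (∈∩ˡ t))) ]′ (∈∪⁻ u))

      match-bound : ∀ {j L} → Match A j L → # (J ∩ L) ≤ j
      match-bound ([] h) = ≤-reflexive (#∅ (h ∘ ∈∩ʳ))
      match-bound {suc j} (pair _ _ _ _ _ _ t M) = ≤-trans (split t) (≤-trans (+-monoˡ-≤ 1 (match-bound M)) (≤-reflexive (+-comm j 1)))

      match-bound₁ : ∀ {j L x y} {M : Match A j L} → Pair x y M → x ∉ J → y ∉ J → # (J ∩ L) + 1 ≤ j
      match-bound₁ {suc j} (here {M = M}) p q = ≤-trans (+-monoˡ-≤ 1 (≤-trans (skip p q) (match-bound M))) (≤-reflexive (+-comm j 1))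
      match-bound₁ {suc j} (there {t = t} m) p q = ≤-trans (+-monoˡ-≤ 1 (split t)) (≤-trans (+-monoˡ-≤ 1 (match-bound₁ m p q)) (≤-reflexive (+-comm j 1)))

      match-bound₂ : ∀ {j L x y x′ y′} {M : Match A j L} → Pair x y M → Pair x′ y′ M → y ≢ y′ →
                     x ∉ J → y ∉ J → x′ ∉ J → y′ ∉ J → # (J ∩ L) + 2 ≤ j
      match-bound₂ here here d = ⊥-elim (d refl)
      match-bound₂ {suc j} {L} (here {M = M}) (there m) d p q p′ q′ =
        lin (# (J ∩ L) ∷ _ ∷ j ∷ []) ((x₀ ≲ x₁ by skip p q) ∷ (x₁ ⊕ κ 1 ≲ x₂ by match-bound₁ m p′ q′) ∷ []) (x₀ ⊕ κ 2) (κ 1 ⊕ x₂)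
      match-bound₂ {suc j} {L} (there m) here d p q p′ q′ =
        lin (# (J ∩ L) ∷ _ ∷ j ∷ []) ((x₀ ≲ x₁ by skip p′ q′) ∷ (x₁ ⊕ κ 1 ≲ x₂ by match-bound₁ m p q) ∷ []) (x₀ ⊕ κ 2) (κ 1 ⊕ x₂)
      match-bound₂ {suc j} {L} (there {t = t} m) (there m′) d p q p′ q′ =
        lin (# (J ∩ L) ∷ _ ∷ j ∷ []) ((x₀ ≲ x₁ ⊕ κ 1 by split t) ∷ (x₁ ⊕ κ 2 ≲ x₂ by match-bound₂ m m′ d p q p′ q′) ∷ []) (x₀ ⊕ κ 2) (κ 1 ⊕ x₂)

    -- The matching maps `W ∩ L` injectively into `E ∩ L`.
    transfer : ∀ {j L E W} (M : Match A j L) → (∀ {x} → x ∈ W → x ∉ A) → (∀ {x y} → Pair x y M → y ∈ W → x ∈ E) →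
               # (W ∩ L) ≤ # (E ∩ L)
    transfer ([] h) _ _ = ≤-trans (≤-reflexive (#∅ (h ∘ ∈∩ʳ))) z≤n
    transfer {L = L} {E} {W} (pair a b p q r s t M) WA h with b ∈? W
    ... | no b∉ = ≤-trans (#-mono λ u → ∈∩ (∈∩ˡ u) (∈∖ (∈∩ʳ u) λ w →
            [ (λ v → WA (∈∩ˡ u) (subst (_∈ A) (｛｝⁻ v) r)) , (λ v → b∉ (subst (_∈ W) (sym (｛｝⁻ v)) (∈∩ˡ u))) ]′ (∈∪⁻ w)))
          (≤-trans (transfer {E = E} M WA (h ∘ there)) (#-mono λ u → ∈∩ (∈∩ˡ u) (∈∖ˡ (∈∩ʳ u))))
    ... | yes b∈ = lin (# (W ∩ L) ∷ # (W ∩ (L ∖ edge a b)) ∷ # (E ∩ L) ∷ # (E ∩ (L ∖ edge a b)) ∷ # ｛ a ｝ ∷ # ｛ b ｝ ∷ [])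
          ((x₀ ≲ x₁ ⊕ x₅ by count (W ∷ L ∷ ｛ a ｝ ∷ ｛ b ｝ ∷ []) ((x₀ ∧ᶠ x₂ ⊑ ff by λ u → ⊥-elim (WA (∈∩ˡ u) (subst (_∈ A) (｛｝⁻ (∈∩ʳ u)) r))) ∷ [])
              ⟨ x₀ ∧ᶠ x₁ ⟩ (⟨ x₀ ∧ᶠ (x₁ ∖ᶠ (x₂ ∨ᶠ x₃)) ⟩ ⊕ ⟨ x₃ ⟩))
          ∷ (x₅ ≲ κ 1 by ≤-reflexive (#｛｝ b)) ∷ (κ 1 ≲ x₄ by ≤-reflexive (sym (#｛｝ a)))
          ∷ (x₁ ≲ x₃ by transfer M WA (h ∘ there))
          ∷ (x₃ ⊕ x₄ ≲ x₂ by count (E ∷ L ∷ ｛ a ｝ ∷ ｛ b ｝ ∷ []) ((x₂ ⊑ x₀ ∧ᶠ x₁ by ｛｝⊆ (∈∩ (h here b∈) p)) ∷ [])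
              (⟨ x₀ ∧ᶠ (x₁ ∖ᶠ (x₂ ∨ᶠ x₃)) ⟩ ⊕ ⟨ x₂ ⟩) ⟨ x₀ ∧ᶠ x₁ ⟩) ∷ []) x₀ x₂

  -- König's theorem needs both sides independent, so only the edges across `A` are kept.
  module Bip (A : VS n) where

    e′ : Fin n → VS n
    e′ x y = e x y ∧ (A x xor A y)

    e′-sym : ∀ x y → e′ x y ≡ e′ y x
    e′-sym x y = cong₂ _∧_ (e-sym x y) (xor-comm (A x) (A y))

    e′-irr : ∀ x → e′ x x ≡ false
    e′-irr x = trans (cong (e x x ∧_) (xor-same (A x))) (∧-zeroʳ (e x x))

    module B = Graphs e′ e′-sym e′-irr
    module BS = Surplus e′ e′-sym e′-irr

    e′-elim : ∀ {x y} → y ∈ e′ x → y ∈ e x × ((x ∈ A × y ∉ A) ⊎ (x ∉ A × y ∈ A))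
    e′-elim {x} {y} (mem p) with e x y in q | A x in r | A y in s | p
    ... | true | true  | false | _ = mem q , inj₁ (mem r , λ { (mem t) → case-⊥ (trans (sym s) t) })
      where
      case-⊥ : false ≢ true
      case-⊥ ()
    ... | true | false | true  | _ = mem q , inj₂ ((λ { (mem t) → case-⊥ (trans (sym r) t) }) , mem s)
      where
      case-⊥ : false ≢ true
      case-⊥ ()

    e′-intro : ∀ {x y} → y ∈ e x → x ∈ A → y ∉ A → y ∈ e′ x
    e′-intro {x} {y} (mem p) (mem q) r with A y in s
    ... | true  = ⊥-elim (r (mem s))
    ... | false = mem (trans (cong₂ _∧_ p (cong₂ _xor_ q s)) refl)

    no-triangle : ∀ {x y z} → y ∈ e′ x → z ∈ e′ y → z ∈ e′ x → ⊥
    no-triangle p q r with proj₂ (e′-elim p) | proj₂ (e′-elim q) | proj₂ (e′-elim r)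
    ... | inj₁ (a , b) | inj₁ (c , d) | _ = b c
    ... | inj₁ (a , b) | inj₂ (c , d) | inj₁ (u , v) = v d
    ... | inj₁ (a , b) | inj₂ (c , d) | inj₂ (u , v) = u a
    ... | inj₂ (a , b) | inj₂ (c , d) | _ = c b
    ... | inj₂ (a , b) | inj₁ (c , d) | inj₁ (u , v) = a u
    ... | inj₂ (a , b) | inj₁ (c , d) | inj₂ (u , v) = d v

    Q≤2 : ∀ {L Q} → B.Clique Q → # L ≤ # (L ∖ Q) + 2
    Q≤2 {L} {Q} c = +-cancelˡ-≤ 0 _ _ (lin (# L ∷ # (L ∖ Q) ∷ # Q ∷ [])
      ((x₀ ≲ x₁ ⊕ x₂ by count (L ∷ Q ∷ []) [] ⟨ x₀ ⟩ (⟨ x₀ ∖ᶠ x₁ ⟩ ⊕ ⟨ x₁ ⟩)) ∷ (x₂ ≲ κ 2 by small) ∷ []) (κ 0 ⊕ x₀) (κ 0 ⊕ (x₁ ⊕ κ 2)))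
      where
      small : # Q ≤ 2
      small = ≮⇒≥ λ h → let x , p = #-inhabited {A = Q} (≤-trans (s≤s z≤n) h)
                            y , z , q , r , d = two {A = Q ∖ ｛ x ｝} (≤-pred (≤-trans h #-∖｛｝))
        in no-triangle (c p (∈∖ˡ q) (∖≢ q)) (c (∈∖ˡ q) (∈∖ˡ r) d) (c p (∈∖ˡ r) (∖≢ r))

    cov-small : ∀ {j L} → B.Cov j L → # L ≤ j + j
    cov-small (B.[] h) = ≤-reflexive (#∅ h)
    cov-small {suc j} {L} (B._∷_ {Q = Q} c cs) = lin (# L ∷ # (L ∖ Q) ∷ j ∷ []) ((x₀ ≲ x₁ ⊕ κ 2 by Q≤2 c) ∷ (x₁ ≲ x₂ ⊕ x₂ by cov-small cs) ∷ []) x₀ (κ 1 ⊕ (x₂ ⊕ (κ 1 ⊕ x₂)))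

    opaque
      -- Cliques of a bipartite graph have at most 2 vertices, so j of them can cover 2j vertices
      -- only as a perfect matching.
      match : ∀ {j L} → B.Cov j L → j + j ≤ # L → Match A j L
      match (B.[] h) _ = [] h
      match {suc j} {L} (B._∷_ {Q = Q} c cs) large =
        let x , y , p , q , d = two {A = L ∩ Q} both in build p q (c (∈∩ʳ p) (∈∩ʳ q) d)
        where
        parts : # L ≤ # (L ∖ Q) + # (L ∩ Q)
        parts = count (L ∷ Q ∷ []) [] ⟨ x₀ ⟩ (⟨ x₀ ∖ᶠ x₁ ⟩ ⊕ ⟨ x₀ ∧ᶠ x₁ ⟩)
        both : 2 ≤ # (L ∩ Q)
        both = lin (# L ∷ # (L ∖ Q) ∷ # (L ∩ Q) ∷ j ∷ [])
          ((x₀ ≲ x₁ ⊕ x₂ by parts) ∷ (x₁ ≲ x₃ ⊕ x₃ by cov-small cs) ∷ (κ 1 ⊕ (x₃ ⊕ (κ 1 ⊕ x₃)) ≲ x₀ by large) ∷ []) (κ 2) x₂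
        rest : j + j ≤ # (L ∖ Q)
        rest = lin (# L ∷ # (L ∖ Q) ∷ j ∷ []) ((x₀ ≲ x₁ ⊕ κ 2 by Q≤2 c) ∷ (κ 1 ⊕ (x₂ ⊕ (κ 1 ⊕ x₂)) ≲ x₀ by large) ∷ []) (x₂ ⊕ x₂) x₁
        inside : ∀ {a b} → a ∈ L ∩ Q → b ∈ L ∩ Q → b ∈ e′ a → L ∖ edge a b ⊆ L ∖ Q
        inside {a} {b} p q h t = ∈∖ (∈∖ˡ t) λ z → no-triangle h
          (c (∈∩ʳ q) z λ { refl → ∈∖ʳ t (∈∪ʳ ∈｛｝) }) (c (∈∩ʳ p) z λ { refl → ∈∖ʳ t (∈∪ˡ ∈｛｝) })
        build : ∀ {a b} → a ∈ L ∩ Q → b ∈ L ∩ Q → b ∈ e′ a → Match A (suc j) L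
        build p q h with e′-elim h
        ... | g , inj₁ (a∈ , b∉) = pair _ _ (∈∩ˡ p) (∈∩ˡ q) a∈ b∉ g (match (B.Cov-⊆ (inside p q h) cs) (≤-trans rest (#-mono (λ t → ∈∖ (∈∖ˡ t) λ u → ∈∖ʳ t (∪⊆ (｛｝⊆ (∈∩ʳ p)) (｛｝⊆ (∈∩ʳ q)) u)))))
        ... | g , inj₂ (a∉ , b∈) = pair _ _ (∈∩ˡ q) (∈∩ˡ p) b∈ a∉ (e⇄ g) (match (B.Cov-⊆ (inside q p (B.e⇄ h)) cs) (≤-trans rest (#-mono (λ t → ∈∖ (∈∖ˡ t) λ u → ∈∖ʳ t (∪⊆ (｛｝⊆ (∈∩ʳ q)) (｛｝⊆ (∈∩ʳ p)) u)))))

  -- The 7 vertices of a maximum independent set J that avoids a pair are x and one from each other pair.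
  module Chain {S A L : VS n} {x y : Fin n} (tf : TF S) (nb : ¬ Br 7 1 S)
               (A⊆ : A ⊆ S) (A-ind : Ind A) (surplusA : ∀ {E} → E ⊆ A → (∃ λ x → x ∈ E) → # E + 1 ≤ # (N S E))
               (x∈ : x ∈ S) (y∈ : y ∈ S) (y∉ : y ∉ A) (xy : y ∈ e x) (deg : ∀ {v} → v ∈ S → 3 ≤ # (S ∩ e v))
               (inL : ∀ {z} → z ∈ S → z ≢ x → z ∈ L) (M : Match A 7 L) where

    alternate : ∀ {a b J} → Pair a b M → J ⊆ S ∖ edge a b → Ind J → 7 ≤ # J →
                x ∈ J × (∀ {a′ b′} → Pair a′ b′ M → b′ ≢ b → b′ ∉ J → a′ ∈ J)
    alternate {a} {b} {J} m J⊆ j large = x∈J , other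
      where
      a∉ : a ∉ J
      a∉ p = ∈∖ʳ (J⊆ p) (∈∪ˡ ∈｛｝)
      b∉ : b ∉ J
      b∉ p = ∈∖ʳ (J⊆ p) (∈∪ʳ ∈｛｝)
      x∈J : x ∈ J
      x∈J with x ∈? J
      ... | yes p = p
      ... | no  p = ⊥-elim (absurd (# J ∷ # (J ∩ L) ∷ [])
            ((κ 7 ≲ x₀ by large) ∷ (x₀ ≲ x₁ by #-mono (λ q → ∈∩ q (inL (∈∖ˡ (J⊆ q)) (∉-resp q p)))) ∷ (x₁ ⊕ κ 1 ≲ κ 7 by match-bound₁ j m a∉ b∉) ∷ []))
      other : ∀ {a′ b′} → Pair a′ b′ M → b′ ≢ b → b′ ∉ J → a′ ∈ J
      other {a′} {b′} m′ d q with a′ ∈? J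
      ... | yes p = p
      ... | no  p = ⊥-elim (absurd (# J ∷ # (J ∩ L) ∷ # ｛ x ｝ ∷ [])
            ((κ 7 ≲ x₀ by large)
            ∷ (x₀ ≲ x₁ ⊕ x₂ by count (J ∷ J ∩ L ∷ ｛ x ｝ ∷ []) ((x₀ ⊑ x₁ ∨ᶠ x₂ by near) ∷ []) ⟨ x₀ ⟩ (⟨ x₁ ⟩ ⊕ ⟨ x₂ ⟩))
            ∷ (x₂ ≲ κ 1 by ≤-reflexive (#｛｝ x)) ∷ (x₁ ⊕ κ 2 ≲ κ 7 by match-bound₂ j m′ m d p q a∉ b∉) ∷ []))
        where
        near : J ⊆ J ∩ L ∪ ｛ x ｝
        near {z} r with z ≟ x
        ... | yes refl = ∈∪ʳ ∈｛｝
        ... | no  d′   = ∈∪ˡ (∈∩ r (inL (∈∖ˡ (J⊆ r)) d′))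
    y∈L : y ∈ L
    y∈L = inL y∈ (e≢ xy ∘ sym)
    a₁ = proj₁ (partner M y∈L (y∉))
    m₁ = proj₂ (partner M y∈L (y∉))
    a₁A : a₁ ∈ A
    a₁A = proj₁ (proj₂ (proj₂ (Pair-L m₁)))
    a₁y : y ∈ e a₁
    a₁y = proj₂ (proj₂ (proj₂ (proj₂ (Pair-L m₁))))
    others : 2 ≤ # (S ∩ e a₁ ∖ ｛ y ｝)
    others = ≤-pred (≤-trans (deg (A⊆ a₁A)) #-∖｛｝)
    max : ∀ {a b} → Pair a b M → Σ (VS n) λ J → Ind J × J ⊆ S ∖ edge a b × 7 ≤ # J
    max m = maximum (drop {r = 0} nb (Clique-edge (proj₂ (proj₂ (proj₂ (proj₂ (Pair-L m)))))))

    bA : ∀ {b} → b ∈ S ∩ e a₁ ∖ ｛ y ｝ → b ∉ A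
    bA p q = A-ind a₁A q (∈∩ʳ (∈∖ˡ p))
    bL : ∀ {b} → b ∈ S ∩ e a₁ ∖ ｛ y ｝ → b ∈ L
    bL p = inL (∈∩ˡ (∈∖ˡ p)) λ { refl → tf (A⊆ a₁A) (∈∩ˡ (∈∖ˡ p)) y∈ (∈∩ʳ (∈∖ˡ p)) xy a₁y }
    b≢y : ∀ {b} → b ∈ S ∩ e a₁ ∖ ｛ y ｝ → y ≢ b
    b≢y p = ∖≢ p
    module _ {b b′ a a′ J J′} (p : b ∈ S ∩ e a₁ ∖ ｛ y ｝) (p′ : b′ ∈ S ∩ e a₁ ∖ ｛ y ｝) (d : b ≢ b′)
             (m : Pair a b M) (m′ : Pair a′ b′ M)
             (J⊆ : J ⊆ S ∖ edge a b) (j : Ind J) (lJ : 7 ≤ # J) (J′⊆ : J′ ⊆ S ∖ edge a′ b′) (j′ : Ind J′) (lJ′ : 7 ≤ # J′) where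

      -- `J` gives no information on the partner of `b`, which is why a second set `J′` is taken.
      -- For `E = A ∩ (J ∪ J′)` all vertices of N(E) have their partners in `E`, so # N(E) ≤ # E,
      -- against the surplus.
      contradiction : ⊥
      contradiction = 1+n≰n (≤-trans (≤-reflexive (+-comm 1 (# E)))
          (≤-trans (surplusA ∈∩ˡ (a₁ , ∈∩ a₁A (∈∪ˡ a₁J)))
          (≤-trans (#-mono (λ q → ∈∩ q (W⊆L q))) (≤-trans (transfer {E = E} M N∉A back) (#-mono ∈∩ˡ)))))
        where
          E = A ∩ (J ∪ J′)
          N∉A : ∀ {z} → z ∈ N S E → z ∉ A
          N∉A q r = let _ , w , w∈ , h = N-elim q in A-ind (∈∩ˡ w∈) r h
          xJ = proj₁ (alternate m J⊆ j lJ)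
          xJ′ = proj₁ (alternate m′ J′⊆ j′ lJ′)
          alt : ∀ {a″ b″} → Pair a″ b″ M → b″ ≢ b → b″ ∉ J → a″ ∈ J
          alt = proj₂ (alternate m J⊆ j lJ)
          alt′ : ∀ {a″ b″} → Pair a″ b″ M → b″ ≢ b′ → b″ ∉ J′ → a″ ∈ J′
          alt′ = proj₂ (alternate m′ J′⊆ j′ lJ′)
          a₁J : a₁ ∈ J
          a₁J = alt m₁ (b≢y p) λ q → j xJ q xy
          a₁J′ : a₁ ∈ J′
          a₁J′ = alt′ m₁ (b≢y p′) λ q → j′ xJ′ q xy
          W⊆L : N S E ⊆ L
          W⊆L q with N-elim q
          ... | z∈ , w , w∈ , h = inL z∈ λ { refl → [ (λ r → j r xJ h) , (λ r → j′ r xJ′ h) ]′ (∈∪⁻ (∈∩ʳ w∈)) }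
          -- A neighbour `z` of `J` is outside `J`, so its partner is in `J` unless z = b. But `b`
          -- is adjacent to `a₁`, which is in `J′`, so `b` is outside `J′` and its partner is in
          -- `J′`. The other case is symmetric.
          back : ∀ {c z} → Pair c z M → z ∈ N S E → c ∈ E
          back {c} {z} pr q with N-elim q
          ... | z∈ , w , w∈ , h = ∈∩ (proj₁ (proj₂ (proj₂ (Pair-L pr)))) ([ in-J , in-J′ ]′ (∈∪⁻ (∈∩ʳ w∈)))
            where
            in-J : w ∈ J → c ∈ J ∪ J′
            in-J r with z ≟ b
            ... | no  s = ∈∪ˡ (alt pr s λ t → j r t h)
            ... | yes refl = ∈∪ʳ (alt′ pr d λ t → j′ a₁J′ t (∈∩ʳ (∈∖ˡ p)))
            in-J′ : w ∈ J′ → c ∈ J ∪ J′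
            in-J′ r with z ≟ b′
            ... | no  s = ∈∪ʳ (alt′ pr s λ t → j′ r t h)
            ... | yes refl = ∈∪ˡ (alt pr (d ∘ sym) λ t → j a₁J t (∈∩ʳ (∈∖ˡ p′)))

    conclude : ⊥
    conclude with two {A = S ∩ e a₁ ∖ ｛ y ｝} others
    ... | b , b′ , p , p′ , d =
      let a , m = partner M (bL p) (bA p) ; a′ , m′ = partner M (bL p′) (bA p′)
          J , j , J⊆ , l = max m ; J′ , j′ , J′⊆ , l′ = max m′
      in contradiction p p′ d m m′ J⊆ j l J′⊆ j′ l′

  module MaxInd {S A : VS n} (tf : TF S) (l : # S ≤ 15) (deg : ∀ {v} → v ∈ S → 3 ≤ # (S ∩ e v)) (nb : ¬ Br 7 1 S)
           (A-ind : Ind A) (A⊆ : A ⊆ S) (sizeA : 7 ≤ # A) where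

    B = S ∖ A
    sizes : # B + # A ≡ # S
    sizes = #-∖⊆ A⊆
    surplusA : ∀ {E} → E ⊆ A → (∃ λ x → x ∈ E) → # E + 1 ≤ # (N S E)
    surplusA s = surplus 0 bound₇ nb (A⊆ ∘ s) (Ind-⊆ s A-ind)
    N⊆B : ∀ {E} → E ⊆ A → N S E ⊆ B
    N⊆B s p = let y∈ , x , x∈ , a = N-elim p in ∈∖ y∈ λ q → A-ind (s x∈) q a
    B≥8 : 8 ≤ # B
    B≥8 = lin (# A ∷ # (N S A) ∷ # B ∷ [])
      ((x₀ ⊕ κ 1 ≲ x₁ by surplusA (λ p → p) (#-inhabited (≤-trans (s≤s z≤n) sizeA))) ∷ (x₁ ≲ x₂ by #-mono (N⊆B (λ p → p))) ∷ (κ 7 ≲ x₀ by sizeA) ∷ []) (κ 8) x₂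
    B≤8 : # B ≤ 8
    B≤8 = lin (# A ∷ # B ∷ # S ∷ []) ((x₁ ⊕ x₀ ≲ x₂ by ≤-reflexive sizes) ∷ (κ 7 ≲ x₀ by sizeA) ∷ (x₂ ≲ κ 15 by l) ∷ []) x₁ (κ 8)

    module Adjacent {x y} (x∈ : x ∈ B) (y∈ : y ∈ B) (xy : y ∈ e x) where
      open Bip A
      L = A ∪ B ∖ ｛ x ｝
      indA : B.Ind A
      indA p q a = [ (λ (_ , r) → r q) , (λ (r , _) → r p) ]′ (proj₂ (e′-elim a))
      indB : B.Ind (S ∖ A ∖ ｛ x ｝)
      indB p q a = [ (λ (r , _) → ∈∖ʳ (∈∖ˡ p) r) , (λ (_ , r) → ∈∖ʳ (∈∖ˡ q) r) ]′ (proj₂ (e′-elim a))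
      L⊆ : L ⊆ S
      L⊆ = ∪⊆ A⊆ (∈∖ˡ ∘ ∈∖ˡ)
      bound : B.Bound 7 (A ∪ S ∖ A ∖ ｛ x ｝)
      bound {J} J⊆ j with some? (A ∩ J)
      ... | inj₂ none = lin (# J ∷ # (B ∖ ｛ x ｝) ∷ # B ∷ [])
            ((x₀ ≲ x₁ by #-mono (λ p → [ (λ q → ⊥-elim (none (∈∩ q p))) , (λ q → q) ]′ (∈∪⁻ (J⊆ p)))) ∷ (κ 1 ⊕ x₁ ≲ x₂ by #-∖∈ x∈) ∷ (x₂ ≲ κ 8 by B≤8) ∷ []) x₀ (κ 7)
      ... | inj₁ t = lin (# J ∷ # (A ∩ J) ∷ # (N S (A ∩ J)) ∷ # B ∷ # (J ∖ A) ∷ [])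
            ((x₀ ≲ x₁ ⊕ x₄ by count (A ∷ J ∷ []) [] ⟨ x₁ ⟩ (⟨ x₀ ∧ᶠ x₁ ⟩ ⊕ ⟨ x₁ ∖ᶠ x₀ ⟩))
            ∷ (x₁ ⊕ κ 1 ≲ x₂ by surplusA ∈∩ˡ t)
            ∷ (x₂ ⊕ x₄ ≲ x₃ by count (N S (A ∩ J) ∷ J ∖ A ∷ B ∷ []) ((x₀ ⊑ x₂ by N⊆B ∈∩ˡ)
                ∷ (x₁ ⊑ x₂ by λ p → ∈∖ (L⊆ (J⊆ (∈∖ˡ p))) (∈∖ʳ p))
                ∷ (x₀ ∧ᶠ x₁ ⊑ ff by λ p → let _ , z , z∈ , a = N-elim (∈∩ˡ p) in ⊥-elim (j (∈∩ʳ z∈) (∈∖ˡ (∈∩ʳ p)) (e′-intro a (∈∩ˡ z∈) (∈∖ʳ (∈∩ʳ p))))) ∷ [])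
                (⟨ x₀ ⟩ ⊕ ⟨ x₁ ⟩) ⟨ x₂ ⟩)
            ∷ (x₃ ≲ κ 8 by B≤8) ∷ []) x₀ (κ 7)
      sizeL : 14 ≤ # L
      sizeL = lin (# L ∷ # A ∷ # (B ∖ ｛ x ｝) ∷ # B ∷ [])
        ((x₁ ⊕ x₂ ≲ x₀ by count (A ∷ S ∷ ｛ x ｝ ∷ []) [] (⟨ x₀ ⟩ ⊕ ⟨ x₁ ∖ᶠ x₀ ∖ᶠ x₂ ⟩) ⟨ x₀ ∨ᶠ x₁ ∖ᶠ x₀ ∖ᶠ x₂ ⟩)
        ∷ (κ 7 ≲ x₁ by sizeA) ∷ (x₃ ≲ κ 1 ⊕ x₂ by #-∖｛｝) ∷ (κ 8 ≲ x₃ by B≥8) ∷ []) (κ 14) x₀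

      inL : ∀ {z} → z ∈ S → z ≢ x → z ∈ L
      inL {z} p q with z ∈? A
      ... | yes r = ∈∪ˡ r
      ... | no  r = ∈∪ʳ (∈∖ (∈∖ p r) (λ t → q (sym (｛｝⁻ t))))
      finish : B.Cov 7 (A ∪ S ∖ A ∖ ｛ x ｝) → ⊥
      finish cov = Chain.conclude tf nb A⊆ A-ind surplusA (∈∖ˡ x∈) (∈∖ˡ y∈) (∈∖ʳ y∈) xy deg inL (match cov sizeL)

      contradiction : ⊥
      contradiction = BS.könig 7 {X = A} {Y = B ∖ ｛ x ｝} indA indB bound finish

    contradiction : ⊥
    contradiction with some? (N B B)
    ... | inj₂ none = 1+n≰n (≤-trans B≥8 (α λ p q a → none (N-intro q p a)))
    ... | inj₁ (y , y∈N) = let y∈ , x , x∈ , xy = N-elim y∈N in Adjacent.contradiction x∈ y∈ xy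

  -- This gains one vertex over `break₁`, which is what remains to be saved in `break₃` once two
  -- edges are deleted.
  fifteen : ∀ {S} → TF S → # S ≤ 15 → (∀ {v} → v ∈ S → 3 ≤ # (S ∩ e v)) → ¬ Br 7 1 S → ⊥
  fifteen tf l deg nb = let A , A-ind , A⊆ , sizeA = maximum (λ h → nb (Br₀ 1 h)) in MaxInd.contradiction tf l deg nb A-ind A⊆ sizeA

  -- A vertex of degree 4 is excluded by `start`. If all degrees are at least 5, deleting two edges
  -- leaves 15 vertices with degrees at least 3.
  break₃ : Breakable 3 19
  break₃ {S} l nb =
    let a , b , a∈ , b∈ , ab = has-edge 2 nb
        c , d , c∈ , d∈ , cd = has-edge 1 (drop {r = 2} nb (Clique-edge ab))
        tf′ = TF-⊆ ∈∖ˡ tf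
    in fifteen (TF-⊆ ∈∖ˡ tf′)
      (lin (# S ∷ # (S ∖ edge a b) ∷ # (S ∖ edge a b ∖ edge c d) ∷ [])
        ((x₀ ≲ κ 19 by l) ∷ (x₁ ⊕ κ 2 ≲ x₀ by size-edge a∈ b∈ ab) ∷ (x₂ ⊕ κ 2 ≲ x₁ by size-edge c∈ d∈ cd) ∷ []) x₂ (κ 15))
      (λ {v} p → lin (# (S ∩ e v) ∷ # ((S ∖ edge a b) ∩ e v) ∷ # ((S ∖ edge a b ∖ edge c d) ∩ e v) ∷ [])
        ((κ 5 ≲ x₀ by deg (∈∖ˡ (∈∖ˡ p))) ∷ (x₀ ≲ x₁ ⊕ κ 1 by deg-edge tf a∈ b∈ ab (∈∖ˡ (∈∖ˡ p)))
        ∷ (x₁ ≲ x₂ ⊕ κ 1 by deg-edge tf′ c∈ d∈ cd (∈∖ˡ p)) ∷ []) (κ 3) x₂)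
      (drop {r = 1} (drop {r = 2} nb (Clique-edge ab)) (Clique-edge cd))
    where
    tf : TF S
    tf = triangle-free break₂ l nb
    deg≥4 : ∀ {v} → v ∈ S → 4 ≤ # (S ∩ e v)
    deg≥4 = degree≥ 2 bound₇ nb
    deg : ∀ {v} → v ∈ S → 5 ≤ # (S ∩ e v)
    deg p = ≰⇒> λ h → start {3} {0} {0} z≤n z≤n (s≤s (s≤s z≤n)) tf l p (≤-antisym h (deg≥4 p)) deg≥4
      (λ s i x _ _ → surplus 2 bound₇ nb s i x) nb

  -- Once v and N(v) \ {u} are deleted, every maximum independent set contains u.
  module Rooted {S : VS n} {v u : Fin n} (tf : TF S) (v∈ : v ∈ S) (u∈ : u ∈ S ∩ e v) where

    U = S ∩ e v ∖ ｛ u ｝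
    X = S ∖ e v ∖ e u

    u∉X : u ∉ X
    u∉X p = ∈∖ʳ (∈∖ˡ p) (∈∩ʳ u∈)

    X⊆S : X ⊆ S
    X⊆S p = ∈∖ˡ (∈∖ˡ p)

    with-u : ∀ {J} → J ⊆ X → Ind J → Ind (J ∪ ｛ u ｝)
    with-u s j = Ind-∪｛｝ j λ p → ∈∖ʳ (s p)

    bound₆ : Bound 6 X
    bound₆ {J} s j = +-cancelʳ-≤ 1 (# J) 6 (≤-trans (#-∪｛｝ (u∉X ∘ s)) (α (with-u s j)))

    sizeX≤ : # X + # (S ∩ e u) + # (S ∩ e v) ≤ # S
    sizeX≤ = count (S ∷ e v ∷ e u ∷ []) ((x₀ ∧ᶠ x₁ ∧ᶠ x₂ ⊑ ff by λ p → ⊥-elim (nbr-ind tf v∈ u∈ (∈∩ˡ p) (∈∩ʳ p))) ∷ [])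
      (⟨ x₀ ∖ᶠ x₁ ∖ᶠ x₂ ⟩ ⊕ ⟨ x₀ ∧ᶠ x₂ ⟩ ⊕ ⟨ x₀ ∧ᶠ x₁ ⟩) ⟨ x₀ ⟩

    sizeU : suc (# U) ≤ # (S ∩ e v)
    sizeU = #-∖∈ u∈

    -- `P` collects the vertices deleted along with the star. A surviving set without its vertex `u`
    -- is an independent 6-set of `X ∖ P`.
    rooted : ∀ {r P} → Cov r (U ∪ ｛ v ｝ ∪ P) → NoInd 6 (X ∖ P) → Br 7 r S
    rooted {r} {P} c none = Cov-Br₀ c λ {J} s j large → none
      (λ p → let q = s (∈∖ˡ p) in ∈∖ (∈∖ (∈∖ (∈∖ˡ q) (λ a → ∈∖ʳ q (∈∪ˡ (∈∪ˡ (∈∖ (∈∩ (∈∖ˡ q) a) (∈∖ʳ p)))))) (j (u∈J s j large) (∈∖ˡ p))) (∈∖ʳ q ∘ ∈∪ʳ))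
      (Ind-⊆ ∈∖ˡ j) (≤-pred (≤-trans large #-∖｛｝))
      where
      u∈J : ∀ {J} → J ⊆ S ∖ (U ∪ ｛ v ｝ ∪ P) → Ind J → 7 ≤ # J → u ∈ J
      u∈J {J} s j large with u ∈? J
      ... | yes q = q
      ... | no  q = ⊥-elim (dominated j (λ r → ∈∖ʳ (s r) (∈∪ˡ (∈∪ʳ ∈｛｝)))
            (λ r a → ∈∖ʳ (s r) (∈∪ˡ (∈∪ˡ (∈∖ (∈∩ (∈∖ˡ (s r)) a) λ t → q (subst (_∈ J) (sym (｛｝⁻ t)) r))))) large)

  cov-base : ∀ {W v} k → W ⊆ e v → # W ≤ suc k → Cov (suc k) (W ∪ ｛ v ｝ ∪ ∅)
  cov-base {W} k s h with some? W
  ... | inj₁ x    = Cov-⊆ (λ p → [ (λ q → q) , (λ q → ⊥-elim (∉∅ q)) ]′ (∈∪⁻ p)) (Cov-star (suc k) s x h)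
  ... | inj₂ none = Clique-｛｝ ∷ Cov-∅ k λ p → [ (λ q → [ none , ∈∖ʳ p ]′ (∈∪⁻ q)) , ∉∅ ]′ (∈∪⁻ (∈∖ˡ p))

  -- The leaf `b` costs a clique anyway; taking the edge to `f` as this clique removes `f` for
  -- nothing.
  cov-kill : ∀ {j W v P b f} → b ∈ e f → Cov j (W ∖ ｛ b ｝ ∪ ｛ v ｝ ∪ P) → Cov (suc j) (W ∪ ｛ v ｝ ∪ (P ∪ ｛ f ｝))
  cov-kill {W = W} {v} {P} {b} {f} h c = Clique-edge h ∷ Cov-⊆ (λ p → go (∈∖ʳ p) (∈∪⁻ (∈∖ˡ p))) c
    where
    go : ∀ {x} → x ∉ edge f b → x ∈ W ∪ ｛ v ｝ ⊎ x ∈ P ∪ ｛ f ｝ → x ∈ W ∖ ｛ b ｝ ∪ ｛ v ｝ ∪ P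
    go q (inj₁ p) = [ (λ r → ∈∪ˡ (∈∪ˡ (∈∖ r (q ∘ ∈∪ʳ)))) , ∈∪ˡ ∘ ∈∪ʳ ]′ (∈∪⁻ p)
    go q (inj₂ p) = [ ∈∪ʳ , (λ r → ⊥-elim (q (∈∪ˡ r))) ]′ (∈∪⁻ p)

  -- Delete v, y and N(v) ∪ N(y) except for N(u) ∪ {u}. If u is in a surviving independent set J, then y can be added to J, otherwise v.
  pair-break : ∀ {r S v y u} → TF S → v ∈ S → y ∈ S → 2 ≤ # (S ∩ e v ∩ e y) → u ∈ S ∩ e v → u ∉ e y →
               Bound (suc (suc r)) ((S ∩ e v ∪ S ∩ e y) ∖ (e u ∪ ｛ u ｝)) → ¬ ¬ Br 7 (suc (suc r)) S
  pair-break {r} {S} {v} {y} {u} tf v∈ y∈ common u∈ u∉ bound nb with two common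
  ... | w , w′ , w∈ , w′∈ , d = könig r (Ind-⊆ ∈∖ˡ (nbr-ind tf v∈)) (Ind-⊆ ∈∖ˡ (nbr-ind tf y∈)) bound′ λ c →
        nb (edge v w , Clique-edge (∈∩ʳ (∈∩ˡ w∈)) , edge y w′ , Clique-edge (∈∩ʳ w′∈) , Cov-Br₀ c rest)
    where
    Z = e u ∪ ｛ u ｝ ∪ ｛ w ｝ ∪ ｛ w′ ｝
    L = (S ∩ e v) ∖ Z ∪ (S ∩ e y) ∖ Z
    far : ∀ {w} → w ∈ S ∩ e v ∩ e y → ∀ {x} → x ∈ L → x ∉ e w
    far w∈ p = [ (λ q → nbr-ind tf v∈ (∈∩ˡ w∈) (∈∖ˡ q)) , (λ q → nbr-ind tf y∈ (∈∩ (∈∩ˡ (∈∩ˡ w∈)) (∈∩ʳ w∈)) (∈∖ˡ q)) ]′ (∈∪⁻ p)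
    in-Z : ∀ {w} → w ∈ S ∩ e v ∩ e y → w ∉ e u ∪ ｛ u ｝
    in-Z w∈ p = [ nbr-ind tf v∈ u∈ (∈∩ˡ w∈) , (λ q → u∉ (subst (_∈ e y) (sym (｛｝⁻ q)) (∈∩ʳ w∈))) ]′ (∈∪⁻ p)
    notZ : ∀ {x} → x ∈ L → x ∉ Z
    notZ p = [ ∈∖ʳ , ∈∖ʳ ]′ (∈∪⁻ p)
    bound′ : Bound r L
    -- The common neighbours `w` and `w′` can both be added to `J`. This lowers König's bound by 2
    -- and so pays for the two edges.
    bound′ {J} s j = lin (# J ∷ # (J ∪ ｛ w ｝) ∷ # (J ∪ ｛ w ｝ ∪ ｛ w′ ｝) ∷ r ∷ [])
      ((x₀ ⊕ κ 1 ≲ x₁ by #-∪｛｝ λ p → notZ (s p) (∈∪ˡ (∈∪ʳ ∈｛｝)))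
      ∷ (x₁ ⊕ κ 1 ≲ x₂ by #-∪｛｝ λ p → [ (λ q → notZ (s q) (∈∪ʳ ∈｛｝)) , d ∘ ｛｝⁻ ]′ (∈∪⁻ p))
      ∷ (x₂ ≲ κ 2 ⊕ x₃ by bound (∪⊆ (∪⊆ (λ p → ∈∖ ([ ∈∪ˡ ∘ ∈∖ˡ , ∈∪ʳ ∘ ∈∖ˡ ]′ (∈∪⁻ (s p))) (notZ (s p) ∘ ∈∪ˡ ∘ ∈∪ˡ)) (｛｝⊆ (∈∖ (∈∪ˡ (∈∩ˡ w∈)) (in-Z w∈)))) (｛｝⊆ (∈∖ (∈∪ˡ (∈∩ˡ w′∈)) (in-Z w′∈))))
          (Ind-∪｛｝ (Ind-∪｛｝ j λ p → far w∈ (s p)) λ p → [ (λ q → far w′∈ (s q)) , (λ q a → nbr-ind tf v∈ (∈∩ˡ w′∈) (subst (_∈ S ∩ e v) (｛｝⁻ q) (∈∩ˡ w∈)) a) ]′ (∈∪⁻ p))) ∷ []) x₀ x₃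
    rest : NoInd 7 (S ∖ edge v w ∖ edge y w′ ∖ L)
    rest {J} s j large with u ∈? J
    ... | yes p = dominated j (λ q → ∈∖ʳ (∈∖ˡ (s q)) (∈∪ˡ ∈｛｝)) (λ q a → ∈∖ʳ (s q) (∈∪ʳ (∈∖ (∈∩ (inS q) a) λ t →
          [ [ [ j p q , (λ t → u∉ (subst (_∈ e y) (sym (｛｝⁻ t)) a)) ]′ ∘ ∈∪⁻ , (λ t → ∈∖ʳ (∈∖ˡ (∈∖ˡ (s q))) (∈∪ʳ t)) ]′ ∘ ∈∪⁻ , (λ t → ∈∖ʳ (∈∖ˡ (s q)) (∈∪ʳ t)) ]′ (∈∪⁻ t)))) large
      where
      inS : J ⊆ S
      inS q = ∈∖ˡ (∈∖ˡ (∈∖ˡ (s q)))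
    ... | no  p = dominated j (λ q → ∈∖ʳ (∈∖ˡ (∈∖ˡ (s q))) (∈∪ˡ ∈｛｝)) (λ q a → ∈∖ʳ (s q) (∈∪ˡ (∈∖ (∈∩ (inS q) a) λ t →
          [ [ [ nbr-ind tf v∈ u∈ (∈∩ (inS q) a) , (λ t → p (subst (_∈ J) (sym (｛｝⁻ t)) q)) ]′ ∘ ∈∪⁻ , (λ t → ∈∖ʳ (∈∖ˡ (∈∖ˡ (s q))) (∈∪ʳ t)) ]′ ∘ ∈∪⁻ , (λ t → ∈∖ʳ (∈∖ˡ (s q)) (∈∪ʳ t)) ]′ (∈∪⁻ t)))) large
      where
      inS : J ⊆ S
      inS q = ∈∖ˡ (∈∖ˡ (∈∖ˡ (s q)))

  Ind-pair : ∀ {x y} → y ∉ e x → Ind (｛ x ｝ ∪ ｛ y ｝)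
  Ind-pair h = Ind-∪｛｝ Ind-｛｝ λ p a → h (e⇄ (subst (_∈ e _) (sym (｛｝⁻ p)) a))

  N-pair : ∀ {S a b} → N S (｛ a ｝ ∪ ｛ b ｝) ⊆ S ∩ e a ∪ S ∩ e b
  N-pair p with N-elim p
  ... | y∈ , z , z∈ , h = [ (λ q → ∈∪ˡ (∈∩ y∈ (subst (λ t → _ ∈ e t) (sym (｛｝⁻ q)) h))) , (λ q → ∈∪ʳ (∈∩ y∈ (subst (λ t → _ ∈ e t) (sym (｛｝⁻ q)) h))) ]′ (∈∪⁻ z∈)

  size-pair : ∀ {a b : Fin n} → a ≢ b → # (｛ a ｝ ∪ ｛ b ｝) ≡ 2
  size-pair {a} {b} d = ≤-antisym
    (lin (# (｛ a ｝ ∪ ｛ b ｝) ∷ # ｛ a ｝ ∷ # ｛ b ｝ ∷ []) ((x₀ ≲ x₁ ⊕ x₂ by count (｛ a ｝ ∷ ｛ b ｝ ∷ []) [] ⟨ x₀ ∨ᶠ x₁ ⟩ (⟨ x₀ ⟩ ⊕ ⟨ x₁ ⟩)) ∷ (x₁ ≲ κ 1 by ≤-reflexive (#｛｝ a)) ∷ (x₂ ≲ κ 1 by ≤-reflexive (#｛｝ b)) ∷ []) x₀ (κ 2))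
    (≤-trans (≤-reflexive (cong (_+ 1) (sym (#｛｝ a)))) (#-∪｛｝ (d ∘ ｛｝⁻)))

  -- There is no 4-cycle through `v`, so the neighbours of `v` have disjoint sets of at least d
  -- further neighbours.
  expansion : ∀ {S v d} → TF S → v ∈ S → (∀ {u} → u ∈ S → suc d ≤ # (S ∩ e u)) →
              (∀ {y} → y ∈ S → y ∉ e v → v ≢ y → # (S ∩ e v ∩ e y) ≤ 1) → d * # (S ∩ e v) + # (S ∩ e v) + 1 ≤ # S
  expansion {S} {v} {d} tf v∈ deg few = lin (d * # (S ∩ e v) ∷ # (S ∩ e v) ∷ # (S ∖ e v ∖ ｛ v ｝) ∷ # ｛ v ｝ ∷ # S ∷ [])
    ((x₀ ≲ x₂ ⊕ κ 0 by double-count (S ∩ e v) (S ∖ e v ∖ ｛ v ｝) low λ p → few (∈∖ˡ (∈∖ˡ p)) (∈∖ʳ (∈∖ˡ p)) (∖≢ p))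
    ∷ (κ 1 ≲ x₃ by ≤-reflexive (sym (#｛｝ v)))
    ∷ (x₁ ⊕ x₂ ⊕ x₃ ≲ x₄ by count (S ∷ e v ∷ ｛ v ｝ ∷ []) ((x₂ ⊑ x₀ by ｛｝⊆ v∈) ∷ (x₂ ∧ᶠ x₁ ⊑ ff by λ q → ⊥-elim (e≢ (∈∩ʳ q) (｛｝⁻ (∈∩ˡ q)))) ∷ [])
        (⟨ x₀ ∧ᶠ x₁ ⟩ ⊕ ⟨ x₀ ∖ᶠ x₁ ∖ᶠ x₂ ⟩ ⊕ ⟨ x₂ ⟩) ⟨ x₀ ⟩) ∷ []) (x₀ ⊕ x₁ ⊕ κ 1) x₄
    where
    low : ∀ {u} → u ∈ S ∩ e v → d ≤ # (S ∖ e v ∖ ｛ v ｝ ∩ e u)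
    low {u} p = lin (# (S ∩ e u) ∷ # (S ∖ e v ∖ ｛ v ｝ ∩ e u) ∷ # ｛ v ｝ ∷ d ∷ [])
      ((κ 1 ⊕ x₃ ≲ x₀ by deg (∈∩ˡ p))
      ∷ (x₀ ≲ x₁ ⊕ x₂ by count (S ∷ e v ∷ ｛ v ｝ ∷ e u ∷ []) ((x₀ ∧ᶠ x₁ ∧ᶠ x₃ ⊑ ff by λ q → ⊥-elim (nbr-ind tf v∈ p (∈∩ˡ q) (∈∩ʳ q))) ∷ [])
          ⟨ x₀ ∧ᶠ x₃ ⟩ (⟨ x₀ ∖ᶠ x₁ ∖ᶠ x₂ ∧ᶠ x₃ ⟩ ⊕ ⟨ x₂ ⟩))
      ∷ (x₂ ≲ κ 1 by ≤-reflexive (#｛｝ v)) ∷ []) x₃ x₁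

  -- Four cliques: equality in the surplus inequality

  module Tight₄ {S : VS n} (tf : TF S) (l : # S ≤ 22) (nb : ¬ Br 7 4 S) where

    -- Equality in `surplus` for r = 4. It has to be excluded because `start` with τ = 1 asks for a
    -- surplus of 5.
    record Tight (m : ℕ) : Set where
      constructor tight
      field
        {E}   : VS n
        E⊆    : E ⊆ S
        E-ind : Ind E
        few   : # (N S E) ≤ # E + 4
        large : m ≤ # E

    surplus₄ : ∀ {E} → E ⊆ S → Ind E → (∃ λ x → x ∈ E) → # E + 4 ≤ # (N S E)
    surplus₄ = surplus 3 bound₇ nb

    -- Four cliques delete `M ∖ K` and `E`. A surviving set has at most 7 - # E vertices outside
    -- `M`, so it contains all of `K`, and the rest of it is a maximum independent set of `X`. If
    -- the same four cliques cannot destroy these as well, their core and `K` form a larger tight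
    -- set.
    module Grow {E K : VS n} (E⊆ : E ⊆ S) (E-ind : Ind E) (E≢∅ : ∃ λ x → x ∈ E) (few : # (N S E) ≤ # E + 4)
                (K⊆ : K ⊆ N S E) (sizeK : # K ≡ # E) (manyK : # K + 5 ≤ # (N S K)) where

      M = N S E
      X = S ∖ M ∖ N S K ∖ E
      q = 7 ∸ # E

      M-ind : Ind M
      M-ind {a} {b} p r ab = absurd (# E ∷ # M ∷ [])
        ((x₀ ⊕ κ 5 ≲ x₁ by surplus-edge 2 bound₇ nb E⊆ E-ind E≢∅ p r ab) ∷ (x₁ ≲ x₀ ⊕ κ 4 by few) ∷ [])
      manyM : # E + 4 ≤ # M
      manyM = surplus₄ E⊆ E-ind E≢∅
      E≤3 : # E ≤ 3
      E≤3 = lin (# E ∷ # M ∷ []) ((x₀ ⊕ κ 4 ≲ x₁ by manyM) ∷ (x₁ ≲ κ 7 by α M-ind) ∷ []) x₀ (κ 3)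
      q+E : q + # E ≡ 7
      q+E = m∸n+n≡m (≤-trans E≤3 (s≤s (s≤s (s≤s z≤n))))
      K⊆S : K ⊆ S
      K⊆S p = N⊆ (K⊆ p)
      X⊆S : X ⊆ S
      X⊆S p = ∈∖ˡ (∈∖ˡ (∈∖ˡ p))
      outside-E : ∀ {y z} → y ∈ S → y ∉ M → z ∈ E → y ∉ e z
      outside-E p q r s = q (N-intro p r s)
      sizeX : # X + # M + # (N S K) ≤ # S
      sizeX = count (X ∷ M ∷ N S K ∷ S ∷ []) ((x₀ ⊑ x₃ by X⊆S) ∷ (x₁ ⊑ x₃ by N⊆) ∷ (x₂ ⊑ x₃ by N⊆)
        ∷ (x₀ ∧ᶠ x₁ ⊑ ff by λ p → ⊥-elim (∈∖ʳ (∈∖ˡ (∈∖ˡ (∈∩ˡ p))) (∈∩ʳ p)))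
        ∷ (x₀ ∧ᶠ x₂ ⊑ ff by λ p → ⊥-elim (∈∖ʳ (∈∖ˡ (∈∩ˡ p)) (∈∩ʳ p)))
        ∷ (x₁ ∧ᶠ x₂ ⊑ ff by λ p → let _ , z , z∈ , a = N-elim (∈∩ʳ p) in ⊥-elim (M-ind (K⊆ z∈) (∈∩ˡ p) a)) ∷ [])
        (⟨ x₀ ⟩ ⊕ ⟨ x₁ ⟩ ⊕ ⟨ x₂ ⟩) ⟨ x₃ ⟩
      beside-E : ∀ {J} → Ind J → J ⊆ S ∖ M → (∀ {x} → x ∈ J → x ∉ E) → # J ≤ q
      beside-E {J} j s d = lin (# J ∷ # E ∷ # (J ∪ E) ∷ q ∷ [])
        ((x₀ ⊕ x₁ ≲ x₂ by count (J ∷ E ∷ []) ((x₀ ∧ᶠ x₁ ⊑ ff by λ p → ⊥-elim (d (∈∩ˡ p) (∈∩ʳ p))) ∷ []) (⟨ x₀ ⟩ ⊕ ⟨ x₁ ⟩) ⟨ x₀ ∨ᶠ x₁ ⟩)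
        ∷ (x₂ ≲ κ 7 by α (Ind-∪ j E-ind λ p r a → outside-E (∈∖ˡ (s p)) (∈∖ʳ (s p)) r (e⇄ a)))
        ∷ (κ 7 ≲ x₃ ⊕ x₁ by ≤-reflexive (sym q+E)) ∷ []) x₀ x₃
      bound-X : Bound q X
      bound-X s j = beside-E j (λ p → ∈∖ˡ (∈∖ˡ (s p))) (λ p → ∈∖ʳ (s p))

      -- `P` is empty or one core vertex; its neighbour in `M ∖ K` keeps König's bound at 4.
      module _ {P : VS n} (P⊆ : P ⊆ X) (P-ind : Ind P) (P≤1 : # P ≤ 1) (P~ : ∀ {f} → f ∈ P → ∃ λ m → m ∈ M ∖ K × m ∈ e f) where

        L = M ∖ K ∪ (E ∪ P)

        bound-L : Bound 4 L
        bound-L {J} J⊆ j with some? (J ∩ E) | some? (J ∩ P)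
        ... | inj₁ t | _ = lin (# J ∷ # (J ∩ E) ∷ # (J ∩ M) ∷ # (J ∩ P) ∷ # (N S (J ∩ E)) ∷ # M ∷ # E ∷ # P ∷ [])
              ((x₀ ≲ x₁ ⊕ x₂ ⊕ x₃ by parts)
              ∷ (x₁ ⊕ κ 4 ≲ x₄ by surplus₄ (λ p → E⊆ (∈∩ʳ p)) (Ind-⊆ ∈∩ʳ E-ind) t)
              ∷ (x₂ ⊕ x₄ ≲ x₅ by count (J ∷ M ∷ N S (J ∩ E) ∷ []) ((x₂ ⊑ x₁ by N-mono ∈∩ʳ)
                  ∷ (x₂ ∧ᶠ x₀ ⊑ ff by λ p → let _ , z , z∈ , a = N-elim (∈∩ˡ p) in ⊥-elim (j (∈∩ˡ z∈) (∈∩ʳ p) a)) ∷ [])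
                  (⟨ x₀ ∧ᶠ x₁ ⟩ ⊕ ⟨ x₂ ⟩) ⟨ x₁ ⟩)
              ∷ (x₅ ≲ x₆ ⊕ κ 4 by few) ∷ (x₆ ≲ κ 3 by E≤3) ∷ (x₃ ≲ x₇ by #-mono ∈∩ʳ) ∷ (x₇ ≲ κ 1 by P≤1) ∷ []) x₀ (κ 4)
          where
          parts : # J ≤ # (J ∩ E) + # (J ∩ M) + # (J ∩ P)
          parts = count (J ∷ E ∷ M ∷ P ∷ K ∷ []) ((x₀ ⊑ x₂ ∖ᶠ x₄ ∨ᶠ (x₁ ∨ᶠ x₃) by J⊆) ∷ []) ⟨ x₀ ⟩ (⟨ x₀ ∧ᶠ x₁ ⟩ ⊕ ⟨ x₀ ∧ᶠ x₂ ⟩ ⊕ ⟨ x₀ ∧ᶠ x₃ ⟩)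
        ... | inj₂ noE | inj₂ noP = lin (# J ∷ # (M ∖ K) ∷ # M ∷ # K ∷ # E ∷ [])
              ((x₀ ≲ x₁ by count (J ∷ E ∷ M ∷ P ∷ K ∷ []) ((x₀ ⊑ x₂ ∖ᶠ x₄ ∨ᶠ (x₁ ∨ᶠ x₃) by J⊆) ∷ (x₀ ∧ᶠ x₁ ⊑ ff by ⊥-elim ∘ noE) ∷ (x₀ ∧ᶠ x₃ ⊑ ff by ⊥-elim ∘ noP) ∷ [])
                  ⟨ x₀ ⟩ ⟨ x₂ ∖ᶠ x₄ ⟩)
              ∷ (x₁ ⊕ x₃ ≲ x₂ by ≤-reflexive (#-∖⊆ K⊆)) ∷ (x₂ ≲ x₄ ⊕ κ 4 by few) ∷ (x₄ ≲ x₃ by ≤-reflexive (sym sizeK)) ∷ []) x₀ (κ 4)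
        ... | inj₂ noE | inj₁ (f , f∈) with P~ (∈∩ʳ f∈)
        ...   | m , m∈ , mf = lin (# J ∷ # (M ∖ K) ∷ # M ∷ # K ∷ # E ∷ # (M ∖ K ∖ ｛ m ｝) ∷ # P ∷ [])
              ((x₀ ≲ x₅ ⊕ x₆ by count (J ∷ E ∷ M ∷ P ∷ K ∷ ｛ m ｝ ∷ []) ((x₀ ⊑ x₂ ∖ᶠ x₄ ∨ᶠ (x₁ ∨ᶠ x₃) by J⊆) ∷ (x₀ ∧ᶠ x₁ ⊑ ff by ⊥-elim ∘ noE)
                  ∷ (x₀ ∧ᶠ x₅ ⊑ ff by λ p → ⊥-elim (j (∈∩ˡ f∈) (subst (_∈ J) (sym (｛｝⁻ (∈∩ʳ p))) (∈∩ˡ p)) mf)) ∷ [])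
                  ⟨ x₀ ⟩ (⟨ x₂ ∖ᶠ x₄ ∖ᶠ x₅ ⟩ ⊕ ⟨ x₃ ⟩))
              ∷ (x₆ ≲ κ 1 by P≤1) ∷ (κ 1 ⊕ x₅ ≲ x₁ by #-∖∈ m∈)
              ∷ (x₁ ⊕ x₃ ≲ x₂ by ≤-reflexive (#-∖⊆ K⊆)) ∷ (x₂ ≲ x₄ ⊕ κ 4 by few) ∷ (x₄ ≲ x₃ by ≤-reflexive (sym sizeK)) ∷ []) x₀ (κ 4)

        module _ {J : VS n} (J⊆ : J ⊆ S ∖ L) (j : Ind J) (large : 7 ≤ # J) where

          out : # (J ∖ M) ≤ q
          out = beside-E (Ind-⊆ ∈∖ˡ j) (λ p → ∈∖ (∈∖ˡ (J⊆ (∈∖ˡ p))) (∈∖ʳ p)) (λ p r → ∈∖ʳ (J⊆ (∈∖ˡ p)) (∈∪ʳ (∈∪ˡ r)))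
          in-K : J ∩ M ⊆ K
          in-K {x} p with x ∈? K
          ... | yes r = r
          ... | no  r = ⊥-elim (∈∖ʳ (J⊆ (∈∩ˡ p)) (∈∪ˡ (∈∖ (∈∩ʳ p) r)))
          split : # J ≤ # (J ∩ M) + # (J ∖ M)
          split = count (J ∷ M ∷ []) [] ⟨ x₀ ⟩ (⟨ x₀ ∧ᶠ x₁ ⟩ ⊕ ⟨ x₀ ∖ᶠ x₁ ⟩)
          K⊆J : K ⊆ J
          K⊆J {x} p with x ∈? J
          ... | yes r = r
          ... | no  r = ⊥-elim (absurd (# J ∷ # (J ∩ M) ∷ # (J ∖ M) ∷ # K ∷ # (K ∖ ｛ x ｝) ∷ q ∷ # E ∷ [])
                ((κ 7 ≲ x₀ by large) ∷ (x₀ ≲ x₁ ⊕ x₂ by split) ∷ (x₂ ≲ x₅ by out)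
                ∷ (x₁ ≲ x₄ by #-mono (λ t → ∈∖ (in-K t) λ u → r (subst (_∈ J) (sym (｛｝⁻ u)) (∈∩ˡ t))))
                ∷ (κ 1 ⊕ x₄ ≲ x₃ by #-∖∈ p) ∷ (x₃ ≲ x₆ by ≤-reflexive sizeK) ∷ (x₅ ⊕ x₆ ≲ κ 7 by ≤-reflexive q+E) ∷ []))
          trapped : J ∖ M ⊆ X
          trapped p = ∈∖ (∈∖ (∈∖ (∈∖ˡ (J⊆ (∈∖ˡ p))) (∈∖ʳ p)) (λ r → let _ , z , z∈ , a = N-elim r in j (K⊆J z∈) (∈∖ˡ p) a))
            (λ r → ∈∖ʳ (J⊆ (∈∖ˡ p)) (∈∪ʳ (∈∪ˡ r)))
          full-size : q ≤ # (J ∖ M)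
          full-size = lin (# J ∷ # (J ∩ M) ∷ # (J ∖ M) ∷ # K ∷ q ∷ # E ∷ [])
            ((κ 7 ≲ x₀ by large) ∷ (x₀ ≲ x₁ ⊕ x₂ by split) ∷ (x₁ ≲ x₃ by #-mono in-K)
            ∷ (x₃ ≲ x₅ by ≤-reflexive sizeK) ∷ (x₄ ⊕ x₅ ≲ κ 7 by ≤-reflexive q+E) ∷ []) x₄ x₂

        break : NoInd q (X ∖ P) → ⊥
        break none = könig 4 (Ind-⊆ ∈∖ˡ M-ind) (Ind-∪ E-ind P-ind λ p r → outside-E (X⊆S (P⊆ r)) (∈∖ʳ (∈∖ˡ (∈∖ˡ (P⊆ r)))) p) bound-L
          λ c → nb (Cov-Br₀ {4} c λ J⊆ j large →
            none (λ p → ∈∖ (trapped J⊆ j large p) λ r → ∈∖ʳ (J⊆ (∈∖ˡ p)) (∈∪ʳ (∈∪ʳ r))) (Ind-⊆ ∈∖ˡ j) (full-size J⊆ j large))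

      module _ (c : Core q X) where
        open Core c

        -- The 5 in `manyK`, one more than in a tight set, is what makes the core nonempty.
        core≥1 : 1 ≤ # core
        core≥1 = lin (# core ∷ # (N X core) ∷ # X ∷ # M ∷ # (N S K) ∷ # S ∷ # E ∷ # K ∷ q ∷ [])
          ((x₈ ⊕ x₈ ⊕ x₁ ≲ x₀ ⊕ x₂ by core-N c) ∷ (x₂ ⊕ x₃ ⊕ x₄ ≲ x₅ by sizeX) ∷ (x₅ ≲ κ 22 by l)
          ∷ (x₆ ⊕ κ 4 ≲ x₃ by manyM) ∷ (x₇ ⊕ κ 5 ≲ x₄ by manyK) ∷ (x₆ ≲ x₇ by ≤-reflexive (sym sizeK))
          ∷ (κ 7 ≲ x₈ ⊕ x₆ by ≤-reflexive (sym q+E)) ∷ (κ 7 ≲ x₈ ⊕ x₆ by ≤-reflexive (sym q+E)) ∷ []) (κ 1) x₀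

        grown : (∀ {m} → m ∉ N (M ∖ K) core) → Tight (suc (# E))
        grown none = tight (∪⊆ (λ p → X⊆S (core-X c p)) K⊆S)
          (Ind-∪ (core-ind c) (Ind-⊆ K⊆ M-ind) λ p r a → ∈∖ʳ (∈∖ˡ (core-X c p)) (N-intro (X⊆S (core-X c p)) r (e⇄ a)))
          (lin (# core ∷ # (N X core) ∷ # X ∷ # M ∷ # (N S K) ∷ # S ∷ # E ∷ # K ∷ q ∷ # (N S (core ∪ K)) ∷ # (core ∪ K) ∷ [])
            ((x₈ ⊕ x₈ ⊕ x₁ ≲ x₀ ⊕ x₂ by core-N c) ∷ (x₂ ⊕ x₃ ⊕ x₄ ≲ x₅ by sizeX) ∷ (x₅ ≲ κ 22 by l)
            ∷ (x₆ ⊕ κ 4 ≲ x₃ by manyM) ∷ (x₆ ≲ x₇ by ≤-reflexive (sym sizeK))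
            ∷ (κ 7 ≲ x₈ ⊕ x₆ by ≤-reflexive (sym q+E)) ∷ (κ 7 ≲ x₈ ⊕ x₆ by ≤-reflexive (sym q+E))
            ∷ (x₉ ≲ x₄ ⊕ x₁ by count (N S (core ∪ K) ∷ N S K ∷ N X core ∷ []) ((x₀ ⊑ x₁ ∨ᶠ x₂ by where-N) ∷ []) ⟨ x₀ ⟩ (⟨ x₁ ⟩ ⊕ ⟨ x₂ ⟩))
            ∷ (x₀ ⊕ x₇ ≲ x₁₀ by sum) ∷ []) x₉ (x₁₀ ⊕ κ 4))
          (lin (# core ∷ # K ∷ # E ∷ # (core ∪ K) ∷ []) ((κ 1 ≲ x₀ by core≥1) ∷ (x₀ ⊕ x₁ ≲ x₃ by sum) ∷ (x₂ ≲ x₁ by ≤-reflexive (sym sizeK)) ∷ []) (κ 1 ⊕ x₂) x₃)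
          where
          sum : # core + # K ≤ # (core ∪ K)
          sum = count (core ∷ K ∷ []) ((x₀ ∧ᶠ x₁ ⊑ ff by λ p → ⊥-elim (∈∖ʳ (∈∖ˡ (∈∖ˡ (core-X c (∈∩ˡ p)))) (K⊆ (∈∩ʳ p)))) ∷ []) (⟨ x₀ ⟩ ⊕ ⟨ x₁ ⟩) ⟨ x₀ ∨ᶠ x₁ ⟩
          where-N : N S (core ∪ K) ⊆ N S K ∪ N X core
          where-N {y} p with N-elim p
          ... | y∈ , x , x∈ , a with ∈∪⁻ x∈
          ...   | inj₂ r = ∈∪ˡ (N-intro y∈ r a)
          ...   | inj₁ r with y ∈? N S K | y ∈? M | y ∈? K
          ...     | yes s | _     | _     = ∈∪ˡ s
          ...     | no _  | yes _ | yes t = ⊥-elim (∈∖ʳ (∈∖ˡ (core-X c r)) (N-intro (X⊆S (core-X c r)) t (e⇄ a)))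
          ...     | no _  | yes s | no t  = ⊥-elim (none (N-intro (∈∖ s t) r a))
          ...     | no s  | no t  | _     = ∈∪ʳ (N-intro (∈∖ (∈∖ (∈∖ y∈ t) s) λ u → outside-E (X⊆S (core-X c r)) (∈∖ʳ (∈∖ˡ (∈∖ˡ (core-X c r)))) u (e⇄ a)) r a)

      grow : Tight (suc (# E))
      grow with core? bound-X
      ... | inj₂ none = ⊥-elim (break {P = ∅} (λ p → ⊥-elim (∉∅ p)) (λ p → ⊥-elim (∉∅ p)) (≤-trans (≤-reflexive (#∅ ∉∅)) z≤n) (λ p → ⊥-elim (∉∅ p))
                          (λ s j h → none (λ p → ∈∖ˡ (s p)) j h))
      ... | inj₁ c with some? (N (M ∖ K) (Core.core c))
      ...   | inj₂ none = grown c none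
      ...   | inj₁ (m , p) with N-elim p
      ...     | m∈ , f , f∈ , a = ⊥-elim (break {P = ｛ f ｝} (｛｝⊆ (core-X c f∈)) Ind-｛｝ (≤-reflexive (#｛｝ f)) (λ r → m , m∈ , subst (λ t → m ∈ e t) (｛｝⁻ r) a)
                (λ s j h → ∈∖ʳ (s (Core.core⊆ c j (λ p → ∈∖ˡ (s p)) h f∈)) ∈｛｝))

    N-union : ∀ {A B} → N S (A ∪ B) ⊆ N S A ∪ N S B
    N-union p with N-elim p
    ... | y∈ , x , x∈ , a = [ (λ r → ∈∪ˡ (N-intro y∈ r a)) , (λ r → ∈∪ʳ (N-intro y∈ r a)) ]′ (∈∪⁻ x∈)

    -- Of the sets K₀ ∪ {m} with # K₀ + 1 = # E, at least one is not tight, or two of them have a tight union.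
    bigger₂ : ∀ {E} → E ⊆ S → Ind E → # (N S E) ≤ # E + 4 → 2 ≤ # E → Tight (suc (# E))
    bigger₂ {E} E⊆ E-ind few E≥2 = choose (shrink (# E ∸ 1) {N S E} (≤-trans (m∸n≤m (# E) 1) (≤-trans (m≤m+n (# E) 4) manyM)))
      where
      E≢∅ : ∃ λ x → x ∈ E
      E≢∅ = #-inhabited (≤-trans (s≤s z≤n) E≥2)
      M = N S E
      manyM : # E + 4 ≤ # M
      manyM = surplus₄ E⊆ E-ind E≢∅
      M-ind : Ind M
      M-ind {a} {b} p r ab = absurd (# E ∷ # M ∷ [])
        ((x₀ ⊕ κ 5 ≲ x₁ by surplus-edge 2 bound₇ nb E⊆ E-ind E≢∅ p r ab) ∷ (x₁ ≲ x₀ ⊕ κ 4 by few) ∷ [])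
      choose : (Σ (VS n) λ K → K ⊆ M × # K ≡ # E ∸ 1) → Tight (suc (# E))
      choose (K₀ , K₀⊆ , size₀) with two {A = M ∖ K₀} (lin (# (M ∖ K₀) ∷ # K₀ ∷ # M ∷ # E ∷ [])
            ((x₂ ≲ x₀ ⊕ x₁ by ≤-reflexive (sym (#-∖⊆ K₀⊆))) ∷ (x₃ ⊕ κ 4 ≲ x₂ by manyM) ∷ (x₁ ⊕ κ 1 ≲ x₃ by ≤-reflexive pred-size) ∷ []) (κ 2) x₀)
        where
        pred-size : # K₀ + 1 ≡ # E
        pred-size = trans (cong (_+ 1) size₀) (m∸n+n≡m (≤-trans (s≤s z≤n) E≥2))
      ... | m , m′ , p , p′ , d = cases (# (K₀ ∪ ｛ m ｝) + 5 ≤? # (N S (K₀ ∪ ｛ m ｝))) (# (K₀ ∪ ｛ m′ ｝) + 5 ≤? # (N S (K₀ ∪ ｛ m′ ｝)))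
        where
        pred-size : # K₀ + 1 ≡ # E
        pred-size = trans (cong (_+ 1) size₀) (m∸n+n≡m (≤-trans (s≤s z≤n) E≥2))
        plus : ∀ {m} → m ∈ M ∖ K₀ → # (K₀ ∪ ｛ m ｝) ≡ # E
        plus {m} p = trans (≤-antisym
          (lin (# K₀ ∷ # ｛ m ｝ ∷ # (K₀ ∪ ｛ m ｝) ∷ []) ((x₂ ≲ x₀ ⊕ x₁ by count (K₀ ∷ ｛ m ｝ ∷ []) [] ⟨ x₀ ∨ᶠ x₁ ⟩ (⟨ x₀ ⟩ ⊕ ⟨ x₁ ⟩)) ∷ (x₁ ≲ κ 1 by ≤-reflexive (#｛｝ m)) ∷ []) x₂ (x₀ ⊕ κ 1))
          (#-∪｛｝ (∈∖ʳ p))) pred-size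
        K⊆ : ∀ {m} → m ∈ M ∖ K₀ → K₀ ∪ ｛ m ｝ ⊆ M
        K⊆ p = ∪⊆ K₀⊆ (｛｝⊆ (∈∖ˡ p))
        cases : Dec (# (K₀ ∪ ｛ m ｝) + 5 ≤ # (N S (K₀ ∪ ｛ m ｝))) → Dec (# (K₀ ∪ ｛ m′ ｝) + 5 ≤ # (N S (K₀ ∪ ｛ m′ ｝))) → Tight (suc (# E))
        cases (yes h) _       = Grow.grow E⊆ E-ind E≢∅ few (K⊆ p) (plus p) h
        cases (no _)  (yes h) = Grow.grow E⊆ E-ind E≢∅ few (K⊆ p′) (plus p′) h
        cases (no h)  (no h′) = tight (λ r → N⊆ (U⊆M r)) (Ind-⊆ U⊆M M-ind)
          (lin (# (N S U) ∷ # (N S (K₀ ∪ ｛ m ｝)) ∷ # (N S (K₀ ∪ ｛ m′ ｝)) ∷ # (N S K₀) ∷ # K₀ ∷ # E ∷ # U ∷ # (K₀ ∪ ｛ m ｝) ∷ # (K₀ ∪ ｛ m′ ｝) ∷ [])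
            ((x₀ ⊕ x₃ ≲ x₁ ⊕ x₂ by count (N S U ∷ N S (K₀ ∪ ｛ m ｝) ∷ N S (K₀ ∪ ｛ m′ ｝) ∷ N S K₀ ∷ [])
                ((x₀ ⊑ x₁ ∨ᶠ x₂ by N-union) ∷ (x₃ ⊑ x₁ by N-mono ∈∪ˡ) ∷ (x₃ ⊑ x₂ by N-mono ∈∪ˡ) ∷ []) (⟨ x₀ ⟩ ⊕ ⟨ x₃ ⟩) (⟨ x₁ ⟩ ⊕ ⟨ x₂ ⟩))
            ∷ (x₄ ⊕ κ 4 ≲ x₃ by surplus₄ (λ r → N⊆ (K₀⊆ r)) (Ind-⊆ K₀⊆ M-ind) K₀≢∅)
            ∷ (κ 1 ⊕ x₁ ≲ x₇ ⊕ κ 5 by ≰⇒> h) ∷ (κ 1 ⊕ x₂ ≲ x₈ ⊕ κ 5 by ≰⇒> h′)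
            ∷ (x₇ ≲ x₅ by ≤-reflexive (plus p)) ∷ (x₈ ≲ x₅ by ≤-reflexive (plus p′))
            ∷ (x₅ ≲ x₄ ⊕ κ 1 by ≤-reflexive (sym pred-size)) ∷ (κ 1 ⊕ x₅ ≲ x₆ by sizeU) ∷ []) x₀ (x₆ ⊕ κ 4))
          sizeU
          where
          U = K₀ ∪ ｛ m ｝ ∪ (K₀ ∪ ｛ m′ ｝)
          U⊆M : U ⊆ M
          U⊆M = ∪⊆ (K⊆ p) (K⊆ p′)
          K₀≢∅ : ∃ λ x → x ∈ K₀
          K₀≢∅ = #-inhabited (lin (# K₀ ∷ # E ∷ []) ((κ 2 ≲ x₁ by E≥2) ∷ (x₁ ≲ x₀ ⊕ κ 1 by ≤-reflexive (sym pred-size)) ∷ []) (κ 1) x₀)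
          sizeU : suc (# E) ≤ # U
          sizeU = lin (# E ∷ # (K₀ ∪ ｛ m ｝) ∷ # (K₀ ∪ ｛ m ｝ ∪ ｛ m′ ｝) ∷ # U ∷ [])
            ((x₀ ≲ x₁ by ≤-reflexive (sym (plus p)))
            ∷ (x₁ ⊕ κ 1 ≲ x₂ by #-∪｛｝ (λ r → [ ∈∖ʳ p′ , d ∘ ｛｝⁻ ]′ (∈∪⁻ r)))
            ∷ (x₂ ≲ x₃ by #-mono (λ r → [ ∈∪ˡ , ∈∪ʳ ∘ ∈∪ʳ ]′ (∈∪⁻ r))) ∷ []) (κ 1 ⊕ x₀) x₃

    deg≥5 : ∀ {v} → v ∈ S → 5 ≤ # (S ∩ e v)
    deg≥5 = degree≥ 3 bound₇ nb

    few-nbrs : ∀ {v} → # (S ∩ e v) ≤ 5 → # (N S ｛ v ｝) ≤ # ｛ v ｝ + 4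
    few-nbrs {v} h = ≤-trans (#-mono N-｛｝) (≤-trans h (≤-reflexive (cong (_+ 4) (sym (#｛｝ v)))))

    grow₁ : ∀ {v u} → v ∈ S → # (S ∩ e v) ≤ 5 → u ∈ S ∩ e v → 6 ≤ # (S ∩ e u) → Tight 2
    grow₁ {v} {u} v∈ dv u∈ du = subst Tight (cong suc (#｛｝ v)) (Grow.grow {｛ v ｝} {｛ u ｝} (｛｝⊆ v∈) Ind-｛｝ (v , ∈｛｝) (few-nbrs dv)
      (｛｝⊆ (N-｛｝⁺ u∈)) (trans (#｛｝ u) (sym (#｛｝ v))) (≤-trans (≤-reflexive (cong (_+ 5) (#｛｝ u))) (≤-trans du (#-mono N-｛｝⁺))))

    -- The star at `v` without `u` has at most four leaves, two of them adjacent to `p`. So `p` can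
    -- be deleted along with one of them even if the other is spent on a core vertex. If no leaf
    -- reaches the core, then `u` and the core form a tight set.
    module Single {v p u : Fin n} (v∈ : v ∈ S) (dv : # (S ∩ e v) ≤ 5) (p∈ : p ∈ S) (pv : p ∉ e v) (p≢v : v ≢ p)
                  (two-nbrs : 2 ≤ # (S ∩ e v ∩ e p)) (u∈ : u ∈ S ∩ e v) (up : u ∉ e p) where
      open Rooted tf v∈ u∈

      X′ = X ∖ ｛ p ｝

      p∈X : p ∈ X
      p∈X = ∈∖ (∈∖ p∈ pv) (up ∘ e⇄)

      sizeX′ : # X′ + 1 + # (S ∩ e u) ≤ 17
      sizeX′ = lin (# X ∷ # X′ ∷ # (S ∩ e u) ∷ # (S ∩ e v) ∷ # S ∷ [])
        ((κ 1 ⊕ x₁ ≲ x₀ by #-∖∈ p∈X) ∷ (x₀ ⊕ x₂ ⊕ x₃ ≲ x₄ by sizeX≤) ∷ (κ 5 ≲ x₃ by deg≥5 v∈) ∷ (x₄ ≲ κ 22 by l) ∷ []) (x₁ ⊕ κ 1 ⊕ x₂) (κ 17)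

      sizeU∖ : ∀ {a} → a ∈ U → # (U ∖ ｛ a ｝) ≤ 3
      sizeU∖ a∈ = ≤-pred (≤-trans (#-∖∈ a∈) (≤-pred (≤-trans sizeU dv)))

      U-p : 2 ≤ # (U ∩ e p)
      U-p = ≤-trans two-nbrs (#-mono λ q → ∈∩ (∈∖ (∈∩ˡ q) λ t → up (subst (_∈ e p) (sym (｛｝⁻ t)) (∈∩ʳ q))) (∈∩ʳ q))

      none-left : NoInd 6 X′ → ⊥
      none-left none =
        let a , a∈ = #-inhabited {A = U ∩ e p} (≤-trans (s≤s z≤n) U-p)
        in nb (rooted (cov-kill (∈∩ʳ a∈) (cov-base 2 (λ q → ∈∩ʳ (∈∖ˡ (∈∖ˡ q))) (sizeU∖ (∈∩ˡ a∈))))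
             λ s → none λ q → ∈∖ (∈∖ˡ (s q)) (∈∖ʳ (s q) ∘ ∈∪ʳ))

      module _ (c : Core 6 X′) where
        open Core c

        killed : ∀ {a f} → a ∈ U → f ∈ core → a ∈ e f → ⊥
        killed {a} a∈ f∈ fa =
          let b , b∈ = #-inhabited {A = U ∩ e p ∖ ｛ a ｝} (≤-pred (≤-trans U-p #-∖｛｝))
              b∈U = ∈∩ˡ (∈∖ˡ b∈)
          in nb (rooted (cov-kill (∈∩ʳ (∈∖ˡ b∈)) (cov-kill fa (cov-base 1 (λ q → ∈∩ʳ (∈∖ˡ (∈∖ˡ (∈∖ˡ q))))
                 (≤-pred (≤-trans (#-∖∈ (∈∖ a∈ λ t → ∖≢ b∈ (sym (｛｝⁻ t)))) (sizeU∖ b∈U))))))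
               λ s j large → ∈∖ʳ (s (core⊆ j (λ q → ∈∖ (∈∖ˡ (s q)) (∈∖ʳ (s q) ∘ ∈∪ʳ)) large f∈)) (∈∪ˡ (∈∪ʳ ∈｛｝)))

        inX : core ⊆ X
        inX q = ∈∖ˡ (core-X c q)

        grown : (∀ {x} → x ∉ N U core) → Tight 2
        grown none = tight (∪⊆ (λ q → X⊆S (inX q)) (｛｝⊆ (∈∩ˡ u∈))) (with-u inX (core-ind c))
          (lin (# core ∷ # (N X′ core) ∷ # X′ ∷ # (S ∩ e u) ∷ # (N S (core ∪ ｛ u ｝)) ∷ # (core ∪ ｛ u ｝) ∷ # ｛ p ｝ ∷ [])
            ((κ 12 ⊕ x₁ ≲ x₀ ⊕ x₂ by core-N c) ∷ (x₂ ⊕ κ 1 ⊕ x₃ ≲ κ 17 by sizeX′) ∷ (x₀ ⊕ κ 1 ≲ x₅ by #-∪｛｝ (u∉X ∘ inX))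
            ∷ (x₄ ≲ x₃ ⊕ x₁ ⊕ x₆ by count (N S (core ∪ ｛ u ｝) ∷ S ∩ e u ∷ N X′ core ∷ ｛ p ｝ ∷ []) ((x₀ ⊑ x₁ ∨ᶠ x₂ ∨ᶠ x₃ by where-N) ∷ []) ⟨ x₀ ⟩ (⟨ x₁ ⟩ ⊕ ⟨ x₂ ⟩ ⊕ ⟨ x₃ ⟩))
            ∷ (x₆ ≲ κ 1 by ≤-reflexive (#｛｝ p)) ∷ []) x₄ (x₅ ⊕ κ 4))
          (lin (# core ∷ # (N X′ core) ∷ # X′ ∷ # (S ∩ e u) ∷ # (core ∪ ｛ u ｝) ∷ [])
            ((κ 12 ⊕ x₁ ≲ x₀ ⊕ x₂ by core-N c) ∷ (x₂ ⊕ κ 1 ⊕ x₃ ≲ κ 17 by sizeX′) ∷ (κ 5 ≲ x₃ by deg≥5 (∈∩ˡ u∈))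
            ∷ (x₀ ⊕ κ 1 ≲ x₄ by #-∪｛｝ (u∉X ∘ inX)) ∷ []) (κ 2) x₄)
          where
          where-N : N S (core ∪ ｛ u ｝) ⊆ S ∩ e u ∪ N X′ core ∪ ｛ p ｝
          where-N {y} q with N-elim q
          ... | y∈ , x , x∈ , a with ∈∪⁻ x∈
          ...   | inj₂ r = ∈∪ˡ (∈∪ˡ (∈∩ y∈ (subst (λ t → y ∈ e t) (sym (｛｝⁻ r)) a)))
          ...   | inj₁ r with y ∈? e u | y ∈? ｛ p ｝ | y ∈? e v
          ...     | yes s | _     | _     = ∈∪ˡ (∈∪ˡ (∈∩ y∈ s))
          ...     | no _  | yes s | _     = ∈∪ʳ s
          ...     | no _  | no _  | yes s = ⊥-elim (none (N-intro (∈∖ (∈∩ y∈ s) λ t → ∈∖ʳ (inX r) (e⇄ (subst (_∈ e x) (sym (｛｝⁻ t)) a))) r a))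
          ...     | no s  | no t  | no w  = ∈∪ˡ (∈∪ʳ (N-intro (∈∖ (∈∖ (∈∖ y∈ w) s) t) r a))

      grow : Tight 2
      grow with core? (Bound-⊆ ∈∖ˡ bound₆)
      ... | inj₂ none = ⊥-elim (none-left none)
      ... | inj₁ c with some? (N U (Core.core c))
      ...   | inj₂ none = grown c none
      ...   | inj₁ (a , q) = let a∈ , f , f∈ , h = N-elim q in ⊥-elim (killed c a∈ f∈ h)

    -- Without a 4-cycle through `v`, `expansion` would require 4 · 5 + 5 + 1 = 26 vertices.
    bigger₁ : ∀ {v} → v ∈ S → # (S ∩ e v) ≤ 5 → Tight 2
    bigger₁ {v} v∈ dv with any? (λ p → (p ∈? (S ∖ e v ∖ ｛ v ｝)) ×-dec (2 ≤? # (S ∩ e v ∩ e p)))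
    ... | no none = ⊥-elim (absurd (# (S ∩ e v) ∷ # S ∷ [])
          ((x₀ ⊕ (x₀ ⊕ (x₀ ⊕ (x₀ ⊕ κ 0))) ⊕ x₀ ⊕ κ 1 ≲ x₁ by expansion {d = 4} tf v∈ deg≥5 few) ∷ (x₁ ≲ κ 22 by l)
          ∷ (κ 5 ≲ x₀ by deg≥5 v∈) ∷ (κ 5 ≲ x₀ by deg≥5 v∈) ∷ (κ 5 ≲ x₀ by deg≥5 v∈) ∷ (κ 5 ≲ x₀ by deg≥5 v∈) ∷ (κ 5 ≲ x₀ by deg≥5 v∈) ∷ []))
      where
      few : ∀ {y} → y ∈ S → y ∉ e v → v ≢ y → # (S ∩ e v ∩ e y) ≤ 1
      few {y} p q d = ≤-pred (≰⇒> λ h → none (y , ∈∖ (∈∖ p q) (d ∘ ｛｝⁻) , h))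
    ... | yes (p , p∈ , h) with some? (S ∩ e v ∖ e p)
    ...   | inj₁ (u , q) = Single.grow v∈ dv (∈∖ˡ (∈∖ˡ p∈)) (∈∖ʳ (∈∖ˡ p∈)) (∖≢ p∈) h (∈∖ˡ q) (∈∖ʳ q)
    -- Here N(v) is contained in N(p), so the surplus of {v, p} gives `p` degree at least 6. A
    -- neighbour `u` of `v` either has degree at least 6 itself or is tight with the neighbour `p`.
    ...   | inj₂ all = dominating (#-inhabited (≤-trans (s≤s z≤n) (deg≥5 v∈)))
      where
      v⊆p : S ∩ e v ⊆ S ∩ e p
      v⊆p {x} q with x ∈? e p
      ... | yes r = ∈∩ (∈∩ˡ q) r
      ... | no  r = ⊥-elim (all (∈∖ q r))
      dp : 6 ≤ # (S ∩ e p)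
      dp = lin (# (｛ v ｝ ∪ ｛ p ｝) ∷ # (N S (｛ v ｝ ∪ ｛ p ｝)) ∷ # (S ∩ e p) ∷ [])
        ((κ 2 ≲ x₀ by ≤-reflexive (sym (size-pair (∖≢ p∈))))
        ∷ (x₀ ⊕ κ 4 ≲ x₁ by surplus₄ (∪⊆ (｛｝⊆ v∈) (｛｝⊆ (∈∖ˡ (∈∖ˡ p∈)))) (Ind-pair (∈∖ʳ (∈∖ˡ p∈))) (v , ∈∪ˡ ∈｛｝))
        ∷ (x₁ ≲ x₂ by #-mono (λ q → ∪⊆ v⊆p (λ r → r) (N-pair q))) ∷ []) (κ 6) x₂
      dominating : (∃ λ u → u ∈ S ∩ e v) → Tight 2
      dominating (u , q) with 6 ≤? # (S ∩ e u)
      ... | yes du = grow₁ v∈ dv q du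
      ... | no  du = grow₁ (∈∩ˡ q) (≤-pred (≰⇒> du)) (∈∩ (∈∖ˡ (∈∖ˡ p∈)) (e⇄ (∈∩ʳ (v⊆p q)))) dp

    -- Tight sets can always be enlarged, but four vertices would have an independent neighbourhood
    -- of 8; `m` bounds the steps up to 4.
    no-tight : ∀ m {k} → 4 ≤ k + m → 1 ≤ k → Tight k → ⊥
    no-tight m {k} h k≥1 (tight {E} E⊆ E-ind few large) with 2 ≤? # E
    ... | no E<2 = let v , p = #-inhabited {A = E} (≤-trans k≥1 large) in
          single m h (bigger₁ (E⊆ p) (≤-trans (#-mono (λ q → N-mono (｛｝⊆ p) (N-｛｝⁺ q))) (≤-trans few (+-monoˡ-≤ 4 (≤-pred (≰⇒> E<2))))))
          where
          single : ∀ m → 4 ≤ k + m → Tight 2 → ⊥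
          single zero    h t = E<2 (≤-trans (≤-trans (s≤s (s≤s z≤n)) (≤-trans h (≤-reflexive (+-identityʳ k)))) large)
          single (suc m) h t = no-tight m {2} (≤-trans h (≤-trans (≤-reflexive (+-suc k m)) (s≤s (+-monoˡ-≤ m (≤-trans large (≤-pred (≰⇒> E<2))))))) (s≤s z≤n) t
    no-tight zero {k} h k≥1 (tight {E} E⊆ E-ind few large) | yes E≥2 = absurd (# E ∷ # (N S E) ∷ [])
      ((κ 4 ≲ x₀ by ≤-trans (≤-trans h (≤-reflexive (+-identityʳ k))) large) ∷ (x₀ ⊕ κ 4 ≲ x₁ by surplus₄ E⊆ E-ind E≢∅) ∷ (x₁ ≲ κ 7 by α M-ind) ∷ [])
      where
      E≢∅ : ∃ λ x → x ∈ E
      E≢∅ = #-inhabited (≤-trans (s≤s z≤n) E≥2)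
      M-ind : Ind (N S E)
      M-ind p r ab = absurd (# E ∷ # (N S E) ∷ [])
        ((x₀ ⊕ κ 5 ≲ x₁ by surplus-edge 2 bound₇ nb E⊆ E-ind E≢∅ p r ab) ∷ (x₁ ≲ x₀ ⊕ κ 4 by few) ∷ [])
    no-tight (suc m) {k} h k≥1 (tight {E} E⊆ E-ind few large) | yes E≥2 =
      no-tight m {suc (# E)} (≤-trans h (≤-trans (≤-reflexive (+-suc k m)) (s≤s (+-monoˡ-≤ m large)))) (s≤s z≤n) (bigger₂ E⊆ E-ind few E≥2)

    loose : ∀ {E} → E ⊆ S → Ind E → (∃ λ x → x ∈ E) → # E + 5 ≤ # (N S E)
    loose {E} s i (x , p) = ≰⇒>′ λ h → no-tight 3 {1} (s≤s (s≤s (s≤s (s≤s z≤n)))) (s≤s z≤n) (tight s i h (#-pos p))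
      where
      ≰⇒>′ : ¬ # (N S E) ≤ # E + 4 → # E + 5 ≤ # (N S E)
      ≰⇒>′ h = ≤-trans (≤-reflexive (+-suc (# E) 4)) (≰⇒> h)

    deg≥6 : ∀ {v} → v ∈ S → 6 ≤ # (S ∩ e v)
    deg≥6 {v} p = ≤-trans (≤-reflexive (cong (_+ 5) (sym (#｛｝ v)))) (≤-trans (loose (｛｝⊆ p) Ind-｛｝ (v , ∈｛｝)) (#-mono N-｛｝))

    -- A minimum degree of 6 or 7 is 5 + s with s = 1 or s = 2, and `loose` is the slack for τ = 1.
    unbreakable : ⊥
    unbreakable with any? (λ v → (v ∈? S) ×-dec (# (S ∩ e v) ≤? 6))
    ... | yes (v , p , h) = start {4} {1} {1} ≤-refl ≤-refl (s≤s (s≤s (s≤s z≤n))) tf l p (≤-antisym h (deg≥6 p)) deg≥6 (λ s i x _ _ → loose s i x) nb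
    ... | no none = let v , _ , p , _ = has-edge 3 nb in
          start {4} {2} {1} ≤-refl (s≤s z≤n) ≤-refl tf l p (≤-antisym (α (nbr-ind tf p)) (deg≥7 p)) deg≥7 (λ s i x _ _ → loose s i x) nb
      where
      deg≥7 : ∀ {v} → v ∈ S → 7 ≤ # (S ∩ e v)
      deg≥7 {v} p = ≰⇒> λ h → none (v , p , h)

  break₄ : Breakable 4 22
  break₄ {S} l nb = Tight₄.unbreakable (triangle-free break₃ l nb) l nb

  -- Five cliques: the neighbourhood of two non-adjacent vertices

  module Five₅ {S : VS n} (tf : TF S) (l : # S ≤ 25) (nb : ¬ Br 7 5 S) where

    surplus₅ : ∀ {E} → E ⊆ S → Ind E → (∃ λ x → x ∈ E) → # E + 5 ≤ # (N S E)
    surplus₅ = surplus 4 bound₇ nb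

    deg≥6 : ∀ {v} → v ∈ S → 6 ≤ # (S ∩ e v)
    deg≥6 = degree≥ 4 bound₇ nb

    deg≤7 : ∀ {v} → v ∈ S → # (S ∩ e v) ≤ 7
    deg≤7 p = α (nbr-ind tf p)

    -- The construction of `Grow` for a tight pair. Here `X` is so small that two vertices hit all
    -- its independent 5-sets, and both can be deleted along with vertices of `M ∖ K`.
    module TightPair {x y : Fin n} (x∈ : x ∈ S) (y∈ : y ∈ S) (x≢y : x ≢ y) (xy : y ∉ e x) (few : # (N S (｛ x ｝ ∪ ｛ y ｝)) ≤ 7) where

      E = ｛ x ｝ ∪ ｛ y ｝
      M = N S E

      E⊆ : E ⊆ S
      E⊆ = ∪⊆ (｛｝⊆ x∈) (｛｝⊆ y∈)
      E-ind : Ind E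
      E-ind = Ind-pair xy
      E≢∅ : ∃ λ x → x ∈ E
      E≢∅ = x , ∈∪ˡ ∈｛｝
      sizeE : 2 ≤ # E
      sizeE = ≤-trans (≤-reflexive (cong (_+ 1) (sym (#｛｝ x)))) (#-∪｛｝ (x≢y ∘ ｛｝⁻))
      M-ind : Ind M
      M-ind p q a = absurd (# E ∷ # M ∷ []) ((κ 2 ≲ x₀ by sizeE) ∷ (x₀ ⊕ κ 6 ≲ x₁ by surplus-edge 3 bound₇ nb E⊆ E-ind E≢∅ p q a) ∷ (x₁ ≲ κ 7 by few) ∷ [])
      manyM : 7 ≤ # M
      manyM = lin (# E ∷ # M ∷ []) ((κ 2 ≲ x₀ by sizeE) ∷ (x₀ ⊕ κ 5 ≲ x₁ by surplus₅ E⊆ E-ind E≢∅) ∷ []) (κ 7) x₁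
      outside-E : ∀ {y z} → y ∈ S → y ∉ M → z ∈ E → y ∉ e z
      outside-E p q r s = q (N-intro p r s)

      module _ {K : VS n} (K⊆ : K ⊆ M) (sizeK : # K ≡ 2) (manyK : 8 ≤ # (N S K)) where

        X = S ∖ M ∖ N S K ∖ E

        X⊆S : X ⊆ S
        X⊆S p = ∈∖ˡ (∈∖ˡ (∈∖ˡ p))
        X∉M : ∀ {x} → x ∈ X → x ∉ M
        X∉M p = ∈∖ʳ (∈∖ˡ (∈∖ˡ p))
        sizeX : # X ≤ 10
        sizeX = lin (# X ∷ # M ∷ # (N S K) ∷ # S ∷ [])
          ((x₀ ⊕ x₁ ⊕ x₂ ≲ x₃ by count (X ∷ M ∷ N S K ∷ S ∷ []) ((x₀ ⊑ x₃ by X⊆S) ∷ (x₁ ⊑ x₃ by N⊆) ∷ (x₂ ⊑ x₃ by N⊆)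
              ∷ (x₀ ∧ᶠ x₁ ⊑ ff by λ p → ⊥-elim (X∉M (∈∩ˡ p) (∈∩ʳ p)))
              ∷ (x₀ ∧ᶠ x₂ ⊑ ff by λ p → ⊥-elim (∈∖ʳ (∈∖ˡ (∈∩ˡ p)) (∈∩ʳ p)))
              ∷ (x₁ ∧ᶠ x₂ ⊑ ff by λ p → let _ , z , z∈ , a = N-elim (∈∩ʳ p) in ⊥-elim (M-ind (K⊆ z∈) (∈∩ˡ p) a)) ∷ [])
              (⟨ x₀ ⟩ ⊕ ⟨ x₁ ⟩ ⊕ ⟨ x₂ ⟩) ⟨ x₃ ⟩)
          ∷ (x₃ ≲ κ 25 by l) ∷ (κ 7 ≲ x₁ by manyM) ∷ (κ 8 ≲ x₂ by manyK) ∷ []) x₀ (κ 10)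
        beside-E : ∀ {J} → Ind J → J ⊆ S ∖ M → (∀ {x} → x ∈ J → x ∉ E) → # J ≤ 5
        beside-E {J} j s d = lin (# J ∷ # E ∷ # (J ∪ E) ∷ [])
          ((x₀ ⊕ x₁ ≲ x₂ by count (J ∷ E ∷ []) ((x₀ ∧ᶠ x₁ ⊑ ff by λ p → ⊥-elim (d (∈∩ˡ p) (∈∩ʳ p))) ∷ []) (⟨ x₀ ⟩ ⊕ ⟨ x₁ ⟩) ⟨ x₀ ∨ᶠ x₁ ⟩)
          ∷ (x₂ ≲ κ 7 by α (Ind-∪ j E-ind λ p r a → outside-E (∈∖ˡ (s p)) (∈∖ʳ (s p)) r (e⇄ a)))
          ∷ (κ 2 ≲ x₁ by sizeE) ∷ []) x₀ (κ 5)
        bound-X : Bound 5 X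
        bound-X s j = beside-E j (λ p → ∈∖ˡ (∈∖ˡ (s p))) (λ p → ∈∖ʳ (s p))

        module _ {J : VS n} (J⊆ : J ⊆ S) (avoid : ∀ {x} → x ∈ J → x ∉ M ∖ K × x ∉ E) (j : Ind J) (large : 7 ≤ # J) where

          in-K : J ∩ M ⊆ K
          in-K {x} p with x ∈? K
          ... | yes r = r
          ... | no  r = ⊥-elim (proj₁ (avoid (∈∩ˡ p)) (∈∖ (∈∩ʳ p) r))
          out : # (J ∖ M) ≤ 5
          out = beside-E (Ind-⊆ ∈∖ˡ j) (λ p → ∈∖ (J⊆ (∈∖ˡ p)) (∈∖ʳ p)) (λ p → proj₂ (avoid (∈∖ˡ p)))
          split : # J ≤ # (J ∩ M) + # (J ∖ M)
          split = count (J ∷ M ∷ []) [] ⟨ x₀ ⟩ (⟨ x₀ ∧ᶠ x₁ ⟩ ⊕ ⟨ x₀ ∖ᶠ x₁ ⟩)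
          K⊆J : K ⊆ J
          K⊆J {x} p with x ∈? J
          ... | yes r = r
          ... | no  r = ⊥-elim (absurd (# J ∷ # (J ∩ M) ∷ # (J ∖ M) ∷ # K ∷ # (K ∖ ｛ x ｝) ∷ [])
                ((κ 7 ≲ x₀ by large) ∷ (x₀ ≲ x₁ ⊕ x₂ by split) ∷ (x₂ ≲ κ 5 by out)
                ∷ (x₁ ≲ x₄ by #-mono (λ t → ∈∖ (in-K t) λ u → r (subst (_∈ J) (sym (｛｝⁻ u)) (∈∩ˡ t))))
                ∷ (κ 1 ⊕ x₄ ≲ x₃ by #-∖∈ p) ∷ (x₃ ≲ κ 2 by ≤-reflexive sizeK) ∷ []))
          trapped : J ∖ M ⊆ X
          trapped p = ∈∖ (∈∖ (∈∖ (J⊆ (∈∖ˡ p)) (∈∖ʳ p)) (λ r → let _ , z , z∈ , a = N-elim r in j (K⊆J z∈) (∈∖ˡ p) a)) (proj₂ (avoid (∈∖ˡ p)))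
          full-size : 5 ≤ # (J ∖ M)
          full-size = lin (# J ∷ # (J ∩ M) ∷ # (J ∖ M) ∷ # K ∷ [])
            ((κ 7 ≲ x₀ by large) ∷ (x₀ ≲ x₁ ⊕ x₂ by split) ∷ (x₁ ≲ x₃ by #-mono in-K) ∷ (x₃ ≲ κ 2 by ≤-reflexive sizeK) ∷ []) (κ 5) x₂

        bound-T : ∀ k {T} → T ⊆ M → # T ≤ k → 2 ≤ k → Bound k (T ∪ E)
        bound-T k {T} T⊆ h k≥2 {J} s j with some? (J ∩ E)
        ... | inj₂ none = ≤-trans (#-mono λ p → [ (λ q → q) , (λ q → ⊥-elim (none (∈∩ p q))) ]′ (∈∪⁻ (s p))) h
        ... | inj₁ t = lin (# J ∷ # (J ∩ E) ∷ # (J ∩ M) ∷ # (N S (J ∩ E)) ∷ # M ∷ k ∷ [])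
              ((x₀ ≲ x₁ ⊕ x₂ by count (J ∷ E ∷ M ∷ T ∷ []) ((x₀ ⊑ x₃ ∨ᶠ x₁ by s) ∷ (x₃ ⊑ x₂ by T⊆) ∷ []) ⟨ x₀ ⟩ (⟨ x₀ ∧ᶠ x₁ ⟩ ⊕ ⟨ x₀ ∧ᶠ x₂ ⟩))
              ∷ (x₁ ⊕ κ 5 ≲ x₃ by surplus₅ (λ p → E⊆ (∈∩ʳ p)) (Ind-⊆ ∈∩ʳ E-ind) t)
              ∷ (x₂ ⊕ x₃ ≲ x₄ by count (J ∷ M ∷ N S (J ∩ E) ∷ []) ((x₂ ⊑ x₁ by N-mono ∈∩ʳ)
                  ∷ (x₂ ∧ᶠ x₀ ⊑ ff by λ p → let _ , z , z∈ , a = N-elim (∈∩ˡ p) in ⊥-elim (j (∈∩ˡ z∈) (∈∩ʳ p) a)) ∷ [])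
                  (⟨ x₀ ∧ᶠ x₁ ⟩ ⊕ ⟨ x₂ ⟩) ⟨ x₁ ⟩)
              ∷ (x₄ ≲ κ 7 by few) ∷ (κ 2 ≲ x₅ by k≥2) ∷ []) x₀ x₅

        sizeMK : # (M ∖ K) ≤ 5
        sizeMK = lin (# (M ∖ K) ∷ # K ∷ # M ∷ []) ((x₀ ⊕ x₁ ≲ x₂ by ≤-reflexive (#-∖⊆ K⊆)) ∷ (κ 2 ≲ x₁ by ≤-reflexive (sym sizeK)) ∷ (x₂ ≲ κ 7 by few) ∷ []) x₀ (κ 5)

        none-left : NoInd 5 X → ⊥
        none-left none = könig 5 (Ind-⊆ ∈∖ˡ M-ind) E-ind (bound-T 5 ∈∖ˡ sizeMK (s≤s (s≤s z≤n))) λ c → nb (Cov-Br₀ c λ s j large →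
          let s′ = λ {x} p → ∈∖ˡ (s {x} p) ; h = λ {x} p → (λ q → ∈∖ʳ (s {x} p) (∈∪ˡ q)) , (λ q → ∈∖ʳ (s {x} p) (∈∪ʳ q))
          in none (trapped s′ h j large) (Ind-⊆ ∈∖ˡ j) (full-size s′ h j large))

        module _ {p f : Fin n} (p∈ : p ∈ X) (f∈ : f ∈ X) (none : NoInd 5 (X ∖ ｛ p ｝ ∖ ｛ f ｝)) where

          -- The two edges use up two of the at most five vertices of `M ∖ K`, so three cliques
          -- suffice for the rest.
          partners : ∀ {m m′} → m ∈ M ∖ K → m′ ∈ M ∖ K → m ≢ m′ → m ∈ e p → m′ ∈ e f → ⊥
          partners {m} {m′} m∈ m′∈ d mp m′f = könig 3 (Ind-⊆ (λ q → ∈∖ˡ (∈∖ˡ (∈∖ˡ q))) M-ind) E-ind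
            (bound-T 3 (λ q → ∈∖ˡ (∈∖ˡ (∈∖ˡ q))) (lin (# (M ∖ K) ∷ # (M ∖ K ∖ ｛ m ｝) ∷ # (M ∖ K ∖ ｛ m ｝ ∖ ｛ m′ ｝) ∷ [])
              ((κ 1 ⊕ x₁ ≲ x₀ by #-∖∈ m∈) ∷ (κ 1 ⊕ x₂ ≲ x₁ by #-∖∈ (∈∖ m′∈ (d ∘ ｛｝⁻))) ∷ (x₀ ≲ κ 5 by sizeMK) ∷ []) x₂ (κ 3)) (s≤s (s≤s z≤n)))
            λ c → nb (edge p m , Clique-edge mp , edge f m′ , Clique-edge m′f , Cov-Br₀ c λ s j large →
              let s′ = λ {x} q → ∈∖ˡ (∈∖ˡ (∈∖ˡ (s {x} q)))
                  h  = λ {x} q → (λ r → ∈∖ʳ (s {x} q) (∈∪ˡ (∈∖ (∈∖ r (λ t → ∈∖ʳ (∈∖ˡ (∈∖ˡ (s q))) (∈∪ʳ t))) λ t → ∈∖ʳ (∈∖ˡ (s q)) (∈∪ʳ t))))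
                                 , (λ r → ∈∖ʳ (s q) (∈∪ʳ r))
              in none (λ q → ∈∖ (∈∖ (trapped s′ h j large q) (λ t → ∈∖ʳ (∈∖ˡ (∈∖ˡ (s (∈∖ˡ q)))) (∈∪ˡ t))) (λ t → ∈∖ʳ (∈∖ˡ (s (∈∖ˡ q))) (∈∪ˡ t)))
                   (Ind-⊆ ∈∖ˡ j) (full-size s′ h j large))

          partner-of : ∀ {g} → g ∈ X → ∃ λ m → m ∈ M ∖ K × m ∈ e g
          partner-of {g} g∈ with some? (M ∩ e g)
          ... | inj₁ (m , q) = m , ∈∖ (∈∩ˡ q) (λ r → ∈∖ʳ (∈∖ˡ g∈) (N-intro (X⊆S g∈) r (e⇄ (∈∩ʳ q)))) , ∈∩ʳ q
          ... | inj₂ none    = ⊥-elim (dominated M-ind (X∉M g∈) (λ q a → none (∈∩ q a)) manyM)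

          -- If `m` is the only neighbour of `p` and `f` in `M`, both can replace it there, which
          -- gives 8 independent vertices.
          same-partner : ∀ {m} → p ≢ f → m ∈ M ∖ K → m ∈ e p → m ∈ e f → (∃ λ x → x ∈ (M ∖ ｛ m ｝) ∩ (e p ∪ e f)) ⊎ (∀ {x} → x ∉ (M ∖ ｛ m ｝) ∩ (e p ∪ e f)) → ⊥
          same-partner {m} p≢f m∈ mp mf (inj₁ (x , q)) = [ (λ a → partners (∉K p∈ a) m∈ (∖≢ (∈∩ˡ q) ∘ sym) a mf) , (λ a → partners m∈ (∉K f∈ a) (∖≢ (∈∩ˡ q)) mp a) ]′ (∈∪⁻ (∈∩ʳ q))
            where
            ∉K : ∀ {g} → g ∈ X → x ∈ e g → x ∈ M ∖ K
            ∉K g∈ a = ∈∖ (∈∖ˡ (∈∩ˡ q)) λ r → ∈∖ʳ (∈∖ˡ g∈) (N-intro (X⊆S g∈) r (e⇄ a))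
          same-partner {m} p≢f m∈ mp mf (inj₂ none′) = absurd (# M ∷ # (M ∖ ｛ m ｝) ∷ # (M ∖ ｛ m ｝ ∪ ｛ p ｝) ∷ # (M ∖ ｛ m ｝ ∪ ｛ p ｝ ∪ ｛ f ｝) ∷ [])
            ((κ 7 ≲ x₀ by manyM) ∷ (x₀ ≲ κ 1 ⊕ x₁ by #-∖｛｝)
            ∷ (x₁ ⊕ κ 1 ≲ x₂ by #-∪｛｝ (λ q → X∉M p∈ (∈∖ˡ q)))
            ∷ (x₂ ⊕ κ 1 ≲ x₃ by #-∪｛｝ (λ q → [ (λ r → X∉M f∈ (∈∖ˡ r)) , p≢f ∘ ｛｝⁻ ]′ (∈∪⁻ q)))
            ∷ (x₃ ≲ κ 7 by α (Ind-∪｛｝ (Ind-∪｛｝ (Ind-⊆ ∈∖ˡ M-ind) (λ q a → none′ (∈∩ q (∈∪ˡ a))))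
                λ q a → [ (λ r → none′ (∈∩ r (∈∪ʳ a))) , (λ r → tf (N⊆ (∈∖ˡ m∈)) (X⊆S f∈) (X⊆S p∈) (e⇄ mf) (subst (_∈ e f) (sym (｛｝⁻ r)) a) (e⇄ mp)) ]′ (∈∪⁻ q))) ∷ [])

          two-left : p ≢ f → ⊥
          two-left p≢f = let m , m∈ , mp = partner-of p∈ ; m′ , m′∈ , m′f = partner-of f∈ in compare m∈ m′∈ mp m′f (m ≟ m′)
            where
            compare : ∀ {m m′} → m ∈ M ∖ K → m′ ∈ M ∖ K → m ∈ e p → m′ ∈ e f → Dec (m ≡ m′) → ⊥
            compare m∈ m′∈ mp m′f (no d)     = partners m∈ m′∈ d mp m′f
            compare m∈ m′∈ mp m′f (yes refl) = same-partner p≢f m∈ mp m′f (some? _)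

        contradiction : ⊥
        contradiction = [ with-core , none-left ]′ (core? bound-X)
          where
          -- Any `p` in `X` leaves at most 9 vertices, fewer than 2 · 5, so the remaining 5-sets
          -- have a common vertex. The second vertex of the 5-set serves when no 5-sets remain.
          with-core : Core 5 X → ⊥
          with-core c = let J , j , J⊆ , l5 = Core.some c ; p , f , p∈ , f∈ , d = two {A = J} (≤-trans (s≤s (s≤s z≤n)) l5)
                        in second (J⊆ p∈) (J⊆ f∈) d (core? (Bound-⊆ ∈∖ˡ bound-X))
            where
            second : ∀ {p f} → p ∈ X → f ∈ X → p ≢ f → Core 5 (X ∖ ｛ p ｝) ⊎ NoInd 5 (X ∖ ｛ p ｝) → ⊥
            second p∈ f∈ d (inj₂ none) = two-left p∈ f∈ (λ s → none (λ q → ∈∖ˡ (s q))) d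
            second {p} p∈ f∈ d (inj₁ c′) =
              let g , g∈ = #-inhabited {A = Core.core c′} (lin (# (Core.core c′) ∷ # (X ∖ ｛ p ｝) ∷ # X ∷ # (N (X ∖ ｛ p ｝) (Core.core c′)) ∷ [])
                      ((κ 10 ⊕ x₃ ≲ x₀ ⊕ x₁ by core-N c′) ∷ (κ 1 ⊕ x₁ ≲ x₂ by #-∖∈ p∈) ∷ (x₂ ≲ κ 10 by sizeX) ∷ []) (κ 1) x₀)
              in two-left p∈ (∈∖ˡ (core-X c′ g∈)) (λ s i h → ∈∖ʳ (s (Core.core⊆ c′ i (λ q → ∈∖ˡ (s q)) h g∈)) ∈｛｝) (∖≢ (core-X c′ g∈))

      module _ {m a b : Fin n} (m∈ : m ∈ M) (a∈ : a ∈ M ∖ ｛ m ｝) (b∈ : b ∈ M ∖ ｛ m ｝) (a≢b : a ≢ b)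
               (h : # (N S (｛ m ｝ ∪ ｛ a ｝)) ≤ 7) (h′ : # (N S (｛ m ｝ ∪ ｛ b ｝)) ≤ 7) where

        T = ｛ m ｝ ∪ ｛ a ｝ ∪ ｛ b ｝
        T⊆M : T ⊆ M
        T⊆M = ∪⊆ (∪⊆ (｛｝⊆ m∈) (｛｝⊆ (∈∖ˡ a∈))) (｛｝⊆ (∈∖ˡ b∈))
        sizeT : 3 ≤ # T
        sizeT = ≤-trans (≤-reflexive (cong (_+ 1) (sym (size-pair (∖≢ a∈))))) (#-∪｛｝ λ p → [ ∖≢ b∈ ∘ ｛｝⁻ , a≢b ∘ ｛｝⁻ ]′ (∈∪⁻ p))
        T≥8 : 8 ≤ # (N S T)
        T≥8 = lin (# T ∷ # (N S T) ∷ []) ((κ 3 ≲ x₀ by sizeT) ∷ (x₀ ⊕ κ 5 ≲ x₁ by surplus₅ (λ p → N⊆ (T⊆M p)) (Ind-⊆ T⊆M M-ind) (m , ∈∪ˡ (∈∪ˡ ∈｛｝))) ∷ []) (κ 8) x₁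
        T≤8 : # (N S T) ≤ 8
        T≤8 = lin (# (N S T) ∷ # (N S (｛ m ｝ ∪ ｛ a ｝)) ∷ # (N S (｛ m ｝ ∪ ｛ b ｝)) ∷ # (N S ｛ m ｝) ∷ # (S ∩ e m) ∷ [])
          ((x₀ ⊕ x₃ ≲ x₁ ⊕ x₂ by count (N S T ∷ N S (｛ m ｝ ∪ ｛ a ｝) ∷ N S (｛ m ｝ ∪ ｛ b ｝) ∷ N S ｛ m ｝ ∷ [])
              ((x₀ ⊑ x₁ ∨ᶠ x₂ by λ p → let s , z , z∈ , h = N-elim p in [ (λ q → ∈∪ˡ (N-intro s q h)) , (λ q → ∈∪ʳ (N-intro s (∈∪ʳ q) h)) ]′ (∈∪⁻ z∈))
              ∷ (x₃ ⊑ x₁ by N-mono ∈∪ˡ) ∷ (x₃ ⊑ x₂ by N-mono ∈∪ˡ) ∷ []) (⟨ x₀ ⟩ ⊕ ⟨ x₃ ⟩) (⟨ x₁ ⟩ ⊕ ⟨ x₂ ⟩))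
          ∷ (κ 1 ⊕ x₁ ≲ κ 8 by s≤s h) ∷ (κ 1 ⊕ x₂ ≲ κ 8 by s≤s h′) ∷ (x₄ ≲ x₃ by #-mono N-｛｝⁺) ∷ (κ 6 ≲ x₄ by deg≥6 (N⊆ m∈)) ∷ []) x₀ (κ 8)
        T-ind : Ind (N S T)
        T-ind p q r = absurd (# T ∷ # (N S T) ∷ []) ((κ 3 ≲ x₀ by sizeT) ∷ (x₁ ≲ κ 8 by T≤8)
          ∷ (x₀ ⊕ κ 6 ≲ x₁ by surplus-edge 3 bound₇ nb (λ p → N⊆ (T⊆M p)) (Ind-⊆ T⊆M M-ind) (m , ∈∪ˡ (∈∪ˡ ∈｛｝)) p q r) ∷ [])
        -- Two tight pairs share the at least 6 neighbours of `m`, so `T` has at most 7 + 7 - 6 = 8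
        -- neighbours: equality again, hence 8 independent vertices. So some pair in `M` can serve
        -- as `K`.
        triple : ⊥
        triple = absurd (# (N S T) ∷ []) ((κ 8 ≲ x₀ by T≥8) ∷ (x₀ ≲ κ 7 by α T-ind) ∷ [])

      impossible : ⊥
      impossible =
        let m , m∈ = #-inhabited {A = M} (≤-trans (s≤s z≤n) manyM)
            a , b , a∈ , b∈ , a≢b = two {A = M ∖ ｛ m ｝} (≤-pred (≤-trans (≤-trans (s≤s (s≤s (s≤s z≤n))) manyM) #-∖｛｝))
        in choose m∈ a∈ b∈ a≢b (8 ≤? _) (8 ≤? _)
        where
        choose : ∀ {m a b} → m ∈ M → a ∈ M ∖ ｛ m ｝ → b ∈ M ∖ ｛ m ｝ → a ≢ b →
                 Dec (8 ≤ # (N S (｛ m ｝ ∪ ｛ a ｝))) → Dec (8 ≤ # (N S (｛ m ｝ ∪ ｛ b ｝))) → ⊥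
        choose m∈ a∈ b∈ d (yes h) _       = contradiction (∪⊆ (｛｝⊆ m∈) (｛｝⊆ (∈∖ˡ a∈))) (size-pair (∖≢ a∈)) h
        choose m∈ a∈ b∈ d (no _)  (yes h) = contradiction (∪⊆ (｛｝⊆ m∈) (｛｝⊆ (∈∖ˡ b∈))) (size-pair (∖≢ b∈)) h
        choose m∈ a∈ b∈ d (no h)  (no h′) = triple m∈ a∈ b∈ d (≤-pred (≰⇒> h)) (≤-pred (≰⇒> h′))

    pair≥8 : ∀ {x y} → x ∈ S → y ∈ S → x ≢ y → y ∉ e x → 8 ≤ # (N S (｛ x ｝ ∪ ｛ y ｝))
    pair≥8 x∈ y∈ d h = ≰⇒> (TightPair.impossible x∈ y∈ d h)

  -- Five cliques: vertices at distance at least 3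

  module Distance {S : VS n} (tf : TF S) (l : # S ≤ 25) (nb : ¬ Br 7 5 S) where
    open Five₅ tf l nb

    -- the vertices at distance at least 3 from v
    Far : Fin n → VS n
    Far v = S ∖ e v ∖ ｛ v ｝ ∖ N S (S ∩ e v)

    far : ∀ {v z} → z ∈ S → z ∉ e v → v ≢ z → (∀ {x} → x ∈ S ∩ e v → x ∉ e z) → z ∈ Far v
    far p q d h = ∈∖ (∈∖ (∈∖ p q) (d ∘ ｛｝⁻)) λ r → let _ , x , x∈ , a = N-elim r in h x∈ (e⇄ a)

    module _ {v z : Fin n} (z∈ : z ∈ Far v) where

      far-S : z ∈ S
      far-S = ∈∖ˡ (∈∖ˡ (∈∖ˡ z∈))
      far-∉ : z ∉ e v
      far-∉ = ∈∖ʳ (∈∖ˡ (∈∖ˡ z∈))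
      far-≢ : v ≢ z
      far-≢ = ∖≢ (∈∖ˡ z∈)
      far-apart : ∀ {x} → x ∈ S ∩ e v → x ∉ e z
      far-apart p a = ∈∖ʳ z∈ (N-intro far-S p (e⇄ a))
      far-sym : v ∈ S → v ∈ Far z
      far-sym v∈ = far v∈ (far-∉ ∘ e⇄) (far-≢ ∘ sym) λ p a → far-apart (∈∩ (∈∩ˡ p) a) (∈∩ʳ p)
      far-ind : v ∈ S → Ind (S ∩ e v ∪ ｛ z ｝)
      far-ind v∈ = Ind-∪｛｝ (nbr-ind tf v∈) far-apart
      far-deg : v ∈ S → # (S ∩ e v) ≤ 6
      far-deg v∈ = +-cancelʳ-≤ 1 _ 6 (≤-trans (#-∪｛｝ (far-∉ ∘ ∈∩ʳ)) (α (far-ind v∈)))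

    -- Otherwise `z`, `z′` and the at least 6 neighbours of `v` would be 8 independent vertices.
    far-adj : ∀ {v z z′} → v ∈ S → z ∈ Far v → z′ ∈ Far v → z ≢ z′ → z′ ∈ e z
    far-adj {v} {z} {z′} v∈ p q d with z′ ∈? e z
    ... | yes h = h
    ... | no  h = ⊥-elim (absurd (# (S ∩ e v) ∷ # (S ∩ e v ∪ ｛ z ｝) ∷ # (S ∩ e v ∪ ｛ z ｝ ∪ ｛ z′ ｝) ∷ [])
      ((κ 6 ≲ x₀ by deg≥6 v∈) ∷ (x₀ ⊕ κ 1 ≲ x₁ by #-∪｛｝ (far-∉ p ∘ ∈∩ʳ))
      ∷ (x₁ ⊕ κ 1 ≲ x₂ by #-∪｛｝ (λ r → [ far-∉ q ∘ ∈∩ʳ , d ∘ ｛｝⁻ ]′ (∈∪⁻ r)))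
      ∷ (x₂ ≲ κ 7 by α (Ind-∪｛｝ (far-ind p v∈) λ r a → [ (λ t → far-apart q t a) , (λ t → h (e⇄ (subst (_∈ e z′) (sym (｛｝⁻ t)) a))) ]′ (∈∪⁻ r))) ∷ []))

    -- `pair-break` fails only if every `u` in `P` outside N(y) lies in an independent 7-set of `L`.
    -- Then the hull of these 7-sets contains `P`, and a core vertex in `Q` has no neighbour in `P`.
    module Common {v y : Fin n} (v∈ : v ∈ S) (y∈ : y ∈ S) (y∉ : y ∉ e v) (v≢y : v ≢ y)
                  (d6 : # (S ∩ e v) ≤ 6) (common : 2 ≤ # (S ∩ e v ∩ e y)) where

      P = S ∩ e v
      Q = S ∩ e y ∖ e v
      L = P ∪ Q

      L⊆ : P ∪ S ∩ e y ⊆ L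
      L⊆ {x} p with x ∈? e v
      ... | yes q = ∈∪ˡ (∈∩ ([ ∈∩ˡ , ∈∩ˡ ]′ (∈∪⁻ p)) q)
      ... | no  q = ∈∪ʳ (∈∖ ([ (λ r → ⊥-elim (q (∈∩ʳ r))) , (λ r → r) ]′ (∈∪⁻ p)) q)

      escape : ∀ {u} → u ∈ P → u ∉ e y → (∀ {J} → J ⊆ L → Ind J → u ∈ J → # J ≤ 6) → ⊥
      escape {u} u∈ u∉ h = pair-break tf v∈ y∈ common u∈ u∉
        (λ {J} s j → +-cancelʳ-≤ 1 (# J) 5 (≤-trans (#-∪｛｝ λ p → ∈∖ʳ (s p) (∈∪ʳ ∈｛｝))
          (h (∪⊆ (λ p → L⊆ (∈∖ˡ (s p))) (｛｝⊆ (∈∪ˡ u∈))) (Ind-∪｛｝ j λ p a → ∈∖ʳ (s p) (∈∪ˡ a)) (∈∪ʳ ∈｛｝)))) nb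

      none : NoInd 7 L → ⊥
      none h with some? (P ∖ e y)
      ... | inj₁ (u , p) = escape (∈∖ˡ p) (∈∖ʳ p) λ s j _ → ≤-pred (≰⇒> λ l → h s j l)
      ... | inj₂ all = absurd (# (N S (｛ v ｝ ∪ ｛ y ｝)) ∷ # (S ∩ e y) ∷ [])
        ((κ 8 ≲ x₀ by pair≥8 v∈ y∈ v≢y y∉)
        ∷ (x₀ ≲ x₁ by #-mono λ p → [ (λ q → ∈∩ (∈∩ˡ q) (inside q)) , (λ q → q) ]′ (∈∪⁻ (N-pair p))) ∷ (x₁ ≲ κ 7 by deg≤7 y∈) ∷ [])
        where
        inside : P ⊆ e y
        inside {x} p with x ∈? e y
        ... | yes q = q
        ... | no  q = ⊥-elim (all (∈∖ p q))

      module _ (c : Core 7 L) where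
        open Core c

        crossing : ∀ {x y} → x ∈ hull → y ∈ core → y ∉ e x
        crossing p q a = let J , j , s , l , r = hull⊆ p in j r (core⊆ j s l q) a

        shared : ∀ {w} → w ∈ P → w ∈ e y → w ∈ hull
        shared {w} p q = let J , j , s , l = some in ⊆hull j s l (inside j s l (w ∈? J))
          where
          inside : ∀ {J} → Ind J → J ⊆ L → 7 ≤ # J → Dec (w ∈ J) → w ∈ J
          inside j s l (yes r) = r
          inside j s l (no r)  = ⊥-elim (dominated j r (λ t a → [ (λ u → nbr-ind tf v∈ p u a) , (λ u → nbr-ind tf y∈ (∈∩ (∈∩ˡ p) q) (∈∖ˡ u) a) ]′ (∈∪⁻ (s t))) l)

        hull-L : hull ⊆ L
        hull-L p = let J , j , s , l , r = hull⊆ p in s r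

        found : ∀ {z} → P ⊆ hull → z ∈ core → z ∈ Q → ∃ λ z → z ∈ S ∩ e y × z ∈ Far v
        found {z} P⊆ p q = z , ∈∖ˡ q , far (∈∩ˡ (∈∖ˡ q)) (∈∖ʳ q) (λ r → y∉ (e⇄ (subst (_∈ e y) (sym r) (∈∩ʳ (∈∖ˡ q))))) λ p′ a → crossing (P⊆ p′) p (e⇄ a)

        -- Independent, since no edge joins core and hull. From 14 ≤ # core + # hull, # P ≤ 6 and #
        -- B ≤ 7 one core vertex remains for `Q`.
        B = core ∩ P ∪ hull ∩ Q

        sizeB : # B ≤ 7
        sizeB = α (Ind-∪ (Ind-⊆ ∈∩ˡ (core-ind c)) (Ind-⊆ (λ p → ∈∖ˡ (∈∩ʳ p)) (nbr-ind tf y∈)) λ p q a → crossing (∈∩ˡ q) (∈∩ˡ p) (e⇄ a))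

        outside : 1 ≤ # (core ∩ Q)
        outside = lin (# P ∷ # (core ∩ Q) ∷ # B ∷ # core ∷ # hull ∷ [])
            ((κ 14 ≲ x₃ ⊕ x₄ by sizes) ∷ (x₀ ≲ κ 6 by d6)
            ∷ (x₂ ≲ κ 7 by sizeB)
            ∷ (x₃ ⊕ x₄ ≲ x₀ ⊕ x₁ ⊕ x₂ by count (core ∷ hull ∷ P ∷ Q ∷ []) ((x₀ ⊑ x₂ ∨ᶠ x₃ by core-X c) ∷ (x₁ ⊑ x₂ ∨ᶠ x₃ by hull-L)
                ∷ (x₂ ∧ᶠ x₃ ⊑ ff by λ p → ⊥-elim (∈∖ʳ (∈∩ʳ p) (∈∩ʳ (∈∩ˡ p)))) ∷ [])
                (⟨ x₀ ⟩ ⊕ ⟨ x₁ ⟩) (⟨ x₂ ⟩ ⊕ ⟨ x₀ ∧ᶠ x₃ ⟩ ⊕ ⟨ x₀ ∧ᶠ x₂ ∨ᶠ x₁ ∧ᶠ x₃ ⟩)) ∷ []) (κ 1) x₁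

        close : P ⊆ hull → ∃ λ z → z ∈ S ∩ e y × z ∈ Far v
        close P⊆ = let z , z∈ = #-inhabited outside in found P⊆ (∈∩ˡ z∈) (∈∩ʳ z∈)

        with-core : ∃ λ z → z ∈ S ∩ e y × z ∈ Far v
        with-core with some? (P ∖ hull)
        ... | inj₁ (u , p) = ⊥-elim (escape (∈∖ˡ p) (λ a → ∈∖ʳ p (shared (∈∖ˡ p) a)) λ s j q → ≤-pred (≰⇒> λ l → ∈∖ʳ p (⊆hull j s l q)))
        ... | inj₂ all = close λ {x} p → inside p (x ∈? hull)
          where
          inside : ∀ {x} → x ∈ P → Dec (x ∈ hull) → x ∈ hull
          inside p (yes q) = q
          inside p (no q)  = ⊥-elim (all (∈∖ p q))

      opaque
        common-far : ∃ λ z → z ∈ S ∩ e y × z ∈ Far v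
        common-far = choose (core? bound₇)
          where
          choose : Core 7 L ⊎ NoInd 7 L → ∃ λ z → z ∈ S ∩ e y × z ∈ Far v
          choose (inj₁ c) = with-core c
          choose (inj₂ h) = ⊥-elim (none h)

    open Common using (common-far) public

    module _ {v : Fin n} (v∈ : v ∈ S) (d6 : # (S ∩ e v) ≤ 6) where

      -- By `common-far` there would be no 4-cycle through `v`, and `expansion` would require 5 · 6
      -- + 6 + 1 = 37 vertices.
      far-exists : (∀ {z} → z ∉ Far v) → ⊥
      far-exists none = absurd (# (S ∩ e v) ∷ # S ∷ [])
        ((x₀ ⊕ (x₀ ⊕ (x₀ ⊕ (x₀ ⊕ (x₀ ⊕ κ 0)))) ⊕ x₀ ⊕ κ 1 ≲ x₁ by expansion {d = 5} tf v∈ deg≥6 few)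
        ∷ (κ 6 ≲ x₀ by deg≥6 v∈) ∷ (κ 6 ≲ x₀ by deg≥6 v∈) ∷ (κ 6 ≲ x₀ by deg≥6 v∈) ∷ (κ 6 ≲ x₀ by deg≥6 v∈) ∷ (κ 6 ≲ x₀ by deg≥6 v∈)
        ∷ (x₁ ≲ κ 25 by l) ∷ [])
        where
        few : ∀ {y} → y ∈ S → y ∉ e v → v ≢ y → # (S ∩ e v ∩ e y) ≤ 1
        few p q d = ≤-pred (≰⇒> λ h → let z , _ , z∈ = common-far v∈ p q d d6 h in none z∈)

      opaque
        some-far : ∃ λ z → z ∈ Far v
        some-far with some? (Far v)
        ... | inj₁ p    = p
        ... | inj₂ none = ⊥-elim (far-exists none)

  -- Five cliques: a single vertex at distance at least 3

  module Unique {S : VS n} (tf : TF S) (l : # S ≤ 25) (nb : ¬ Br 7 5 S) (full-S : 25 ≤ # S)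
                {v z : Fin n} (v∈ : v ∈ S) (z∈ : z ∈ Distance.Far tf l nb v) (only : ∀ {x} → x ∈ Distance.Far tf l nb v → z ≡ x) where
    open Five₅ tf l nb
    open Distance tf l nb

    v∈Far : v ∈ Far z
    v∈Far = far-sym z∈ v∈

    zS : z ∈ S
    zS = far-S z∈

    O = S ∖ e v ∖ ｛ v ｝ ∖ e z ∖ ｛ z ｝

    O⊆S : O ⊆ S
    O⊆S p = ∈∖ˡ (∈∖ˡ (∈∖ˡ (∈∖ˡ p)))

    O∉v : ∀ {o} → o ∈ O → o ∉ e v
    O∉v p = ∈∖ʳ (∈∖ˡ (∈∖ˡ (∈∖ˡ p)))

    O∉z : ∀ {o} → o ∈ O → o ∉ e z
    O∉z p = ∈∖ʳ (∈∖ˡ p)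

    O≢v : ∀ {o} → o ∈ O → v ≢ o
    O≢v p = ∖≢ (∈∖ˡ (∈∖ˡ p))

    sizeO≥ : 11 ≤ # O
    sizeO≥ = lin (# O ∷ # S ∷ # (S ∩ e v) ∷ # ｛ v ｝ ∷ # (S ∩ e z) ∷ # ｛ z ｝ ∷ [])
      ((κ 25 ≲ x₁ by full-S) ∷ (x₂ ≲ κ 6 by far-deg z∈ v∈) ∷ (x₄ ≲ κ 6 by far-deg v∈Far zS)
      ∷ (x₃ ≲ κ 1 by ≤-reflexive (#｛｝ v)) ∷ (x₅ ≲ κ 1 by ≤-reflexive (#｛｝ z))
      ∷ (x₁ ≲ x₀ ⊕ x₂ ⊕ x₃ ⊕ x₄ ⊕ x₅ by count (S ∷ e v ∷ ｛ v ｝ ∷ e z ∷ ｛ z ｝ ∷ []) [] ⟨ x₀ ⟩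
          (⟨ x₀ ∖ᶠ x₁ ∖ᶠ x₂ ∖ᶠ x₃ ∖ᶠ x₄ ⟩ ⊕ ⟨ x₀ ∧ᶠ x₁ ⟩ ⊕ ⟨ x₂ ⟩ ⊕ ⟨ x₀ ∧ᶠ x₃ ⟩ ⊕ ⟨ x₄ ⟩)) ∷ []) (κ 11) x₀

    sizeO≤ : # O ≤ 11
    sizeO≤ = lin (# O ∷ # S ∷ # (S ∩ e v) ∷ # ｛ v ｝ ∷ # (S ∩ e z) ∷ # ｛ z ｝ ∷ [])
      ((x₁ ≲ κ 25 by l) ∷ (κ 6 ≲ x₂ by deg≥6 v∈) ∷ (κ 6 ≲ x₄ by deg≥6 zS)
      ∷ (κ 1 ≲ x₃ by ≤-reflexive (sym (#｛｝ v))) ∷ (κ 1 ≲ x₅ by ≤-reflexive (sym (#｛｝ z)))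
      ∷ (x₀ ⊕ x₂ ⊕ x₃ ⊕ x₄ ⊕ x₅ ≲ x₁ by count (S ∷ e v ∷ ｛ v ｝ ∷ e z ∷ ｛ z ｝ ∷ [])
          ((x₂ ⊑ x₀ by ｛｝⊆ v∈) ∷ (x₄ ⊑ x₀ by ｛｝⊆ zS)
          ∷ (x₁ ∧ᶠ x₂ ⊑ ff by λ p → ⊥-elim (e≢ (∈∩ˡ p) (｛｝⁻ (∈∩ʳ p))))
          ∷ (x₃ ∧ᶠ x₄ ⊑ ff by λ p → ⊥-elim (e≢ (∈∩ˡ p) (｛｝⁻ (∈∩ʳ p))))
          ∷ (x₁ ∧ᶠ x₄ ⊑ ff by λ p → ⊥-elim (far-∉ z∈ (subst (_∈ e v) (sym (｛｝⁻ (∈∩ʳ p))) (∈∩ˡ p))))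
          ∷ (x₃ ∧ᶠ x₂ ⊑ ff by λ p → ⊥-elim (far-∉ v∈Far (subst (_∈ e z) (sym (｛｝⁻ (∈∩ʳ p))) (∈∩ˡ p))))
          ∷ (x₂ ∧ᶠ x₄ ⊑ ff by λ p → ⊥-elim (far-≢ z∈ (trans (｛｝⁻ (∈∩ˡ p)) (sym (｛｝⁻ (∈∩ʳ p))))))
          ∷ (x₀ ∧ᶠ x₁ ∧ᶠ x₃ ⊑ ff by λ p → ⊥-elim (far-apart z∈ (∈∩ˡ p) (∈∩ʳ p))) ∷ [])
          (⟨ x₀ ∖ᶠ x₁ ∖ᶠ x₂ ∖ᶠ x₃ ∖ᶠ x₄ ⟩ ⊕ ⟨ x₀ ∧ᶠ x₁ ⟩ ⊕ ⟨ x₂ ⟩ ⊕ ⟨ x₀ ∧ᶠ x₃ ⟩ ⊕ ⟨ x₄ ⟩) ⟨ x₀ ⟩) ∷ []) x₀ (κ 11)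

    opaque
      contact : ∀ {x} → x ∈ S → x ∉ e v → v ≢ x → z ≢ x → ∃ λ b → b ∈ S ∩ e v × b ∈ e x
      contact {x} p q d d′ with some? (S ∩ e v ∩ e x)
      ... | inj₁ (b , r) = b , ∈∩ˡ r , ∈∩ʳ r
      ... | inj₂ none    = ⊥-elim (d′ (only (far p q d λ r a → none (∈∩ r a))))

    -- With two contacts `o` has a neighbour far from `v`; this can only be `z`, which has no
    -- neighbour in `O`.
    contact-unique : ∀ {o b b′} → o ∈ O → b ∈ S ∩ e v → b′ ∈ S ∩ e v → b ≢ b′ → b ∈ e o → b′ ∈ e o → ⊥
    contact-unique {o} {b} p q q′ d a a′ =
      let x , x∈ , xF = common-far v∈ (O⊆S p) (O∉v p) (O≢v p) (far-deg z∈ v∈)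
            (≤-trans (s≤s (#-pos (∈∖ (∈∩ q′ a′) (d ∘ ｛｝⁻)))) (#-∖∈ (∈∩ q a)))
      in O∉z p (e⇄ (subst (_∈ e o) (sym (only xF)) (∈∩ʳ x∈)))

    -- `busy` leaves at most 9 vertices in `Y`, so a single `f` hits its independent 5-sets, and `f`
    -- is deleted along with its contact `b`.
    module At {u : Fin n} (u∈ : u ∈ S ∩ e v) (busy : 2 ≤ # (O ∩ e u)) {w : Fin n} (w∈ : w ∈ S ∩ e u ∩ e z) where
      open Rooted tf v∈ u∈

      uz : u ∉ e z
      uz = far-apart z∈ u∈

      v≢X : ∀ {x} → x ∈ X → v ≢ x
      v≢X p refl = ∈∖ʳ p (e⇄ (∈∩ʳ u∈))

      z∈X : z ∈ X
      z∈X = ∈∖ (∈∖ zS (far-∉ z∈)) (uz ∘ e⇄)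

      Y = O ∖ e u

      Y⊆X : Y ⊆ X
      Y⊆X p = ∈∖ (∈∖ (O⊆S (∈∖ˡ p)) (O∉v (∈∖ˡ p))) (∈∖ʳ p)

      bound-Y : Bound 5 Y
      bound-Y {J} s j = lin (# J ∷ # (J ∪ ｛ u ｝) ∷ # (J ∪ ｛ u ｝ ∪ ｛ z ｝) ∷ [])
        ((x₀ ⊕ κ 1 ≲ x₁ by #-∪｛｝ (λ p → u∉X (Y⊆X (s p))))
        ∷ (x₁ ⊕ κ 1 ≲ x₂ by #-∪｛｝ (λ p → [ (λ q → ∖≢ (∈∖ˡ (s q)) refl) , (λ q → u∉X (subst (_∈ X) (sym (｛｝⁻ q)) z∈X)) ]′ (∈∪⁻ p)))
        ∷ (x₂ ≲ κ 7 by α (Ind-∪｛｝ (Ind-∪｛｝ j λ p → ∈∖ʳ (s p)) λ p → [ (λ q → O∉z (∈∖ˡ (s q))) , (λ q a → uz (subst (_∈ e z) (sym (｛｝⁻ q)) a)) ]′ (∈∪⁻ p))) ∷ []) x₀ (κ 5)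

      sizeY≤ : # Y ≤ 9
      sizeY≤ = lin (# Y ∷ # O ∷ # (O ∩ e u) ∷ []) ((x₁ ≲ κ 11 by sizeO≤) ∷ (κ 2 ≲ x₂ by busy)
        ∷ (x₀ ⊕ x₂ ≲ x₁ by count (O ∷ e u ∷ []) [] (⟨ x₀ ∖ᶠ x₁ ⟩ ⊕ ⟨ x₀ ∧ᶠ x₁ ⟩) ⟨ x₀ ⟩) ∷ []) x₀ (κ 9)

      sizeY≥ : 1 ≤ # Y
      sizeY≥ = lin (# Y ∷ # O ∷ # (O ∩ e u) ∷ []) ((κ 11 ≲ x₁ by sizeO≥) ∷ (x₂ ≲ κ 7 by α (λ p q a → tf (∈∩ˡ u∈) (O⊆S (∈∩ˡ p)) (O⊆S (∈∩ˡ q)) (∈∩ʳ p) a (∈∩ʳ q)))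
        ∷ (x₁ ≲ x₀ ⊕ x₂ by count (O ∷ e u ∷ []) [] ⟨ x₀ ⟩ (⟨ x₀ ∖ᶠ x₁ ⟩ ⊕ ⟨ x₀ ∧ᶠ x₁ ⟩)) ∷ []) (κ 1) x₀

      module Deleting {f b : Fin n} (f∈ : f ∈ Y) (none : NoInd 5 (Y ∖ ｛ f ｝)) (b∈ : b ∈ S ∩ e v) (bf : b ∈ e f) where

        u≢b : u ≢ b
        u≢b refl = ∈∖ʳ f∈ (e⇄ bf)

        b∈U : b ∈ U
        b∈U = ∈∖ b∈ (u≢b ∘ ｛｝⁻)

        X′ = X ∖ ｛ z ｝ ∖ ｛ f ｝

        -- A 6-set through `z` is `z` with a 5-set of `Y`, and these are gone with `f`.
        reduce : ∀ {P} → f ∈ P → NoInd 6 (X ∖ ｛ z ｝ ∖ P) → NoInd 6 (X ∖ P)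
        reduce {P} f∈P h {J} s j large with z ∈? J
        ... | no q  = h (λ p → ∈∖ (∈∖ (∈∖ˡ (s p)) λ r → q (subst (_∈ J) (sym (｛｝⁻ r)) p)) (∈∖ʳ (s p))) j large
        ... | yes q = none (λ p → ∈∖ (in-Y (∈∖ˡ p) (∈∖ʳ p)) λ r → ∈∖ʳ (s (∈∖ˡ p)) (subst (_∈ P) (｛｝⁻ r) f∈P)) (Ind-⊆ ∈∖ˡ j) (≤-pred (≤-trans large #-∖｛｝))
          where
          in-Y : ∀ {x} → x ∈ J → x ∉ ｛ z ｝ → x ∈ Y
          in-Y p r = let p′ = ∈∖ˡ (s p) in ∈∖ (∈∖ (∈∖ (∈∖ (∈∖ˡ p′) (v≢X p′ ∘ ｛｝⁻)) (j q p)) r) (∈∖ʳ p′)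

        sizeU≤ : # U ≤ 5
        sizeU≤ = ≤-pred (≤-trans sizeU (far-deg z∈ v∈))

        sizeU∖ : # (U ∖ ｛ b ｝) ≤ 4
        sizeU∖ = ≤-pred (≤-trans (#-∖∈ b∈U) sizeU≤)

        none-left : NoInd 6 X′ → ⊥
        none-left h = nb (rooted (cov-kill bf (cov-base 3 (λ p → ∈∩ʳ (∈∖ˡ (∈∖ˡ p))) sizeU∖))
          (reduce (∈∪ʳ ∈｛｝) λ s → h λ p → ∈∖ (∈∖ˡ (s p)) (∈∖ʳ (s p) ∘ ∈∪ʳ)))

        module Second (c : Core 6 X′) where
          open Core c

          in-X : core ⊆ X
          in-X p = ∈∖ˡ (∈∖ˡ (core-X c p))

          second : ∀ {f′ b′} → f′ ∈ core → b′ ∈ U → b ≢ b′ → b′ ∉ e f′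
          second f′∈ b′∈ d a = nb (rooted (cov-kill bf (cov-kill a (cov-base 2 (λ p → ∈∩ʳ (∈∖ˡ (∈∖ˡ (∈∖ˡ p)))) (≤-pred (≤-trans (#-∖∈ (∈∖ b′∈ (d ∘ ｛｝⁻))) sizeU∖)))))
            (reduce (∈∪ʳ ∈｛｝) λ s j large →
              ∈∖ʳ (s (core⊆ j (λ p → ∈∖ (∈∖ˡ (s p)) (∈∖ʳ (s p) ∘ ∈∪ʳ)) large f′∈)) (∈∪ˡ (∈∪ʳ ∈｛｝))))

          only-b : ∀ {f′ x} → f′ ∈ core → x ∈ S ∩ e v → x ∈ e f′ → b ≡ x
          only-b {f′} {x} p q a with b ≟ x
          ... | yes r = r
          ... | no  d = ⊥-elim (second p (∈∖ q λ r → ∈∖ʳ (in-X p) (subst (λ t → f′ ∈ e t) (sym (｛｝⁻ r)) (e⇄ a))) d a)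

          b-core : ∀ {f′} → f′ ∈ core → b ∈ e f′
          b-core {f′} p = let x , x∈ , a = contact (X⊆S (in-X p)) (∈∖ʳ (∈∖ˡ (in-X p))) (v≢X (in-X p)) (∖≢ (∈∖ˡ (core-X c p)))
                     in subst (_∈ e f′) (sym (only-b p x∈ a)) a

          f-core : ∀ {f′} → f′ ∈ core → f′ ∉ e f
          f-core p a = tf (∈∩ˡ b∈) (X⊆S (Y⊆X f∈)) (X⊆S (in-X p)) (e⇄ bf) a (e⇄ (b-core p))

          -- `b` is the only contact of `f` and of the core vertices, so `f` can replace it and no
          -- edge leads to the core.
          I = (S ∩ e v) ∖ ｛ b ｝ ∪ ｛ f ｝

          I-ind : Ind I
          I-ind = Ind-∪｛｝ (Ind-⊆ ∈∖ˡ (nbr-ind tf v∈)) λ p a → contact-unique (∈∖ˡ f∈) b∈ (∈∖ˡ p) (∖≢ p) bf a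

          sizeI : # I + # core ≤ 7
          sizeI = ≤-trans (count (I ∷ core ∷ []) ((x₀ ∧ᶠ x₁ ⊑ ff by λ p → ⊥-elim ([ (λ q → ∈∖ʳ (∈∖ˡ (in-X (∈∩ʳ p))) (∈∩ʳ (∈∖ˡ q))) , ∈∖ʳ (core-X c (∈∩ʳ p)) ]′ (∈∪⁻ (∈∩ˡ p)))) ∷ [])
              (⟨ x₀ ⟩ ⊕ ⟨ x₁ ⟩) ⟨ x₀ ∨ᶠ x₁ ⟩)
            (α (Ind-∪ I-ind (core-ind c) λ {x} p q a → [ (λ r → ∈∖ʳ r (subst (x ∈_) (cong ｛_｝ (sym (only-b q (∈∖ˡ r) (e⇄ a)))) ∈｛｝)) , (λ r → f-core q (subst (λ t → _ ∈ e t) (sym (｛｝⁻ r)) a)) ]′ (∈∪⁻ p)))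

          few : # core ≤ 1
          few = lin (# I ∷ # core ∷ # ((S ∩ e v) ∖ ｛ b ｝) ∷ # (S ∩ e v) ∷ [])
            ((x₀ ⊕ x₁ ≲ κ 7 by sizeI) ∷ (x₂ ⊕ κ 1 ≲ x₀ by #-∪｛｝ (λ p → O∉v (∈∖ˡ f∈) (∈∩ʳ (∈∖ˡ p)))) ∷ (x₃ ≲ κ 1 ⊕ x₂ by #-∖｛｝) ∷ (κ 6 ≲ x₃ by deg≥6 v∈) ∷ []) x₁ (κ 1)

          sizeX′ : # X′ + 2 ≤ # X
          sizeX′ = lin (# X′ ∷ # (X ∖ ｛ z ｝) ∷ # X ∷ [])
            ((κ 1 ⊕ x₁ ≲ x₂ by #-∖∈ z∈X) ∷ (κ 1 ⊕ x₀ ≲ x₁ by #-∖∈ (∈∖ (Y⊆X f∈) (∈∖ʳ (∈∖ˡ f∈)))) ∷ []) (x₀ ⊕ κ 2) x₂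

          -- With `few` this forces a single core vertex without neighbours in `X′`, and degree 6
          -- for `u`.
          balance : # (N X′ core) + # (S ∩ e u) ≤ # core + 5
          balance = lin (# (N X′ core) ∷ # (S ∩ e u) ∷ # X′ ∷ # core ∷ # (S ∩ e v) ∷ # X ∷ # S ∷ [])
            ((κ 12 ⊕ x₀ ≲ x₃ ⊕ x₂ by core-N c) ∷ (x₂ ⊕ κ 2 ≲ x₅ by sizeX′) ∷ (x₅ ⊕ x₁ ⊕ x₄ ≲ x₆ by sizeX≤) ∷ (κ 6 ≲ x₄ by deg≥6 v∈) ∷ (x₆ ≲ κ 25 by l) ∷ [])
            (x₀ ⊕ x₁) (x₃ ⊕ κ 5)

          deg-u : # (S ∩ e u) ≤ 6
          deg-u = lin (# (N X′ core) ∷ # (S ∩ e u) ∷ # core ∷ []) ((x₀ ⊕ x₁ ≲ x₂ ⊕ κ 5 by balance) ∷ (x₂ ≲ κ 1 by few) ∷ []) x₁ (κ 6)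

          isolated : ∀ {x} → x ∉ N X′ core
          isolated p = absurd (# (N X′ core) ∷ # (S ∩ e u) ∷ # core ∷ [])
            ((x₀ ⊕ x₁ ≲ x₂ ⊕ κ 5 by balance) ∷ (x₂ ≲ κ 1 by few) ∷ (κ 6 ≲ x₁ by deg≥6 (∈∩ˡ u∈)) ∷ (κ 1 ≲ x₀ by #-pos p) ∷ [])

          some-core : 1 ≤ # core
          some-core = lin (# (N X′ core) ∷ # (S ∩ e u) ∷ # core ∷ [])
            ((x₀ ⊕ x₁ ≲ x₂ ⊕ κ 5 by balance) ∷ (κ 6 ≲ x₁ by deg≥6 (∈∩ˡ u∈)) ∷ []) (κ 1) x₂

          module _ {f′ : Fin n} (f′∈ : f′ ∈ core) where

            f′u : f′ ∉ e u
            f′u = ∈∖ʳ (in-X f′∈)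

            neighbours : ∀ {x} → x ∈ S ∩ e f′ → x ∈ S ∩ e u ∩ e f′ ∪ ｛ b ｝ ∪ ｛ z ｝
            neighbours {x} p with x ∈? e u | x ∈? e v | z ≟ x | f ≟ x
            ... | yes q | _     | _        | _        = ∈∪ˡ (∈∪ˡ (∈∩ (∈∩ (∈∩ˡ p) q) (∈∩ʳ p)))
            ... | no _  | yes q | _        | _        = ∈∪ˡ (∈∪ʳ (subst (_∈ ｛ b ｝) (only-b f′∈ (∈∩ (∈∩ˡ p) q) (∈∩ʳ p)) ∈｛｝))
            ... | no _  | no _  | yes refl | _        = ∈∪ʳ ∈｛｝
            ... | no _  | no _  | no _     | yes refl = ⊥-elim (f-core f′∈ (e⇄ (∈∩ʳ p)))
            ... | no q  | no q′ | no d     | no d′    = ⊥-elim (isolated (N-intro (∈∖ (∈∖ (∈∖ (∈∖ (∈∩ˡ p) q′) q) (d ∘ ｛｝⁻)) (d′ ∘ ｛｝⁻)) f′∈ (∈∩ʳ p)))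

            common : 2 ≤ # (S ∩ e u ∩ e f′)
            common = lin (# (S ∩ e f′) ∷ # (S ∩ e u ∩ e f′) ∷ # ｛ b ｝ ∷ # ｛ z ｝ ∷ [])
              ((κ 6 ≲ x₀ by deg≥6 (X⊆S (in-X f′∈))) ∷ (x₂ ≲ κ 1 by ≤-reflexive (#｛｝ b)) ∷ (x₃ ≲ κ 1 by ≤-reflexive (#｛｝ z))
              ∷ (x₀ ≲ x₁ ⊕ x₂ ⊕ x₃ by count (S ∩ e f′ ∷ S ∩ e u ∩ e f′ ∷ ｛ b ｝ ∷ ｛ z ｝ ∷ []) ((x₀ ⊑ x₁ ∨ᶠ x₂ ∨ᶠ x₃ by neighbours) ∷ []) ⟨ x₀ ⟩ (⟨ x₁ ⟩ ⊕ ⟨ x₂ ⟩ ⊕ ⟨ x₃ ⟩)) ∷ []) (κ 2) x₁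

            -- `v` is a common neighbour of `b` and `u`, and `w` one of `z` and `u`.
            not-far : ∀ {y} → y ∈ S ∩ e f′ → y ∉ Far u
            not-far {y} p q = [ [ (λ r → far-∉ q (∈∩ʳ (∈∩ˡ r)))
                                , (λ r → far-apart q (∈∩ v∈ (e⇄ (∈∩ʳ u∈))) (subst (λ t → v ∈ e t) (｛｝⁻ r) (e⇄ (∈∩ʳ b∈)))) ]′ ∘ ∈∪⁻
                              , (λ r → far-apart q (∈∩ˡ w∈) (subst (λ t → w ∈ e t) (｛｝⁻ r) (∈∩ʳ w∈))) ]′ (∈∪⁻ (neighbours p))

            clash : ⊥
            clash = let y , y∈ , yF = common-far (∈∩ˡ u∈) (X⊆S (in-X f′∈)) f′u (∉-resp′ f′∈) deg-u common in not-far y∈ yF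
              where
              ∉-resp′ : f′ ∈ core → u ≢ f′
              ∉-resp′ p refl = u∉X (in-X p)

          impossible : ⊥
          impossible = let f′ , f′∈ = #-inhabited some-core in clash f′∈

        deleted : Core 6 X′ ⊎ NoInd 6 X′ → ⊥
        deleted (inj₁ c) = Second.impossible c
        deleted (inj₂ h) = none-left h

      delete : ∀ {f} → f ∈ Y → NoInd 5 (Y ∖ ｛ f ｝) → ⊥
      delete f∈ none =
        let b , b∈ , bf = contact (O⊆S (∈∖ˡ f∈)) (O∉v (∈∖ˡ f∈)) (O≢v (∈∖ˡ f∈)) (∖≢ (∈∖ˡ f∈))
        in Deleting.deleted f∈ none b∈ bf (core? (Bound-⊆ (λ p → ∈∖ˡ (∈∖ˡ p)) bound₆))

      start-Y : Core 5 Y ⊎ NoInd 5 Y → ⊥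
      start-Y (inj₂ none) = let f , f∈ = #-inhabited sizeY≥ in delete f∈ λ s → none λ p → ∈∖ˡ (s p)
      start-Y (inj₁ c) =
        let f , f∈ = #-inhabited {A = Core.core c} (lin (# (Core.core c) ∷ # Y ∷ # (N Y (Core.core c)) ∷ [])
              ((κ 10 ⊕ x₂ ≲ x₀ ⊕ x₁ by core-N c) ∷ (x₁ ≲ κ 9 by sizeY≤) ∷ []) (κ 1) x₀)
        in delete (core-X c f∈) λ s j large → ∈∖ʳ (s (Core.core⊆ c j (λ p → ∈∖ˡ (s p)) large f∈)) ∈｛｝

      busy-impossible : ⊥
      busy-impossible = start-Y (core? bound-Y)

    idle : ∀ {u} → u ∈ S ∩ e v → (∃ λ w → w ∈ S ∩ e u ∩ e z) → # (O ∩ e u) ≤ 1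
    idle u∈ (w , w∈) = ≤-pred (≰⇒> λ h → At.busy-impossible u∈ h w∈)

    N₀ = S ∩ e v ∖ N S (S ∩ e z)

    touches : ∀ {u} → u ∈ S ∩ e v → u ∉ N₀ → ∃ λ w → w ∈ S ∩ e u ∩ e z
    touches {u} p q with some? (S ∩ e u ∩ e z)
    ... | inj₁ r    = r
    ... | inj₂ none = ⊥-elim (q (∈∖ p λ r → let _ , w , w∈ , a = N-elim r in none (∈∩ (∈∩ (∈∩ˡ w∈) (e⇄ a)) (∈∩ʳ w∈))))

    N₀-far : ∀ {u} → u ∈ N₀ → u ∈ Far z
    N₀-far p = far (∈∩ˡ (∈∖ˡ p)) (far-apart z∈ (∈∖ˡ p)) (λ r → far-∉ z∈ (subst (_∈ e v) (sym r) (∈∩ʳ (∈∖ˡ p))))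
      λ q a → ∈∖ʳ p (N-intro (∈∩ˡ (∈∖ˡ p)) q (e⇄ a))

    spread : ∀ (A Y : VS n) → A ⊆ O → Y ⊆ S ∩ e v → (∀ {o} → o ∈ A → 1 ≤ # (Y ∩ e o)) → (∀ {y} → y ∈ Y → y ∉ N₀) → # A ≤ # Y
    spread A Y A⊆ Y⊆ low h = lin (# A ∷ # Y ∷ []) ((x₀ ⊕ κ 0 ≲ x₁ ⊕ κ 0 by double-count A Y low
      λ p → ≤-trans (#-mono λ q → ∈∩ (A⊆ (∈∩ˡ q)) (∈∩ʳ q)) (idle (Y⊆ p) (touches (Y⊆ p) (h p)))) ∷ []) x₀ x₁

    contact-O : ∀ {o} → o ∈ O → ∃ λ b → b ∈ S ∩ e v × b ∈ e o
    contact-O p = contact (O⊆S p) (O∉v p) (O≢v p) (∖≢ p)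

    -- All 11 vertices of `O` have a contact in N(v), and by `idle` a contact outside `N₀` serves
    -- only one of them. `N₀` has at most one vertex `u`, since two would be adjacent; then at most
    -- 5 vertices of `O` are neighbours of `u` and at most 5 are served by the others.
    unique-far : ⊥
    unique-far with some? N₀
    ... | inj₂ none = absurd (# O ∷ # (S ∩ e v) ∷ [])
      ((κ 11 ≲ x₀ by sizeO≥) ∷ (x₁ ≲ κ 6 by far-deg z∈ v∈)
      ∷ (x₀ ≲ x₁ by spread O (S ∩ e v) (λ p → p) (λ p → p) (λ p → let b , b∈ , a = contact-O p in #-pos (∈∩ b∈ a)) (λ _ → none)) ∷ [])
    ... | inj₁ (u , u∈) = absurd (# O ∷ # (O ∩ e u) ∷ # (O ∖ e u) ∷ # (S ∩ e v ∖ ｛ u ｝) ∷ # (S ∩ e v) ∷ # (S ∩ e u) ∷ [])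
      ((κ 11 ≲ x₀ by sizeO≥) ∷ (x₄ ≲ κ 6 by far-deg z∈ v∈)
      ∷ (x₀ ≲ x₁ ⊕ x₂ by count (O ∷ e u ∷ []) [] ⟨ x₀ ⟩ (⟨ x₀ ∧ᶠ x₁ ⟩ ⊕ ⟨ x₀ ∖ᶠ x₁ ⟩))
      ∷ (κ 1 ⊕ x₃ ≲ x₄ by #-∖∈ (∈∖ˡ u∈))
      ∷ (x₅ ≲ κ 6 by far-deg (far-sym (N₀-far u∈) zS) (∈∩ˡ (∈∖ˡ u∈)))
      ∷ (x₁ ⊕ κ 1 ≲ x₅ by ≤-trans (≤-trans (+-monoʳ-≤ _ (≤-reflexive (sym (#｛｝ v))))
          (count (O ∷ e u ∷ ｛ v ｝ ∷ []) ((x₀ ∧ᶠ x₂ ⊑ ff by λ p → ⊥-elim (O≢v (∈∩ˡ p) (｛｝⁻ (∈∩ʳ p)))) ∷ []) (⟨ x₀ ∧ᶠ x₁ ⟩ ⊕ ⟨ x₂ ⟩) ⟨ x₀ ∧ᶠ x₁ ∨ᶠ x₂ ⟩))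
          (#-mono (∪⊆ (λ p → ∈∩ (O⊆S (∈∩ˡ p)) (∈∩ʳ p)) (｛｝⊆ (∈∩ v∈ (e⇄ (∈∩ʳ (∈∖ˡ u∈))))))))
      ∷ (x₂ ≲ x₃ by spread (O ∖ e u) (S ∩ e v ∖ ｛ u ｝) ∈∖ˡ ∈∖ˡ
          (λ p → let b , b∈ , a = contact-O (∈∖ˡ p) in #-pos (∈∩ (∈∖ b∈ λ r → ∈∖ʳ p (subst (λ t → _ ∈ e t) (sym (｛｝⁻ r)) (e⇄ a))) a))
          (λ p q → nbr-ind tf v∈ (∈∖ˡ u∈) (∈∖ˡ p) (far-adj zS (N₀-far u∈) (N₀-far q) (∖≢ p)))) ∷ [])

  -- Five cliques: several vertices at distance at least 3

  module Twin {S : VS n} (tf : TF S) (l : # S ≤ 25) (nb : ¬ Br 7 5 S) {v z z′ u : Fin n} (v∈ : v ∈ S)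
              (z∈ : z ∈ Distance.Far tf l nb v) (z′∈ : z′ ∈ Distance.Far tf l nb v) (z≢z′ : z ≢ z′)
              (u∈F : u ∈ Distance.Far tf l nb z) (v≢u : v ≢ u) where
    open Five₅ tf l nb
    open Distance tf l nb

    zS : z ∈ S
    zS = far-S z∈
    z′S : z′ ∈ S
    z′S = far-S z′∈
    uS : u ∈ S
    uS = far-S u∈F
    v∈F : v ∈ Far z
    v∈F = far-sym z∈ v∈
    zz′ : z′ ∈ e z
    zz′ = far-adj v∈ z∈ z′∈ z≢z′
    uv : u ∈ e v
    uv = far-adj zS v∈F u∈F v≢u
    u∈ : u ∈ S ∩ e v
    u∈ = ∈∩ uS uv
    uz : u ∉ e z
    uz = far-∉ u∈F
    uz′ : u ∉ e z′
    uz′ = far-apart z′∈ u∈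
    deg-v : # (S ∩ e v) ≤ 6
    deg-v = far-deg z∈ v∈
    deg-z′ : # (S ∩ e z′) ≤ 6
    deg-z′ = far-deg (far-sym z′∈ v∈) z′S
    deg-u : # (S ∩ e u) ≤ 6
    deg-u = far-deg (far-sym u∈F zS) uS

    W = S ∩ e u ∩ e z′
    Nuz = S ∩ e u ∪ S ∩ e z′

    sizeW : # W ≤ 4
    sizeW = lin (# W ∷ # (N S (｛ u ｝ ∪ ｛ z′ ｝)) ∷ # Nuz ∷ # (S ∩ e u) ∷ # (S ∩ e z′) ∷ [])
      ((κ 8 ≲ x₁ by pair≥8 uS z′S (λ { refl → far-∉ z′∈ uv }) (uz′ ∘ e⇄)) ∷ (x₁ ≲ x₂ by #-mono N-pair)
      ∷ (x₂ ⊕ x₀ ≲ x₃ ⊕ x₄ by count (S ∷ e u ∷ e z′ ∷ []) [] (⟨ x₀ ∧ᶠ x₁ ∨ᶠ x₀ ∧ᶠ x₂ ⟩ ⊕ ⟨ x₀ ∧ᶠ x₁ ∧ᶠ x₂ ⟩) (⟨ x₀ ∧ᶠ x₁ ⟩ ⊕ ⟨ x₀ ∧ᶠ x₂ ⟩))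
      ∷ (x₃ ≲ κ 6 by deg-u) ∷ (x₄ ≲ κ 6 by deg-z′) ∷ []) x₀ (κ 4)

    Nuz∉v : ∀ {x} → x ∈ Nuz → x ∉ e v
    Nuz∉v p a = [ (λ q → nbr-ind tf v∈ u∈ (∈∩ (∈∩ˡ q) a) (∈∩ʳ q)) , (λ q → far-apart z′∈ (∈∩ (∈∩ˡ q) a) (∈∩ʳ q)) ]′ (∈∪⁻ p)

    Nuz∉z : ∀ {x} → x ∈ Nuz → x ∉ e z
    Nuz∉z p a = [ (λ q → far-apart u∈F (∈∩ (∈∩ˡ q) a) (∈∩ʳ q)) , (λ q → nbr-ind tf zS (∈∩ z′S zz′) (∈∩ (∈∩ˡ q) a) (∈∩ʳ q)) ]′ (∈∪⁻ p)

    W⊆Nuz : W ⊆ Nuz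
    W⊆Nuz p = ∈∪ˡ (∈∩ˡ p)

    Nuz∉W : ∀ {x w} → w ∈ W → x ∈ Nuz → x ∉ e w
    Nuz∉W w∈ p = [ nbr-ind tf uS (∈∩ˡ w∈) , nbr-ind tf z′S (∈∩ (∈∩ˡ (∈∩ˡ w∈)) (∈∩ʳ w∈)) ]′ (∈∪⁻ p)

    -- Three vertices of `W` give edges that delete `u`, `z′` and one vertex `p`; two more cliques
    -- empty N(u) and N(z′) except for `v` and `z`. A surviving set then contains `v` and `z`, and
    -- its rest lies in the tiny set `O`.
    module Dense (many : 3 ≤ # W) where

      O = S ∖ e v ∖ ｛ v ｝ ∖ e z ∖ ｛ z ｝ ∖ e u ∖ e z′

      sizeO : # O ≤ 5
      sizeO = lin (# O ∷ # S ∷ # W ∷ # (S ∩ e v) ∷ # (S ∩ e z) ∷ # (S ∩ e u) ∷ # (S ∩ e z′) ∷ [])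
        ((x₁ ≲ κ 25 by l) ∷ (x₂ ≲ κ 4 by sizeW) ∷ (κ 6 ≲ x₃ by deg≥6 v∈) ∷ (κ 6 ≲ x₄ by deg≥6 zS) ∷ (κ 6 ≲ x₅ by deg≥6 uS) ∷ (κ 6 ≲ x₆ by deg≥6 z′S)
        ∷ (x₀ ⊕ x₃ ⊕ x₄ ⊕ x₅ ⊕ x₆ ≲ x₁ ⊕ x₂ by count (O ∷ S ∷ e v ∷ e z ∷ e u ∷ e z′ ∷ [])
            ((x₀ ⊑ x₁ by λ p → ∈∖ˡ (∈∖ˡ (∈∖ˡ (∈∖ˡ (∈∖ˡ (∈∖ˡ p))))))
            ∷ (x₀ ∧ᶠ x₂ ⊑ ff by λ p → ⊥-elim (∈∖ʳ (∈∖ˡ (∈∖ˡ (∈∖ˡ (∈∖ˡ (∈∖ˡ (∈∩ˡ p)))))) (∈∩ʳ p)))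
            ∷ (x₀ ∧ᶠ x₃ ⊑ ff by λ p → ⊥-elim (∈∖ʳ (∈∖ˡ (∈∖ˡ (∈∖ˡ (∈∩ˡ p)))) (∈∩ʳ p)))
            ∷ (x₀ ∧ᶠ x₄ ⊑ ff by λ p → ⊥-elim (∈∖ʳ (∈∖ˡ (∈∩ˡ p)) (∈∩ʳ p)))
            ∷ (x₀ ∧ᶠ x₅ ⊑ ff by λ p → ⊥-elim (∈∖ʳ (∈∩ˡ p) (∈∩ʳ p)))
            ∷ (x₁ ∧ᶠ x₂ ∧ᶠ x₃ ⊑ ff by λ p → ⊥-elim (far-apart z∈ (∈∩ˡ p) (∈∩ʳ p)))
            ∷ (x₁ ∧ᶠ x₄ ∧ᶠ x₂ ⊑ ff by λ p → ⊥-elim (Nuz∉v (∈∪ˡ (∈∩ˡ p)) (∈∩ʳ p)))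
            ∷ (x₁ ∧ᶠ x₄ ∧ᶠ x₃ ⊑ ff by λ p → ⊥-elim (Nuz∉z (∈∪ˡ (∈∩ˡ p)) (∈∩ʳ p)))
            ∷ (x₁ ∧ᶠ x₅ ∧ᶠ x₂ ⊑ ff by λ p → ⊥-elim (Nuz∉v (∈∪ʳ (∈∩ˡ p)) (∈∩ʳ p)))
            ∷ (x₁ ∧ᶠ x₅ ∧ᶠ x₃ ⊑ ff by λ p → ⊥-elim (Nuz∉z (∈∪ʳ (∈∩ˡ p)) (∈∩ʳ p))) ∷ [])
            (⟨ x₀ ⟩ ⊕ ⟨ x₁ ∧ᶠ x₂ ⟩ ⊕ ⟨ x₁ ∧ᶠ x₃ ⟩ ⊕ ⟨ x₁ ∧ᶠ x₄ ⟩ ⊕ ⟨ x₁ ∧ᶠ x₅ ⟩) (⟨ x₁ ⟩ ⊕ ⟨ x₁ ∧ᶠ x₄ ∧ᶠ x₅ ⟩)) ∷ []) x₀ (κ 5)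

      module Three {w₁ w₂ w₃ p : Fin n} (w₁∈ : w₁ ∈ W) (w₂∈ : w₂ ∈ W) (w₃∈ : w₃ ∈ W) (d₁₂ : w₁ ≢ w₂) (d₃₁ : w₃ ≢ w₁) (d₃₂ : w₃ ≢ w₂)
                   (p∈ : p ∈ e w₃) (none : NoInd 5 (O ∖ ｛ p ｝)) where

        Z = ｛ w₃ ｝ ∪ ｛ w₁ ｝ ∪ ｛ w₂ ｝ ∪ ｛ v ｝ ∪ ｛ z ｝
        L = (S ∩ e u) ∖ Z ∪ (S ∩ e z′) ∖ Z

        L⊆ : L ⊆ Nuz
        L⊆ q = [ (λ r → ∈∪ˡ (∈∖ˡ r)) , (λ r → ∈∪ʳ (∈∖ˡ r)) ]′ (∈∪⁻ q)

        notZ : ∀ {x} → x ∈ L → x ∉ Z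
        notZ q = [ ∈∖ʳ , ∈∖ʳ ]′ (∈∪⁻ q)

        -- Five vertices, namely `w₁`, `w₂`, `w₃`, `v` and `z`, can be added to an independent set
        -- of `L`.
        bound₂ : Bound 2 L
        bound₂ {J} s j = lin (# J ∷ # J₃ ∷ # J₁ ∷ # J₂ ∷ # Jv ∷ # (Jv ∪ ｛ z ｝) ∷ [])
          ((x₀ ⊕ κ 1 ≲ x₁ by #-∪｛｝ λ q → notZ (s q) (∈∪ˡ (∈∪ˡ (∈∪ˡ (∈∪ˡ ∈｛｝)))))
          ∷ (x₁ ⊕ κ 1 ≲ x₂ by #-∪｛｝ λ q → [ (λ r → notZ (s r) (∈∪ˡ (∈∪ˡ (∈∪ˡ (∈∪ʳ ∈｛｝))))) , d₃₁ ∘ ｛｝⁻ ]′ (∈∪⁻ q))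
          ∷ (x₂ ⊕ κ 1 ≲ x₃ by #-∪｛｝ λ q → [ [ (λ r → notZ (s r) (∈∪ˡ (∈∪ˡ (∈∪ʳ ∈｛｝)))) , d₃₂ ∘ ｛｝⁻ ]′ ∘ ∈∪⁻ , d₁₂ ∘ ｛｝⁻ ]′ (∈∪⁻ q))
          ∷ (x₃ ⊕ κ 1 ≲ x₄ by #-∪｛｝ λ q → [ [ [ (λ r → notZ (s r) (∈∪ˡ (∈∪ʳ ∈｛｝))) , ≢v w₃∈ ]′ ∘ ∈∪⁻ , ≢v w₁∈ ]′ ∘ ∈∪⁻ , ≢v w₂∈ ]′ (∈∪⁻ q))
          ∷ (x₄ ⊕ κ 1 ≲ x₅ by #-∪｛｝ λ q → [ [ [ [ (λ r → notZ (s r) (∈∪ʳ ∈｛｝)) , ≢z w₃∈ ]′ ∘ ∈∪⁻ , ≢z w₁∈ ]′ ∘ ∈∪⁻ , ≢z w₂∈ ]′ ∘ ∈∪⁻ , (λ r → far-≢ z∈ (｛｝⁻ r)) ]′ (∈∪⁻ q))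
          ∷ (x₅ ≲ κ 7 by α (Ind-∪｛｝ (Ind-∪｛｝ i₂ λ q → Nuz∉v (in₂ q)) λ q → [ (λ r → Nuz∉z (in₂ r)) , (λ r a → far-∉ v∈F (subst (_∈ e z) (sym (｛｝⁻ r)) a)) ]′ (∈∪⁻ q))) ∷ []) x₀ (κ 2)
          where
          J₃ = J ∪ ｛ w₃ ｝
          J₁ = J₃ ∪ ｛ w₁ ｝
          J₂ = J₁ ∪ ｛ w₂ ｝
          Jv = J₂ ∪ ｛ v ｝
          ≢v : ∀ {w} → w ∈ W → v ∉ ｛ w ｝
          ≢v q r = far-∉ (far-sym z′∈ v∈) (subst (_∈ e z′) (｛｝⁻ r) (∈∩ʳ q))
          ≢z : ∀ {w} → w ∈ W → z ∉ ｛ w ｝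
          ≢z q r = uz (e⇄ (subst (_∈ e u) (｛｝⁻ r) (∈∩ʳ (∈∩ˡ q))))
          in₃ : J₃ ⊆ Nuz
          in₃ = ∪⊆ (λ q → L⊆ (s q)) (｛｝⊆ (W⊆Nuz w₃∈))
          in₁ : J₁ ⊆ Nuz
          in₁ = ∪⊆ in₃ (｛｝⊆ (W⊆Nuz w₁∈))
          in₂ : J₂ ⊆ Nuz
          in₂ = ∪⊆ in₁ (｛｝⊆ (W⊆Nuz w₂∈))
          i₂ : Ind J₂
          i₂ = Ind-∪｛｝ (Ind-∪｛｝ (Ind-∪｛｝ j λ q → Nuz∉W w₃∈ (L⊆ (s q))) λ q → Nuz∉W w₁∈ (in₃ q)) λ q → Nuz∉W w₂∈ (in₁ q)

        module _ {J : VS n} (s : J ⊆ S ∖ edge w₃ p ∖ edge w₁ u ∖ edge w₂ z′ ∖ L) (j : Ind J) (large : 7 ≤ # J) where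

          inS : J ⊆ S
          inS q = ∈∖ˡ (∈∖ˡ (∈∖ˡ (∈∖ˡ (s q))))

          left : ∀ {x} → x ∈ J → x ∈ Nuz → x ∈ ｛ v ｝ ∪ ｛ z ｝
          left {x} q r with x ∈? Z
          ... | no h  = ⊥-elim (∈∖ʳ (s q) ([ (λ t → ∈∪ˡ (∈∖ t h)) , (λ t → ∈∪ʳ (∈∖ t h)) ]′ (∈∪⁻ r)))
          ... | yes h = [ [ [ [ (λ t → ⊥-elim (∈∖ʳ (∈∖ˡ (∈∖ˡ (∈∖ˡ (s q)))) (∈∪ˡ t))) , (λ t → ⊥-elim (∈∖ʳ (∈∖ˡ (∈∖ˡ (s q))) (∈∪ˡ t))) ]′ ∘ ∈∪⁻
                            , (λ t → ⊥-elim (∈∖ʳ (∈∖ˡ (s q)) (∈∪ˡ t))) ]′ ∘ ∈∪⁻ , ∈∪ˡ ]′ ∘ ∈∪⁻ , ∈∪ʳ ]′ (∈∪⁻ h)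

          v∈J : v ∈ J
          v∈J with v ∈? J
          ... | yes q = q
          ... | no  q = ⊥-elim (dominated j (λ r → ∈∖ʳ (∈∖ˡ (∈∖ˡ (s r))) (∈∪ʳ ∈｛｝)) (λ r a →
                [ (λ t → q (subst (_∈ J) (sym (｛｝⁻ t)) r)) , (λ t → uz (e⇄ (subst (_∈ e u) (sym (｛｝⁻ t)) a))) ]′ (∈∪⁻ (left r (∈∪ˡ (∈∩ (inS r) a))))) large)

          z∈J : z ∈ J
          z∈J with z ∈? J
          ... | yes q = q
          ... | no  q = ⊥-elim (dominated j (λ r → ∈∖ʳ (∈∖ˡ (s r)) (∈∪ʳ ∈｛｝)) (λ r a →
                [ (λ t → far-∉ (far-sym z′∈ v∈) (subst (_∈ e z′) (sym (｛｝⁻ t)) a)) , (λ t → q (subst (_∈ J) (sym (｛｝⁻ t)) r)) ]′ (∈∪⁻ (left r (∈∪ʳ (∈∩ (inS r) a))))) large)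

          trapped : J ∖ ｛ v ｝ ∖ ｛ z ｝ ⊆ O ∖ ｛ p ｝
          trapped q = let r = ∈∖ˡ (∈∖ˡ q) ; out = λ t → [ ∈∖ʳ (∈∖ˡ q) , ∈∖ʳ q ]′ (∈∪⁻ (left r t)) in
            ∈∖ (∈∖ (∈∖ (∈∖ (∈∖ (∈∖ (∈∖ (inS r) (j v∈J r)) (∈∖ʳ (∈∖ˡ q))) (j z∈J r)) (∈∖ʳ q)) (λ a → out (∈∪ˡ (∈∩ (inS r) a)))) (λ a → out (∈∪ʳ (∈∩ (inS r) a))))
              λ t → ∈∖ʳ (∈∖ˡ (∈∖ˡ (∈∖ˡ (s r)))) (∈∪ʳ t)

          three : ⊥
          three = none trapped (Ind-⊆ (λ q → ∈∖ˡ (∈∖ˡ q)) j) (≤-pred (≤-pred (≤-trans large (≤-trans #-∖｛｝ (s≤s #-∖｛｝)))))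

        broken : ⊥
        broken = könig 2 (Ind-⊆ ∈∖ˡ (nbr-ind tf uS)) (Ind-⊆ ∈∖ˡ (nbr-ind tf z′S)) bound₂ λ c →
          nb (edge w₃ p , Clique-edge p∈ , edge w₁ u , Clique-edge (e⇄ (∈∩ʳ (∈∩ˡ w₁∈))) , edge w₂ z′ , Clique-edge (e⇄ (∈∩ʳ w₂∈)) , Cov-Br₀ c three)

      with-edge : ∀ {w p} → w ∈ W → p ∈ e w → NoInd 5 (O ∖ ｛ p ｝) → ⊥
      with-edge {w} w∈ a none =
        let w₁ , w₂ , w₁∈ , w₂∈ , d = two {A = W ∖ ｛ w ｝} (≤-pred (≤-trans many #-∖｛｝))
        in Three.broken (∈∖ˡ w₁∈) (∈∖ˡ w₂∈) w∈ d (∖≢ w₁∈) (∖≢ w₂∈) a none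

      -- An independent 5-set fills `O`. Some vertex `p` of it has a neighbour in `W`, as otherwise
      -- 5 + 3 vertices would be independent.
      split : Core 5 O ⊎ NoInd 5 O → ⊥
      split (inj₂ none) = let w , w∈ = #-inhabited {A = W} (≤-trans (s≤s z≤n) many) in
        with-edge w∈ (e⇄ (∈∩ʳ (∈∩ˡ w∈))) λ s → none λ q → ∈∖ˡ (s q)
      split (inj₁ c) = let J , j , J⊆ , l5 = Core.some c in go j J⊆ l5 (some? (N J W))
        where
        go : ∀ {J} → Ind J → J ⊆ O → 5 ≤ # J → (∃ λ p → p ∈ N J W) ⊎ (∀ {p} → p ∉ N J W) → ⊥
        go j J⊆ l5 (inj₁ (p , q)) = let q′ , w , w∈ , a = N-elim q in
          with-edge w∈ a λ s _ large → 1+n≰n (≤-trans (≤-trans (s≤s (≤-trans large (#-mono s))) (#-∖∈ (J⊆ q′))) sizeO)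
        go {J} j J⊆ l5 (inj₂ none) = absurd (# J ∷ # W ∷ # (J ∪ W) ∷ [])
          ((κ 5 ≲ x₀ by l5) ∷ (κ 3 ≲ x₁ by many)
          ∷ (x₀ ⊕ x₁ ≲ x₂ by count (J ∷ W ∷ []) ((x₀ ∧ᶠ x₁ ⊑ ff by λ q → ⊥-elim (∈∖ʳ (J⊆ (∈∩ˡ q)) (∈∩ʳ (∈∩ʳ q)))) ∷ []) (⟨ x₀ ⟩ ⊕ ⟨ x₁ ⟩) ⟨ x₀ ∨ᶠ x₁ ⟩)
          ∷ (x₂ ≲ κ 7 by α (Ind-∪ j (Ind-⊆ ∈∩ˡ (nbr-ind tf uS)) λ q r a → none (N-intro q r (e⇄ a)))) ∷ [])

      dense : ⊥
      dense = split (core? λ s _ → ≤-trans (#-mono s) sizeO)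

    -- The 6-sets of `X` form three families: those through `z`, those through `z′`, and those in
    -- `X′`. Each is destroyed by one vertex, deleted along with a leaf of its own.
    module Sparse (few : # W ≤ 2) where
      open Rooted tf v∈ u∈

      v∉X : v ∉ X
      v∉X p = ∈∖ʳ p (e⇄ uv)

      z∈X : z ∈ X
      z∈X = ∈∖ (∈∖ zS (far-∉ z∈)) (uz ∘ e⇄)

      z′∈X : z′ ∈ X
      z′∈X = ∈∖ (∈∖ z′S (far-∉ z′∈)) (uz′ ∘ e⇄)

      sizeX : # X ≤ 13
      sizeX = lin (# X ∷ # (S ∩ e u) ∷ # (S ∩ e v) ∷ # S ∷ [])
        ((x₀ ⊕ x₁ ⊕ x₂ ≲ x₃ by sizeX≤) ∷ (x₃ ≲ κ 25 by l) ∷ (κ 6 ≲ x₁ by deg≥6 uS) ∷ (κ 6 ≲ x₂ by deg≥6 v∈) ∷ []) x₀ (κ 13)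

      sizeU≤5 : # U ≤ 5
      sizeU≤5 = ≤-pred (≤-trans sizeU deg-v)

      sizeU≥5 : 5 ≤ # U
      sizeU≥5 = ≤-pred (≤-trans (deg≥6 v∈) #-∖｛｝)

      Beside : Fin n → VS n
      Beside y = X ∖ e y ∖ ｛ y ｝

      bound-Beside : ∀ {y} → y ∈ X → Bound 5 (Beside y)
      bound-Beside {y} y∈ {J} s j = lin (# J ∷ # (J ∪ ｛ u ｝) ∷ # (J ∪ ｛ u ｝ ∪ ｛ y ｝) ∷ [])
        ((x₀ ⊕ κ 1 ≲ x₁ by #-∪｛｝ (λ p → u∉X (inX (s p))))
        ∷ (x₁ ⊕ κ 1 ≲ x₂ by #-∪｛｝ (λ p → [ (λ q → ∈∖ʳ (s q) ∈｛｝) , (λ q → u∉X (subst (_∈ X) (sym (｛｝⁻ q)) y∈)) ]′ (∈∪⁻ p)))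
        ∷ (x₂ ≲ κ 7 by α (Ind-∪｛｝ (with-u (λ p → inX (s p)) j) λ p → [ (λ q → ∈∖ʳ (∈∖ˡ (s q))) , (λ q a → ∈∖ʳ y∈ (e⇄ (subst (_∈ e y) (sym (｛｝⁻ q)) a))) ]′ (∈∪⁻ p))) ∷ []) x₀ (κ 5)
        where
        inX : Beside y ⊆ X
        inX p = ∈∖ˡ (∈∖ˡ p)

      sizeY : # (Beside z) ≤ 6
      sizeY = lin (# (Beside z) ∷ # X ∷ # (S ∩ e z) ∷ # ｛ z ｝ ∷ [])
        ((x₁ ≲ κ 13 by sizeX) ∷ (κ 6 ≲ x₂ by deg≥6 zS) ∷ (κ 1 ≲ x₃ by ≤-reflexive (sym (#｛｝ z)))
        ∷ (x₀ ⊕ x₂ ⊕ x₃ ≲ x₁ by count (X ∷ S ∷ e z ∷ ｛ z ｝ ∷ []) ((x₃ ⊑ x₀ by ｛｝⊆ z∈X)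
            ∷ (x₁ ∧ᶠ x₂ ⊑ x₀ by λ p → ∈∖ (∈∖ (∈∩ˡ p) (λ a → far-apart z∈ (∈∩ (∈∩ˡ p) a) (∈∩ʳ p))) (far-apart u∈F p))
            ∷ (x₂ ∧ᶠ x₃ ⊑ ff by λ p → ⊥-elim (e≢ (∈∩ˡ p) (｛｝⁻ (∈∩ʳ p)))) ∷ [])
            (⟨ x₀ ∖ᶠ x₂ ∖ᶠ x₃ ⟩ ⊕ ⟨ x₁ ∧ᶠ x₂ ⟩ ⊕ ⟨ x₃ ⟩) ⟨ x₀ ⟩) ∷ []) x₀ (κ 6)

      sizeY′ : # (Beside z′) ≤ 8
      sizeY′ = lin (# (Beside z′) ∷ # X ∷ # (S ∩ e z′) ∷ # ｛ z′ ｝ ∷ # W ∷ [])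
        ((x₁ ≲ κ 13 by sizeX) ∷ (κ 6 ≲ x₂ by deg≥6 z′S) ∷ (κ 1 ≲ x₃ by ≤-reflexive (sym (#｛｝ z′))) ∷ (x₄ ≲ κ 2 by few)
        ∷ (x₀ ⊕ x₂ ⊕ x₃ ≲ x₁ ⊕ x₄ by count (X ∷ S ∷ e z′ ∷ ｛ z′ ｝ ∷ e u ∷ []) ((x₃ ⊑ x₀ by ｛｝⊆ z′∈X)
            ∷ (x₁ ∧ᶠ x₂ ∖ᶠ x₄ ⊑ x₀ by λ p → ∈∖ (∈∖ (∈∩ˡ (∈∖ˡ p)) (λ a → far-apart z′∈ (∈∩ (∈∩ˡ (∈∖ˡ p)) a) (∈∩ʳ (∈∖ˡ p)))) (∈∖ʳ p))
            ∷ (x₂ ∧ᶠ x₃ ⊑ ff by λ p → ⊥-elim (e≢ (∈∩ˡ p) (｛｝⁻ (∈∩ʳ p)))) ∷ [])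
            (⟨ x₀ ∖ᶠ x₂ ∖ᶠ x₃ ⟩ ⊕ ⟨ x₁ ∧ᶠ x₂ ⟩ ⊕ ⟨ x₃ ⟩) (⟨ x₀ ⟩ ⊕ ⟨ x₁ ∧ᶠ x₄ ∧ᶠ x₂ ⟩)) ∷ []) x₀ (κ 8)

      X′ = X ∖ ｛ z ｝ ∖ ｛ z′ ｝

      sizeX′ : # X′ ≤ 11
      sizeX′ = ≤-pred (≤-pred (≤-trans (s≤s (#-∖∈ (∈∖ z′∈X (z≢z′ ∘ ｛｝⁻)))) (≤-trans (#-∖∈ z∈X) sizeX)))

      opaque
        contact : ∀ {x} → x ∈ X → z ≢ x → z′ ≢ x → ∃ λ b → b ∈ U × b ∈ e x
        contact {x} x∈ d d′ with some? (U ∩ e x)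
        ... | inj₁ (b , p) = b , ∈∩ˡ p , ∈∩ʳ p
        -- Without a contact `x` is far from `v`, hence adjacent to both `z` and `z′`, which closes
        -- a triangle.
        ... | inj₂ none    = ⊥-elim (tf zS z′S (X⊆S x∈) zz′ (far-adj v∈ z′∈ xF d′) (far-adj v∈ z∈ xF d))
          where
          xF : x ∈ Far v
          xF = far (X⊆S x∈) (∈∖ʳ (∈∖ˡ x∈)) (λ r → v∉X (subst (_∈ X) (sym r) x∈))
            λ p a → none (∈∩ (∈∖ p λ r → ∈∖ʳ x∈ (subst (λ t → x ∈ e t) (sym (｛｝⁻ r)) (e⇄ a))) a)

      contact′ : ∀ {x} → x ∈ X′ → ∃ λ b → b ∈ U × b ∈ e x
      contact′ p = contact (∈∖ˡ (∈∖ˡ p)) (∖≢ (∈∖ˡ p)) (∖≢ p)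

      -- A family of independent sets that is already empty is killed for free by the edge from v to its partner.
      v-edge : ∀ {a} → a ∈ U → a ∈ e v
      v-edge p = ∈∩ʳ (∈∖ˡ p)

      core-ind-with : ∀ {q Y A} (c : Core q Y) → Y ⊆ X → Ind A → (∀ {x} → x ∈ A → x ∉ X) → (∀ {x y} → x ∈ A → y ∈ Core.core c → y ∉ e x) → # A + # (Core.core c) ≤ 7
      core-ind-with {A = A} c s i d h = ≤-trans
        (count (A ∷ Core.core c ∷ []) ((x₀ ∧ᶠ x₁ ⊑ ff by λ p → ⊥-elim (d (∈∩ˡ p) (s (core-X c (∈∩ʳ p))))) ∷ []) (⟨ x₀ ⟩ ⊕ ⟨ x₁ ⟩) ⟨ x₀ ∨ᶠ x₁ ⟩)
        (α (Ind-∪ i (core-ind c) h))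

      module Killers {f g a b : Fin n} (a∈ : a ∈ U) (b∈ : b ∈ U) (a≢b : a ≢ b) (af : a ∈ e f) (bg : b ∈ e g)
                  (none′ : NoInd 5 (Beside z′ ∖ ｛ f ｝ ∖ ｛ g ｝)) (none : NoInd 6 (X′ ∖ ｛ f ｝ ∖ ｛ g ｝)) where

        U′ = U ∖ ｛ a ｝ ∖ ｛ b ｝

        sizeU′≤ : # U′ ≤ 3
        sizeU′≤ = ≤-pred (≤-pred (≤-trans (s≤s (#-∖∈ (∈∖ b∈ (a≢b ∘ ｛｝⁻)))) (≤-trans (#-∖∈ a∈) sizeU≤5)))

        sizeU′≥ : 3 ≤ # U′
        sizeU′≥ = ≤-pred (≤-pred (≤-trans sizeU≥5 (≤-trans #-∖｛｝ (s≤s #-∖｛｝))))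

        finish : ∀ {c h} → c ∈ U′ → c ∈ e h → NoInd 5 (Beside z ∖ ｛ f ｝ ∖ ｛ g ｝ ∖ ｛ h ｝) → ⊥
        finish {c} {h} c∈ ch none″ = nb (rooted
            (cov-kill af (cov-kill bg (cov-kill ch (cov-base 1 (λ p → v-edge (∈∖ˡ (∈∖ˡ (∈∖ˡ p)))) (≤-pred (≤-trans (#-∖∈ c∈) sizeU′≤)))))) free)
          where
          free : NoInd 6 (X ∖ (∅ ∪ ｛ h ｝ ∪ ｛ g ｝ ∪ ｛ f ｝))
          free {J} s j large = cases (z ∈? J) (z′ ∈? J)
            where
            F : ∀ {x} → x ∈ J → x ∉ ｛ f ｝
            F p q = ∈∖ʳ (s p) (∈∪ʳ q)
            G : ∀ {x} → x ∈ J → x ∉ ｛ g ｝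
            G p q = ∈∖ʳ (s p) (∈∪ˡ (∈∪ʳ q))
            H : ∀ {x} → x ∈ J → x ∉ ｛ h ｝
            H p q = ∈∖ʳ (s p) (∈∪ˡ (∈∪ˡ (∈∪ʳ q)))
            beside : ∀ {y} → y ∈ J → J ∖ ｛ y ｝ ⊆ Beside y
            beside q p = ∈∖ (∈∖ (∈∖ˡ (s (∈∖ˡ p))) (j q (∈∖ˡ p))) (∈∖ʳ p)
            cases : Dec (z ∈ J) → Dec (z′ ∈ J) → ⊥
            cases (yes q) _ = none″ (λ p → ∈∖ (∈∖ (∈∖ (beside q p) (F (∈∖ˡ p))) (G (∈∖ˡ p))) (H (∈∖ˡ p))) (Ind-⊆ ∈∖ˡ j) (≤-pred (≤-trans large #-∖｛｝))
            cases (no _)  (yes q) = none′ (λ p → ∈∖ (∈∖ (beside q p) (F (∈∖ˡ p))) (G (∈∖ˡ p))) (Ind-⊆ ∈∖ˡ j) (≤-pred (≤-trans large #-∖｛｝))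
            cases (no q)  (no q′) = none (λ p → ∈∖ (∈∖ (∈∖ (∈∖ (∈∖ˡ (s p)) (λ r → q (subst (_∈ J) (sym (｛｝⁻ r)) p))) (λ r → q′ (subst (_∈ J) (sym (｛｝⁻ r)) p))) (F p)) (G p)) j large

        I = (S ∩ e v) ∖ ｛ a ｝ ∖ ｛ b ｝

        Y = Beside z ∖ ｛ f ｝ ∖ ｛ g ｝

        -- At least 4 vertices of N(v) and at least 4 core vertices would be independent.
        stuck : (c : Core 5 Y) → (∀ {x} → x ∉ N U′ (Core.core c)) → ⊥
        stuck c h = absurd (# (S ∩ e v) ∷ # ((S ∩ e v) ∖ ｛ a ｝) ∷ # I ∷ # (Core.core c) ∷ # Y ∷ # (Beside z) ∷ # (N Y (Core.core c)) ∷ [])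
          ((κ 6 ≲ x₀ by deg≥6 v∈) ∷ (x₀ ≲ κ 1 ⊕ x₁ by #-∖｛｝) ∷ (x₁ ≲ κ 1 ⊕ x₂ by #-∖｛｝)
          ∷ (κ 10 ⊕ x₆ ≲ x₃ ⊕ x₄ by core-N c) ∷ (x₄ ≲ x₅ by #-mono (λ p → ∈∖ˡ (∈∖ˡ p))) ∷ (x₅ ≲ κ 6 by sizeY)
          ∷ (x₂ ⊕ x₃ ≲ κ 7 by core-ind-with c inX (Ind-⊆ (λ p → ∈∖ˡ (∈∖ˡ p)) (nbr-ind tf v∈)) (λ p q → ∈∖ʳ (∈∖ˡ q) (∈∩ʳ (∈∖ˡ (∈∖ˡ p)))) apart) ∷ [])
          where
          inX : Y ⊆ X
          inX p = ∈∖ˡ (∈∖ˡ (∈∖ˡ (∈∖ˡ p)))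
          apart : ∀ {x y} → x ∈ I → y ∈ Core.core c → y ∉ e x
          apart p q a = h (N-intro (∈∖ (∈∖ (∈∖ (∈∖ˡ (∈∖ˡ p)) λ r → ∈∖ʳ (inX (core-X c q)) (subst (λ t → _ ∈ e t) (sym (｛｝⁻ r)) a)) (∈∖ʳ (∈∖ˡ p))) (∈∖ʳ p)) q (e⇄ a))

        third : Core 5 Y ⊎ NoInd 5 Y → ⊥
        third (inj₂ h) = let c , c∈ = #-inhabited {A = U′} (≤-trans (s≤s z≤n) sizeU′≥) in
          finish c∈ (v-edge (∈∖ˡ (∈∖ˡ c∈))) λ s → h λ p → ∈∖ˡ (s p)
        third (inj₁ c) = [ (λ { (x , p) → go p }) , stuck c ]′ (some? (N U′ (Core.core c)))
          where
          go : ∀ {x} → x ∈ N U′ (Core.core c) → ⊥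
          go p = let q , y , y∈ , a = N-elim p in finish q a λ s j large → ∈∖ʳ (s (Core.core⊆ c j (λ r → ∈∖ˡ (s r)) large y∈)) ∈｛｝

        killed : ⊥
        killed = third (core? (Bound-⊆ (λ p → ∈∖ˡ (∈∖ˡ p)) (bound-Beside z∈X)))

      other : ∀ a → ∃ λ b → b ∈ U × a ≢ b
      other a = let b , b∈ = #-inhabited {A = U ∖ ｛ a ｝} (≤-pred (≤-trans (≤-trans (s≤s (s≤s z≤n)) sizeU≥5) #-∖｛｝)) in b , ∈∖ˡ b∈ , ∖≢ b∈

      only-second : NoInd 5 (Beside z′) → Core 6 X′ ⊎ NoInd 6 X′ → ⊥
      only-second none′ (inj₂ none) = let a , b , a∈ , b∈ , d = two {A = U} (≤-trans (s≤s (s≤s z≤n)) sizeU≥5) in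
        Killers.killed a∈ b∈ d (v-edge a∈) (v-edge b∈) (λ s → none′ λ p → ∈∖ˡ (∈∖ˡ (s p))) (λ s → none λ p → ∈∖ˡ (∈∖ˡ (s p)))
      only-second none′ (inj₁ c) =
        let g , g∈ = #-inhabited {A = Core.core c} (lin (# (Core.core c) ∷ # X′ ∷ # (N X′ (Core.core c)) ∷ [])
              ((κ 12 ⊕ x₂ ≲ x₀ ⊕ x₁ by core-N c) ∷ (x₁ ≲ κ 11 by sizeX′) ∷ []) (κ 1) x₀)
            b , b∈ , bg = contact′ (core-X c g∈)
            a , a∈ , d = other b
        in Killers.killed a∈ b∈ (d ∘ sym) (v-edge a∈) bg (λ s → none′ λ p → ∈∖ˡ (∈∖ˡ (s p)))
             λ s j large → ∈∖ʳ (s (Core.core⊆ c j (λ p → ∈∖ˡ (∈∖ˡ (s p))) large g∈)) ∈｛｝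

      -- The difficulty is to find different leaves for `f` and for a vertex hitting the 6-sets of
      -- `X′` that remain.
      module Both {f a : Fin n} (f∈ : f ∈ Beside z′) (none′ : NoInd 5 (Beside z′ ∖ ｛ f ｝)) (a∈ : a ∈ U) (af : a ∈ e f) where

        fX : f ∈ X
        fX = ∈∖ˡ (∈∖ˡ f∈)

        f∈X′ : f ∈ X′
        f∈X′ = ∈∖ (∈∖ fX λ p → ∈∖ʳ (∈∖ˡ f∈) (subst (_∈ e z′) (｛｝⁻ p) (e⇄ zz′))) (∈∖ʳ f∈)

        none-f : ∀ {g} → NoInd 5 (Beside z′ ∖ ｛ f ｝ ∖ ｛ g ｝)
        none-f s = none′ λ p → ∈∖ˡ (s p)

        module _ (c : Core 6 (X′ ∖ ｛ f ｝)) where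
          open Core c

          pair-with : ∀ {a b g} → a ∈ U → b ∈ U → a ≢ b → a ∈ e f → g ∈ core → b ∈ e g → ⊥
          pair-with a∈ b∈ d af g∈ bg = Killers.killed a∈ b∈ d af bg none-f λ s j large → ∈∖ʳ (s (core⊆ j (λ p → ∈∖ˡ (s p)) large g∈)) ∈｛｝

          size-core : 2 ≤ # core
          size-core = lin (# core ∷ # (X′ ∖ ｛ f ｝) ∷ # (N (X′ ∖ ｛ f ｝) core) ∷ # X′ ∷ [])
            ((κ 12 ⊕ x₂ ≲ x₀ ⊕ x₁ by core-N c) ∷ (κ 1 ⊕ x₁ ≲ x₃ by #-∖∈ f∈X′) ∷ (x₃ ≲ κ 11 by sizeX′) ∷ []) (κ 2) x₀

          core⊆X′ : core ⊆ X′
          core⊆X′ p = ∈∖ˡ (core-X c p)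

          module _ (none : ∀ {x} → x ∉ N (U ∖ ｛ a ｝) core) where

            only-a : ∀ {g b} → g ∈ core → b ∈ U → b ∈ e g → a ≡ b
            only-a {b = b} g∈ b∈ bg with a ≟ b
            ... | yes r = r
            ... | no  d = ⊥-elim (none (N-intro (∈∖ b∈ (d ∘ ｛｝⁻)) g∈ bg))

            a-core : ∀ {g} → g ∈ core → a ∈ e g
            a-core {g} g∈ = let b , b∈ , bg = contact′ (core⊆X′ g∈) in subst (_∈ e g) (sym (only-a g∈ b∈ bg)) bg

            -- If `a` is the only leaf for both, then `f` can replace it in N(v), and two core
            -- vertices make 8 independent vertices.
            alone : (∀ {x} → x ∉ (U ∖ ｛ a ｝) ∩ e f) → ⊥
            alone h = absurd (# (S ∩ e v) ∷ # ((S ∩ e v) ∖ ｛ a ｝) ∷ # I ∷ # core ∷ # (I ∪ core) ∷ [])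
              ((κ 6 ≲ x₀ by deg≥6 v∈) ∷ (x₀ ≲ κ 1 ⊕ x₁ by #-∖｛｝)
              ∷ (x₁ ⊕ κ 1 ≲ x₂ by #-∪｛｝ (λ p → ∈∖ʳ (∈∖ˡ fX) (∈∩ʳ (∈∖ˡ p))))
              ∷ (κ 2 ≲ x₃ by size-core)
              ∷ (x₂ ⊕ x₃ ≲ x₄ by count (I ∷ core ∷ []) ((x₀ ∧ᶠ x₁ ⊑ ff by λ p → ⊥-elim ([ (λ q → ∈∖ʳ (∈∖ˡ (inX (∈∩ʳ p))) (∈∩ʳ (∈∖ˡ q))) , ∈∖ʳ (core-X c (∈∩ʳ p)) ]′ (∈∪⁻ (∈∩ˡ p)))) ∷ []) (⟨ x₀ ⟩ ⊕ ⟨ x₁ ⟩) ⟨ x₀ ∨ᶠ x₁ ⟩)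
              ∷ (x₄ ≲ κ 7 by α (Ind-∪ I-ind (core-ind c) apart)) ∷ [])
              where
              I = (S ∩ e v) ∖ ｛ a ｝ ∪ ｛ f ｝
              inX : core ⊆ X
              inX p = ∈∖ˡ (∈∖ˡ (core⊆X′ p))
              in-U : ∀ {x y} → y ∈ X → x ∈ e y → x ∈ (S ∩ e v) ∖ ｛ a ｝ → x ∈ U ∖ ｛ a ｝
              in-U q h p = ∈∖ (∈∖ (∈∖ˡ p) λ r → ∈∖ʳ q (subst (λ t → _ ∈ e t) (sym (｛｝⁻ r)) (e⇄ h))) (∈∖ʳ p)
              I-ind : Ind I
              I-ind = Ind-∪｛｝ (Ind-⊆ ∈∖ˡ (nbr-ind tf v∈)) λ p h′ → h (∈∩ (in-U fX h′ p) h′)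
              apart : ∀ {x y} → x ∈ I → y ∈ core → y ∉ e x
              apart p q h′ = [ (λ r → none (N-intro (in-U (inX q) (e⇄ h′) r) q (e⇄ h′)))
                             , (λ r → tf (∈∩ˡ (∈∖ˡ a∈)) (X⊆S fX) (X⊆S (inX q)) (e⇄ af) (subst (λ t → _ ∈ e t) (sym (｛｝⁻ r)) h′) (e⇄ (a-core q))) ]′ (∈∪⁻ p)

            swap : (∃ λ x → x ∈ (U ∖ ｛ a ｝) ∩ e f) ⊎ (∀ {x} → x ∉ (U ∖ ｛ a ｝) ∩ e f) → ⊥
            swap (inj₂ h)       = alone h
            swap (inj₁ (x , p)) = let g , g∈ = #-inhabited {A = core} (≤-trans (s≤s z≤n) size-core) in
              pair-with (∈∖ˡ (∈∩ˡ p)) a∈ (∖≢ (∈∩ˡ p) ∘ sym) (∈∩ʳ p) g∈ (a-core g∈)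

          matched : (∃ λ x → x ∈ N (U ∖ ｛ a ｝) core) ⊎ (∀ {x} → x ∉ N (U ∖ ｛ a ｝) core) → ⊥
          matched (inj₂ none)    = swap none (some? _)
          matched (inj₁ (b , p)) = let q , g , g∈ , h = N-elim p in pair-with a∈ (∈∖ˡ q) (∖≢ q) af g∈ h

        both : Core 6 (X′ ∖ ｛ f ｝) ⊎ NoInd 6 (X′ ∖ ｛ f ｝) → ⊥
        both (inj₁ c)    = matched c (some? _)
        both (inj₂ none) = let b , b∈ , d = other a in Killers.killed a∈ b∈ d af (v-edge b∈) none-f λ s → none λ p → ∈∖ˡ (s p)

      bound-X′ : Bound 6 X′
      bound-X′ = Bound-⊆ (λ p → ∈∖ˡ (∈∖ˡ p)) bound₆

      first : Core 5 (Beside z′) ⊎ NoInd 5 (Beside z′) → ⊥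
      first (inj₂ none′) = only-second none′ (core? bound-X′)
      first (inj₁ c) =
        let f , f∈ = #-inhabited {A = Core.core c} (lin (# (Core.core c) ∷ # (Beside z′) ∷ # (N (Beside z′) (Core.core c)) ∷ [])
              ((κ 10 ⊕ x₂ ≲ x₀ ⊕ x₁ by core-N c) ∷ (x₁ ≲ κ 8 by sizeY′) ∷ []) (κ 1) x₀)
            f∈Y = core-X c f∈
            a , a∈ , af = contact (∈∖ˡ (∈∖ˡ f∈Y)) (λ r → ∈∖ʳ (∈∖ˡ f∈Y) (subst (_∈ e z′) r (e⇄ zz′))) (∖≢ f∈Y)
        in Both.both f∈Y (λ s j large → ∈∖ʳ (s (Core.core⊆ c j (λ p → ∈∖ˡ (s p)) large f∈)) ∈｛｝) a∈ af (core? (Bound-⊆ ∈∖ˡ bound-X′))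

      sparse : ⊥
      sparse = first (core? (bound-Beside z′∈X))

    twin : ⊥
    twin with 3 ≤? # W
    ... | yes h = Dense.dense h
    ... | no h  = Sparse.sparse (≤-pred (≰⇒> h))

  -- Five cliques: conclusion by parity

  module Five {S : VS n} (tf : TF S) (l : # S ≤ 25) (nb : ¬ Br 7 5 S) (full-S : 25 ≤ # S) where
    open Five₅ tf l nb
    open Distance tf l nb

    second-far : ∀ {v z} → v ∈ S → z ∈ Far v → ∃ λ z′ → z′ ∈ Far v × z ≢ z′
    second-far {v} {z} v∈ z∈ with some? (Far v ∖ ｛ z ｝)
    ... | inj₁ (z′ , p) = z′ , ∈∖ˡ p , ∖≢ p
    ... | inj₂ none     = ⊥-elim (Unique.unique-far tf l nb full-S v∈ z∈ λ p → only p (z ≟ _))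
      where
      only : ∀ {x} → x ∈ Far v → Dec (z ≡ x) → z ≡ x
      only p (yes r) = r
      only p (no d)  = ⊥-elim (none (∈∖ p (d ∘ ｛｝⁻)))

    deg≥7 : ∀ {v} → v ∈ S → 7 ≤ # (S ∩ e v)
    deg≥7 {v} v∈ = ≰⇒> λ d6 →
      let z , z∈ = some-far v∈ d6
          z′ , z′∈ , d = second-far v∈ z∈
          u , u∈ , d′ = second-far (far-S z∈) (far-sym z∈ v∈)
      in Twin.twin tf l nb v∈ z∈ z′∈ d u∈ d′

    -- 175 = 7 · 25 is the degree sum when all 25 vertices have degree 7.
    odd : ∀ h → 175 ≡ h + h → ⊥
    odd h eq with h ≤? 87
    ... | yes p = absurd (h ∷ []) ((x₀ ≲ κ 87 by p) ∷ (x₀ ≲ κ 87 by p) ∷ (κ 175 ≲ x₀ ⊕ x₀ by ≤-reflexive eq) ∷ [])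
    ... | no p  = absurd (h ∷ []) ((κ 88 ≲ x₀ by ≰⇒> p) ∷ (κ 88 ≲ x₀ by ≰⇒> p) ∷ (x₀ ⊕ x₀ ≲ κ 175 by ≤-reflexive (sym eq)) ∷ [])

    five : ⊥
    five = let h , eq = degree-sum-even S λ p → ≤-antisym (deg≤7 p) (deg≥7 p)
           in odd h (trans (cong (7 *_) (sym (≤-antisym l full-S))) eq)

  break₅ : Breakable 5 25
  -- Up to 24 = 22 + 2 vertices deleting an edge is enough, so there are exactly 25.
  break₅ l nb = Five.five (triangle-free break₄ l nb) l nb (≰⇒> λ h → from-edge break₄ h nb)

  -- Six and more cliques

  module Six {S : VS n} (tf : TF S) (l : # S ≤ 28) (nb : ¬ Br 7 6 S) where

    deg≥7 : ∀ {v} → v ∈ S → 7 ≤ # (S ∩ e v)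
    deg≥7 = degree≥ 5 bound₇ nb

    -- With six cliques the bound 6 in `pair-break` is free, as `u` itself can be added. If no `u`
    -- exists, {v, y} has at most 7 neighbours instead of 8.
    few : ∀ {v y} → v ∈ S → y ∈ S → y ∉ e v → v ≢ y → # (S ∩ e v ∩ e y) ≤ 1
    few {v} {y} v∈ y∈ y∉ d = ≤-pred (≰⇒> λ h → private-nbr h (some? (S ∩ e v ∖ e y)))
      where
      private-nbr : 2 ≤ # (S ∩ e v ∩ e y) → (∃ λ u → u ∈ S ∩ e v ∖ e y) ⊎ (∀ {u} → u ∉ S ∩ e v ∖ e y) → ⊥
      private-nbr h (inj₁ (u , p)) = pair-break tf v∈ y∈ h (∈∖ˡ p) (∈∖ʳ p)
        (λ {J} s j → +-cancelʳ-≤ 1 (# J) 6 (≤-trans (#-∪｛｝ λ q → ∈∖ʳ (s q) (∈∪ʳ ∈｛｝)) (α (Ind-∪｛｝ j λ q a → ∈∖ʳ (s q) (∈∪ˡ a))))) nb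
      private-nbr h (inj₂ none) = absurd (# (｛ v ｝ ∪ ｛ y ｝) ∷ # (N S (｛ v ｝ ∪ ｛ y ｝)) ∷ # (S ∩ e y) ∷ [])
        ((κ 2 ≲ x₀ by ≤-reflexive (sym (size-pair d)))
        ∷ (x₀ ⊕ κ 6 ≲ x₁ by surplus 5 bound₇ nb (∪⊆ (｛｝⊆ v∈) (｛｝⊆ y∈)) (Ind-pair y∉) (v , ∈∪ˡ ∈｛｝))
        ∷ (x₁ ≲ x₂ by #-mono λ p → [ (λ q → ∈∩ (∈∩ˡ q) (inside q)) , (λ q → q) ]′ (∈∪⁻ (N-pair p)))
        ∷ (x₂ ≲ κ 7 by α (nbr-ind tf y∈)) ∷ [])
        where
        inside : S ∩ e v ⊆ e y
        inside {x} p with x ∈? e y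
        ... | yes q = q
        ... | no  q = ⊥-elim (none (∈∖ p q))

    -- Without 4-cycles through `v`, at least 6 · 7 + 7 + 1 = 50 vertices are needed.
    six : ⊥
    six = let v , _ , v∈ , _ = has-edge 5 nb in
      absurd (# (S ∩ e v) ∷ # S ∷ [])
        ((x₀ ⊕ (x₀ ⊕ (x₀ ⊕ (x₀ ⊕ (x₀ ⊕ (x₀ ⊕ κ 0))))) ⊕ x₀ ⊕ κ 1 ≲ x₁ by expansion {d = 6} tf v∈ deg≥7 (few v∈))
        ∷ (κ 7 ≲ x₀ by deg≥7 v∈) ∷ (κ 7 ≲ x₀ by deg≥7 v∈) ∷ (κ 7 ≲ x₀ by deg≥7 v∈) ∷ (κ 7 ≲ x₀ by deg≥7 v∈) ∷ (κ 7 ≲ x₀ by deg≥7 v∈) ∷ (κ 7 ≲ x₀ by deg≥7 v∈)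
        ∷ (x₁ ≲ κ 28 by l) ∷ [])

  break₆ : Breakable 6 28
  break₆ l nb = Six.six (triangle-free break₅ l nb) l nb

  break : ∀ k → Breakable (6 + k) (28 + k * 3)
  break zero    l = break₆ l
  break (suc k) {S} l nb =
    let v , _ , v∈ , _ = has-edge (6 + k) nb
        tf = triangle-free (break k) (lin (# S ∷ k * 3 ∷ []) ((x₀ ≲ κ 28 ⊕ (κ 3 ⊕ x₁) by l) ∷ []) x₀ (κ 28 ⊕ x₁ ⊕ κ 3)) nb
    in absurd (# (S ∩ e v) ∷ k ∷ []) ((κ 8 ⊕ x₁ ≲ x₀ by degree≥ (6 + k) bound₇ nb v∈) ∷ (x₀ ≲ κ 7 by α (nbr-ind tf v∈)) ∷ [])

-- From broken sets to colourings

∑-∸ : ∀ {s} {f g : Fin s → ℕ} → (∀ i → g i ≤ f i) → ∑ (λ i → f i ∸ g i) + ∑ g ≡ ∑ f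
∑-∸ {f = f} {g} h = trans (sym (∑-+ (λ i → f i ∸ g i) g)) (∑-cong λ i → m∸n+n≡m (h i))

∑-pos : ∀ {s} (f : Fin s → ℕ) → 1 ≤ ∑ f → ∃ λ i → 1 ≤ f i
∑-pos {suc s} f h with f zero in eq
... | suc _ = zero , ≤-trans (s≤s z≤n) (≤-reflexive (sym eq))
... | zero  = let i , p = ∑-pos (f ∘ suc) h in suc i , p

∑-foldr : ∀ {s} (a : Fin s → ℕ) → Vector.foldr (λ x acc → (x ∸ 1) + acc) 0 a ≡ ∑ (λ i → a i ∸ 1)
∑-foldr {zero}  a = refl
∑-foldr {suc s} a = cong (a zero ∸ 1 +_) (∑-foldr (a ∘ suc))

image : ∀ {k n} → (Fin k → Fin n) → VS n
image {zero}  f = ∅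
image {suc k} f = image (f ∘ suc) ∪ ｛ f zero ｝

image⁻ : ∀ {k n} (f : Fin k → Fin n) {x} → x ∈ image f → ∃ λ i → f i ≡ x
image⁻ {zero}  f p = ⊥-elim (∉∅ p)
image⁻ {suc k} f p = [ (λ q → let i , r = image⁻ (f ∘ suc) q in suc i , r) , (λ q → zero , ｛｝⁻ q) ]′ (∈∪⁻ p)

#-image : ∀ {k n} (f : Fin k → Fin n) → (∀ i j → i ≢ j → f i ≢ f j) → k ≤ # (image f)
#-image {zero}  f inj = z≤n
#-image {suc k} f inj = ≤-trans (≤-trans (≤-reflexive (+-comm 1 k)) (+-monoˡ-≤ 1 (#-image (f ∘ suc) λ i j d → inj (suc i) (suc j) λ { refl → d refl })))
  (#-∪｛｝ λ p → let i , r = image⁻ (f ∘ suc) p in inj (suc i) zero (λ ()) r)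

enumerate : ∀ {n} k {A : VS n} → k ≤ # A → Σ (Fin k → Fin n) λ f → (∀ i → f i ∈ A) × (∀ i j → i ≢ j → f i ≢ f j)
enumerate zero    h = (λ ()) , (λ ()) , λ ()
enumerate {n} (suc k) {A} h =
  let x , x∈ = #-inhabited {A = A} (≤-trans (s≤s z≤n) h)
      f , f∈ , inj = enumerate k {A ∖ ｛ x ｝} (≤-pred (≤-trans h #-∖｛｝))
  in cons x f , (λ { zero → x∈ ; (suc i) → ∈∖ˡ (f∈ i) })
   , λ { zero zero d → ⊥-elim (d refl) ; zero (suc j) _ → ∖≢ (f∈ j) ; (suc i) zero _ → ∖≢ (f∈ i) ∘ sym ; (suc i) (suc j) d → inj i j (d ∘ cong suc) }
  where
  cons : Fin n → (Fin k → Fin n) → Fin (suc k) → Fin n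
  cons x f zero    = x
  cons x f (suc i) = f i

opaque
  unfolding #

  #≤n : ∀ {n} (A : VS n) → # A ≤ n
  #≤n {zero}  A = z≤n
  #≤n {suc n} A = +-mono-≤ (ι≤1 (A zero)) (#≤n (A ∘ suc))
    where
    ι≤1 : ∀ b → ι b ≤ 1
    ι≤1 true  = ≤-refl
    ι≤1 false = z≤n

  ∑-ι : ∀ {s} c (i : Fin s) → ∑ (λ j → c * ι (｛ i ｝ j)) ≡ c
  ∑-ι c i = trans (∑-* c (ι ∘ ｛ i ｝)) (trans (cong (c *_) (#｛｝ i)) (*-identityʳ c))

ι-∈ : ∀ {n} {A : VS n} {x} → x ∈ A → ι (A x) ≡ 1
ι-∈ (mem p) = cong ι p

ι-∉ : ∀ {n} {A : VS n} {x} → x ∉ A → ι (A x) ≡ 0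
ι-∉ {A = A} {x} p with A x in q
... | true  = ⊥-elim (p (mem q))
... | false = refl

ι-｛｝≤ : ∀ {s} {f : Fin s → ℕ} {c i} → c ≤ f i → ∀ j → c * ι (｛ i ｝ j) ≤ f j
ι-｛｝≤ {f = f} {c} {i} h j with j ∈? ｛ i ｝
... | yes p rewrite sym (｛｝⁻ p) = ≤-trans (≤-reflexive (trans (cong (c *_) (ι-∈ ∈｛｝)) (*-identityʳ c))) h
... | no p  = ≤-trans (≤-reflexive (trans (cong (c *_) (ι-∉ p)) (*-zeroʳ c))) z≤n

module Colour {n : ℕ} (e : Fin n → VS n) (e-sym : ∀ x y → e x y ≡ e y x) (e-irr : ∀ x → e x x ≡ false) {s : ℕ} (i₀ : Fin s) where
  open Graphs e e-sym e-irr

  Ind-Clique : ∀ {K Q} → Ind K → Clique Q → # (K ∩ Q) ≤ 1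
  Ind-Clique {K} {Q} i q = ≤-pred (≰⇒> λ h →
    let x , y , x∈ , y∈ , d = two {A = K ∩ Q} h in i (∈∩ˡ x∈) (∈∩ˡ y∈) (q (∈∩ʳ x∈) (∈∩ʳ y∈) d))

  -- Colour i is given to b i of the r cliques, and i₀ to the rest of S.
  colour : ∀ r {S} (b : Fin s → ℕ) → ∑ b ≡ r → Br 7 r S →
           Σ (Fin n → Fin s) λ c → ∀ {K j} → K ⊆ S → Ind K → (∀ {x} → x ∈ K → c x ≡ j) → # K ≤ b j + 6 * ι (｛ i₀ ｝ j)
  colour zero {S} b _ br = (λ _ → i₀) , λ {K} {j} s i h → bound s i h (some? K)
    where
    bound : ∀ {K j} → K ⊆ S → Ind K → (∀ {x} → x ∈ K → i₀ ≡ j) → (∃ λ x → x ∈ K) ⊎ (∀ {x} → x ∉ K) → # K ≤ b j + 6 * ι (｛ i₀ ｝ j)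
    bound s i h (inj₂ none) = ≤-trans (≤-reflexive (#∅ none)) z≤n
    bound {K} s i h (inj₁ (x , p)) with h p
    ... | refl = ≤-trans (≤-pred (≰⇒> (br s i))) (≤-trans (≤-reflexive (sym (cong (6 *_) (ι-∈ ∈｛｝)))) (m≤n+m _ (b i₀)))
  colour (suc r) {S} b sum (Q , q , br) = c , bound
    where
    chosen : ∃ λ i → 1 ≤ b i
    chosen = ∑-pos b (≤-trans (s≤s z≤n) (≤-reflexive (sym sum)))
    i = proj₁ chosen
    b′ : Fin s → ℕ
    b′ j = b j ∸ 1 * ι (｛ i ｝ j)
    paid : ∀ j → 1 * ι (｛ i ｝ j) ≤ b j
    paid = ι-｛｝≤ (proj₂ chosen)
    sum′ : ∑ b′ ≡ r
    sum′ = +-cancelʳ-≡ 1 _ r (trans (cong (∑ b′ +_) (sym (∑-ι 1 i))) (trans (∑-∸ paid) (trans sum (+-comm 1 r))))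
    rec = colour r b′ sum′ br
    c : Fin n → Fin s
    c x = if Q x then i else proj₁ rec x
    c-Q : ∀ {x} → x ∈ Q → c x ≡ i
    c-Q (mem p) rewrite p = refl
    c-rest : ∀ {x} → x ∉ Q → c x ≡ proj₁ rec x
    c-rest {x} p with Q x in eq
    ... | true  = ⊥-elim (p (mem eq))
    ... | false = refl
    inside : ∀ {K j} → Ind K → (∀ {x} → x ∈ K → c x ≡ j) → # (K ∩ Q) ≤ 1 * ι (｛ i ｝ j)
    inside {K} {j} k h with j ∈? ｛ i ｝
    ... | yes p = ≤-trans (Ind-Clique k q) (≤-reflexive (sym (cong (1 *_) (ι-∈ p))))
    ... | no p  = ≤-trans (≤-reflexive (#∅ λ r → p (subst (_∈ ｛ i ｝) (trans (sym (c-Q (∈∩ʳ r))) (h (∈∩ˡ r))) ∈｛｝))) z≤n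
    bound : ∀ {K j} → K ⊆ S → Ind K → (∀ {x} → x ∈ K → c x ≡ j) → # K ≤ b j + 6 * ι (｛ i₀ ｝ j)
    bound {K} {j} s k h = lin (# K ∷ # (K ∖ Q) ∷ # (K ∩ Q) ∷ b j ∷ b′ j ∷ 1 * ι (｛ i ｝ j) ∷ 6 * ι (｛ i₀ ｝ j) ∷ [])
      ((x₀ ≲ x₁ ⊕ x₂ by count (K ∷ Q ∷ []) [] ⟨ x₀ ⟩ (⟨ x₀ ∖ᶠ x₁ ⟩ ⊕ ⟨ x₀ ∧ᶠ x₁ ⟩))
      ∷ (x₁ ≲ x₄ ⊕ x₆ by proj₂ rec (λ p → ∈∖ (s (∈∖ˡ p)) (∈∖ʳ p)) (Ind-⊆ ∈∖ˡ k) λ p → trans (sym (c-rest (∈∖ʳ p))) (h (∈∖ˡ p)))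
      ∷ (x₂ ≲ x₅ by inside k h) ∷ (x₄ ⊕ x₅ ≲ x₃ by ≤-reflexive (m∸n+n≡m (paid j))) ∷ []) x₀ (x₃ ⊕ x₆)

module Complement {n : ℕ} (G : Graph n) where

  e : Fin n → VS n
  e x = full ∖ adj G x ∖ ｛ x ｝

  opaque
    unfolding _∪_

    e-sym : ∀ x y → e x y ≡ e y x
    e-sym x y rewrite adj-sym G x y with x ≟ y | y ≟ x
    ... | yes _ | yes _ = refl
    ... | no _  | no _  = refl
    ... | yes p | no q  = ⊥-elim (q (sym p))
    ... | no p  | yes q = ⊥-elim (p (sym q))

    e-irr : ∀ x → e x x ≡ false
    e-irr x with x ≟ x | adj G x x
    ... | yes _ | true  = refl
    ... | yes _ | false = refl
    ... | no p  | _     = ⊥-elim (p refl)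

  open Graphs e e-sym e-irr

  IsClique⇒≢ : ∀ {k} {f : Fin k → Fin n} → IsClique G f → ∀ i j → i ≢ j → f i ≢ f j
  IsClique⇒≢ {f = f} q i j d r with trans (sym (trans (cong (adj G (f i)) (sym r)) refl)) (q i j d)
  ... | eq with trans (sym (irrefl G (f i))) eq
  ...   | ()

  Ind-image : ∀ {k} {f : Fin k → Fin n} → IsClique G f → Ind (image f)
  Ind-image {f = f} q p p′ a with image⁻ f p | image⁻ f p′
  ... | i , refl | j , refl with i ≟ j
  ...   | yes refl = ∈∖ʳ a ∈｛｝
  ...   | no d     = ∈∖ʳ (∈∖ˡ a) (mem (q i j d))

  Ind⇒clique : ∀ {J} k → Ind J → k ≤ # J → HasClique G k
  Ind⇒clique k j h =
    let f , f∈ , inj = enumerate k h in f , λ a b d → adjacent (j (f∈ a) (f∈ b)) (inj a b d)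
    where
    adjacent : ∀ {x y} → y ∉ e x → x ≢ y → adj G x y ≡ true
    adjacent {x} {y} p d with y ∈? adj G x
    ... | yes (mem q) = q
    ... | no q        = ⊥-elim (p (∈∖ (∈∖ ∈full q) (d ∘ ｛｝⁻)))

  α : CliqueNumberLt G 8 → ∀ {J} → Ind J → # J ≤ 7
  α ω j = ≤-pred (≰⇒> λ h → ω (Ind⇒clique 8 j h))

  -- An independent set meets each clique at most once and has at most 6 vertices left after all
  -- deletions. So the quota a i - 1, with 6 of it at `i₀` reserved for the rest, bounds every
  -- monochromatic clique of `G` of colour i.
  unbroken : ∀ {s} {a : Fin s → ℕ} {i₀ r} → (∀ i → 1 ≤ a i) → a i₀ ≡ 7 → ∑ (λ i → a i ∸ 1) ≡ r + 6 → VArrows G s a → ¬ Br 7 r full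
  unbroken {s} {a} {i₀} {r} a≥1 a₀ sum arrows br = mono (arrows (proj₁ colouring))
    where
    open Colour e e-sym e-irr i₀
    kept : ∀ i → 6 * ι (｛ i₀ ｝ i) ≤ a i ∸ 1
    kept = ι-｛｝≤ (≤-reflexive (sym (cong (_∸ 1) a₀)))
    b : Fin s → ℕ
    b i = a i ∸ 1 ∸ 6 * ι (｛ i₀ ｝ i)
    sum-b : ∑ b ≡ r
    sum-b = +-cancelʳ-≡ 6 _ r (trans (cong (∑ b +_) (sym (∑-ι 6 i₀))) (trans (∑-∸ kept) sum))
    colouring = colour r b sum-b br
    mono : (∃ λ i → Σ (Fin (a i) → Fin n) λ f → IsClique G f × (∀ j → proj₁ colouring (f j) ≡ i)) → ⊥
    mono (i , f , q , h) = 1+n≰n (≤-trans (≤-reflexive (m+[n∸m]≡n (a≥1 i))) (≤-trans (#-image f (IsClique⇒≢ q))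
      (≤-trans (proj₂ colouring {image f} {i} (λ _ → ∈full) (Ind-image q) λ p → let j , r = image⁻ f p in trans (cong (proj₁ colouring) (sym r)) (h j))
        (≤-reflexive (m∸n+n≡m (kept i))))))

theorem5p1 : (s : ℕ) → (a : Fin s → ℕ) →
    (∀ i → 1 ≤ a i) → (∀ i → a i ≤ 7) → (∃ λ i → a i ≡ 7) →
    13 ≤ mOf s a →
    (n : ℕ) → (G : Graph n) → VArrows G s a → CliqueNumberLt G 8 →
    3 * mOf s a ∸ 10 ≤ n
theorem5p1 s a a≥1 _ (i₀ , a₀) m≥13 n G arrows ω with 3 * mOf s a ∸ 10 ≤? n
... | yes h = h
... | no h  = ⊥-elim (Bounded.break e e-sym e-irr (α ω) k small (unbroken {r = 6 + k} a≥1 a₀ sum arrows))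
  where
  open Complement G
  -- With m = 13 + k there are r = m - 7 = 6 + k cliques.
  k = mOf s a ∸ 13
  m≡ : 13 + k ≡ mOf s a
  m≡ = m+[n∸m]≡n m≥13
  sum : ∑ (λ i → a i ∸ 1) ≡ 6 + k + 6
  sum = +-cancelʳ-≡ 1 _ _ (trans (cong (_+ 1) (sym (∑-foldr a))) (trans (sym m≡) (≤-antisym (lin (k ∷ []) [] (κ 13 ⊕ x₀) (κ 6 ⊕ x₀ ⊕ κ 6 ⊕ κ 1)) (lin (k ∷ []) [] (κ 6 ⊕ x₀ ⊕ κ 6 ⊕ κ 1) (κ 13 ⊕ x₀)))))
  small : # (full {n}) ≤ 28 + k * 3
  small = lin (# (full {n}) ∷ n ∷ k ∷ k * 3 ∷ [])
    -- For m = 13 + k the truncated subtraction computes: 10 is taken from the first 13, which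
    -- leaves the 3 in front.
    ((x₀ ≲ x₁ by #≤n full) ∷ (κ 1 ⊕ x₁ ≲ κ 3 ⊕ x₂ ⊕ (κ 13 ⊕ x₂ ⊕ (κ 13 ⊕ x₂ ⊕ κ 0)) by subst (λ m → suc n ≤ 3 * m ∸ 10) (sym m≡) (≰⇒> h))
    ∷ (x₂ ⊕ (x₂ ⊕ (x₂ ⊕ κ 0)) ≲ x₃ by ≤-reflexive (*-comm 3 k)) ∷ []) x₀ (κ 28 ⊕ x₃)
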